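{- For every positive integer $k$, \[\binom{\lfloor k^2/2\rfloor}{\lfloor k^2/4\rfloor}^{k}\left(f^{\lambda_{\lfloor k/2\rfloor\times\lceil k/2\rceil}}\right)^{2k}\;\le\;\big|\mathrm{SAv}_{k^3}(12\cdots(k+1))\big|\;\le\;\left(f^{\lambda_{k^2\times k}}\right)^2 .\]
   Context: Permutations $\pi\in S_n$ are identified with words $\pi(1)\cdots\pi(n)$. For $\tau\in S_m$, entries $\pi(i_1),\ldots,\pi(i_m)$ with $i_1<\cdots<i_m$ form an occurrence of $\tau$ if for all $j,l$, $\pi(i_j)<\pi(i_l)$ iff $\tau(j)<\tau(l)$; $\pi$ avoids $\tau$ if there is no occurrence. A permutation $\pi\in S_n$ strongly avoids $\tau$ if both $\pi$ and $\pi^2$ (square in the group $S_n$, i.e. $\pi\circ\pi$) avoid $\tau$; $\mathrm{SAv}_n(\tau)$ is the set of $\pi\in S_n$ strongly avoiding $\tau$. Here $12\cdots(k+1)$ is the identity permutation of $S_{k+1}$. For positive integers $p,q$, $\lambda_{p\times q}$ is the partition $(q,q,\ldots,q)$ with $p$ parts (a $p\times q$ rectangle) and $f^{\lambda_{p\times q}}$ is the number of standard Young tableaux of that shape, namely $f^{\lambda_{p\times q}}=\frac{(pq)!}{\prod_{i=1}^p\prod_{j=1}^q(i+j-1)}$; for $p=0$ (empty shape) this number is $1$. -}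

module Defs where

open import Data.Nat as ℕ using (ℕ; zero; suc; _+_; _*_; NonZero)
open import Data.Nat.Properties using (m*n≢0)
open import Data.Fin as Fin using (Fin)
open import Data.Fin.Properties using (any?; all?; _≟_; _<?_)
open import Data.Vec as Vec using (Vec; []; _∷_; lookup; tabulate)
open import Data.List as List using (List; length; filter; concatMap)
open import Data.Product using (Σ; ∃; _×_; _,_)
open import Relation.Nullary using (Dec; ¬_; yes; no)
open import Relation.Nullary.Decidable using (map′; _×-dec_; _→-dec_; ¬?)
open import Relation.Binary.PropositionalEquality using (_≡_)

-- Permutations of S_n as words π(1)⋯π(n), positions and values in Fin n
-- (0-based). A word is a permutation iff it is injective.

Word : ℕ → Set
Word n = Vec (Fin n) n

IsPerm : ∀ {n} → Word n → Set
IsPerm {n} w = (i j : Fin n) → lookup w i ≡ lookup w j → i ≡ j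

square : ∀ {n} → Word n → Word n
square w = tabulate (λ i → lookup w (lookup w i))

Occurrence : ∀ {m n} → Vec (Fin m) m → Word n → Vec (Fin n) m → Set
Occurrence {m} τ π is =
  ((j l : Fin m) → j Fin.< l → lookup is j Fin.< lookup is l) ×
  ((j l : Fin m) →
     ((lookup π (lookup is j) Fin.< lookup π (lookup is l)) → lookup τ j Fin.< lookup τ l) ×
     (lookup τ j Fin.< lookup τ l → lookup π (lookup is j) Fin.< lookup π (lookup is l)))

Avoids : ∀ {m n} → Word n → Vec (Fin m) m → Set
Avoids {m} {n} π τ = ¬ (Σ (Vec (Fin n) m) λ is → Occurrence τ π is)

StronglyAvoids : ∀ {m n} → Word n → Vec (Fin m) m → Set
StronglyAvoids π τ = Avoids π τ × Avoids (square π) τ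

identityPattern : (m : ℕ) → Vec (Fin m) m
identityPattern m = Vec.allFin m

vec-any? : ∀ {n} m {P : Vec (Fin n) m → Set} → ((v : Vec (Fin n) m) → Dec (P v)) → Dec (∃ P)
vec-any? zero P? = map′ (λ p → [] , p) (λ { ([] , p) → p }) (P? [])
vec-any? (suc m) {P} P? =
  map′ (λ { (i , v , p) → i ∷ v , p }) (λ { (i ∷ v , p) → i , v , p })
       (any? λ i → vec-any? m (λ v → P? (i ∷ v)))

isPerm? : ∀ {n} (w : Word n) → Dec (IsPerm w)
isPerm? w = all? λ i → all? λ j → (lookup w i ≟ lookup w j) →-dec (i ≟ j)

occurrence? : ∀ {m n} (τ : Vec (Fin m) m) (π : Word n) (is : Vec (Fin n) m) → Dec (Occurrence τ π is)
occurrence? τ π is =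
  (all? λ j → all? λ l → (j <? l) →-dec (lookup is j <? lookup is l)) ×-dec
  (all? λ j → all? λ l →
     ((lookup π (lookup is j) <? lookup π (lookup is l)) →-dec (lookup τ j <? lookup τ l)) ×-dec
     ((lookup τ j <? lookup τ l) →-dec (lookup π (lookup is j) <? lookup π (lookup is l))))

avoids? : ∀ {m n} (π : Word n) (τ : Vec (Fin m) m) → Dec (Avoids π τ)
avoids? {m} π τ = ¬? (vec-any? m (occurrence? τ π))

sav? : ∀ {m n} (τ : Vec (Fin m) m) (π : Word n) → Dec (IsPerm π × StronglyAvoids π τ)
sav? τ π = isPerm? π ×-dec (avoids? π τ ×-dec avoids? (square π) τ)

allVecs : (n m : ℕ) → List (Vec (Fin n) m)
allVecs n zero = List.[ [] ]
allVecs n (suc m) = concatMap (λ i → List.map (i ∷_) (allVecs n m)) (List.allFin n)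

#SAv : ∀ {m} (n : ℕ) → Vec (Fin m) m → ℕ
#SAv n τ = length (filter (sav? τ) (allVecs n n))

-- f^{λ_{p×q}} via the hook length formula (pq)! / ∏_{i≤p} ∏_{j≤q} (i+j-1)

rowProd : ℕ → ℕ → ℕ
rowProd i zero = 1
rowProd i (suc q) = rowProd i q * suc (i + q)

hookProd : ℕ → ℕ → ℕ
hookProd zero q = 1
hookProd (suc p) q = hookProd p q * rowProd p q

rowProd≢0 : ∀ i q → NonZero (rowProd i q)
rowProd≢0 i zero = _
rowProd≢0 i (suc q) = m*n≢0 (rowProd i q) (suc (i + q)) {{rowProd≢0 i q}}

hookProd≢0 : ∀ p q → NonZero (hookProd p q)
hookProd≢0 zero q = _
hookProd≢0 (suc p) q = m*n≢0 (hookProd p q) (rowProd p q) {{hookProd≢0 p q}} {{rowProd≢0 p q}}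

fRect : ℕ → ℕ → ℕ
fRect p q = ℕ._/_ ((p * q) ℕ.!) (hookProd p q) {{hookProd≢0 p q}}

{-# OPTIONS --safe #-}
module Submission where

-- Upper bound.  A permutation π of [k³] strongly avoiding 12⋯(k+1) has no ascending chain of k+1
-- entries, and no descending chain of k²+1 entries: by Erdős–Szekeres, π maps the values of such a
-- chain with a long ascent (an ascent of π) or a long descent (an ascent of π²).  Labelling every
-- position by the lengths of the longest descending and ascending chains ending there is therefore a
-- bijection with the cells of the k² × k rectangle, and in these coordinates positions and (with the
-- rows reversed) values form two standard tableaux, which determine π.  Rectangular tableaux are
-- counted by lattice words, whose number satisfies the recurrence of the determinant det ((l_i)_j)
-- of falling factorials, and this gives the hook length formula.
--
-- Lower bound.  Order the points (b , i , j) of [k]³ so that along every row i and every column j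
-- they are sorted by the layer b first, and so that each layer is symmetric under the half turn
-- (i , j) ↦ (k-1-i , k-1-j).  Conjugating (b , i , j) ↦ (k-1-b , j , k-1-i) by such an order gives a
-- permutation that decreases on every column and whose square decreases on every layer, so it
-- strongly avoids 12⋯(k+1); conversely it determines the order.  Write k = p + e + p with e ≤ 1.
-- A layer starts with a tableau on its p × (p+e) corner and ends with the half turn of it; in between,
-- a p × p block is shuffled symmetrically with its half turn in one of 2^(p²) ways.  Transposing every
-- second layer, the end of a layer and the start of the next one share no row or column and
-- may be shuffled freely.  With m = p (p+e) this yields (f_{p×(p+e)} f_{p×p} 2^(p²))^k C(2m,m)^(k-1)
-- orders, and (f_{p×p} 2^(p²))^k ≥ C(2m,m) f_{p×(p+e)}^k because f_{p×(p+1)} ≤ p^p f_{p×p}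
-- (for odd k with p ≤ 2 by evaluation).

open import Defs
open import Data.Nat as ℕ using (ℕ; zero; suc; pred; _∸_; _^_; _≤_; _<_; _/_; _<ᵇ_; _!; z≤n; s≤s; z<s; s<s; ⌊_/2⌋; ⌈_/2⌉)
import Data.Nat.Properties as ℕₚ
import Data.Nat.DivMod as DivMod
open import Data.Nat.Combinatorics using (_C_; nCk+nC[k+1]≡[n+1]C[k+1]; nCn≡1)
open import Data.Nat.Divisibility using (divides)
open import Data.Bool using (Bool; true; false; not; T; if_then_else_)
open import Data.Fin as F using (Fin; zero; suc; toℕ; fromℕ<; opposite; punchOut; splitAt; _↑ˡ_; _↑ʳ_; combine; remQuot; finToFun; funToFin)
import Data.Fin.Properties as Fₚ
open import Data.List as List using (List; []; _∷_; _++_; length)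
open import Data.Vec using (Vec; []; _∷_; lookup; tabulate; replicate)
import Data.Vec.Properties as Vecₚ
open import Data.Product using (Σ; ∃; _×_; _,_; proj₁; proj₂)
open import Data.Sum using (_⊎_; inj₁; inj₂)
open import Data.Unit using (⊤; tt)
open import Data.Empty using (⊥)
open import Function using (_∘_)
open import Relation.Nullary using (Dec; yes; no; contradiction; ¬_)
open import Relation.Nullary.Decidable using (_×-dec_)
open import Relation.Binary using (tri<; tri≈; tri>)
open import Relation.Binary.PropositionalEquality

-- The length k³ is exactly the number of cells of the k² × k rectangle, so the injection of
-- positions into pairs of labels has no room to spare; without this tightness the labels would not
-- fill a rectangle. For the lower bound, increasing runs are excluded by colouring: there are k
-- columns and k layers, so among k+1 entries two share a colour, and the permutation (respectively
-- its square) reverses the order inside each colour. The square of the conjugated map is the half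
-- turn of every layer, and this is what forces the symmetry. The symmetry has a price. The last
-- corner of a layer is determined by the first, so a layer offers one p × (p+e) tableau where the
-- bound asks for two; and k layers have only k-1 interfaces where the bound asks for k binomials.
-- The p × p block away from the main diagonal, shuffled with its half turn, has to pay for both
-- losses, and the numerical inequality at the end says that it does.

-- Determinants of falling factorials.

module Determinants where

  open import Data.Integer using (ℤ; +_; _+_; _*_; _-_; -_; 0ℤ; 1ℤ)
  import Data.Integer.Properties as ℤₚ
  open import Data.Integer.Tactic.RingSolver using (solve-∀)
  open import Data.List using (map)

  -- ι φ contracts the first row φ of a determinant against the remaining minors G
  -- of the column list, so iterating it is the Laplace expansion along rows.
  ι : (ℕ → ℤ) → (List ℕ → ℤ) → List ℕ → ℤ
  ι φ G []       = 0ℤ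
  ι φ G (j ∷ js) = φ j * G js - ι φ (λ r → G (j ∷ r)) js

  detRows : List (ℕ → ℤ) → List ℕ → ℤ
  detRows []       []      = 1ℤ
  detRows []       (_ ∷ _) = 0ℤ
  detRows (φ ∷ φs) js      = ι φ (detRows φs) js

  ι-cong : ∀ {φ ψ G H} → (∀ j → φ j ≡ ψ j) → (∀ js → G js ≡ H js) → ∀ js → ι φ G js ≡ ι ψ H js
  ι-cong e f []       = refl
  ι-cong e f (j ∷ js) = cong₂ _-_ (cong₂ _*_ (e j) (f js)) (ι-cong e (λ r → f (j ∷ r)) js)

  ι-zero : ∀ {φ G} → (∀ js → G js ≡ 0ℤ) → ∀ js → ι φ G js ≡ 0ℤ
  ι-zero z []       = refl
  ι-zero {φ} z (j ∷ js)
    rewrite z js | ι-zero {φ} (λ r → z (j ∷ r)) js | ℤₚ.*-zeroʳ (φ j) = refl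

  ι-linear : ∀ φ a G H js → ι φ (λ r → a * G r + H r) js ≡ a * ι φ G js + ι φ H js
  ι-linear φ a G H []       = lemma a
    where
    lemma : ∀ a → 0ℤ ≡ a * 0ℤ + 0ℤ
    lemma = solve-∀
  ι-linear φ a G H (j ∷ js)
    rewrite ι-linear φ a (λ r → G (j ∷ r)) (λ r → H (j ∷ r)) js =
      lemma a (φ j) (G js) (H js) _ _
    where
    lemma : ∀ a f g h u v → f * (a * g + h) - (a * u + v) ≡ a * (f * g - u) + (f * h - v)
    lemma = solve-∀

  ι-scale : ∀ φ a G js → ι φ (λ r → a * G r) js ≡ a * ι φ G js
  ι-scale φ a G []       = sym (ℤₚ.*-zeroʳ a)
  ι-scale φ a G (j ∷ js) rewrite ι-scale φ a (λ r → G (j ∷ r)) js =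
    lemma a (φ j) (G js) _
    where
    lemma : ∀ a f g u → f * (a * g) - a * u ≡ a * (f * g - u)
    lemma = solve-∀

  ι-row-plus : ∀ φ ψ G js → ι (λ j → φ j + ψ j) G js ≡ ι φ G js + ι ψ G js
  ι-row-plus φ ψ G []       = refl
  ι-row-plus φ ψ G (j ∷ js) rewrite ι-row-plus φ ψ (λ r → G (j ∷ r)) js =
    lemma (φ j) (ψ j) (G js) _ _
    where
    lemma : ∀ f f′ g u v → (f + f′) * g - (u + v) ≡ (f * g - u) + (f′ * g - v)
    lemma = solve-∀

  -- Splitting off the column `j` leaves two terms with the factor `φ j`, which cancel, and the same
  -- claim on fewer columns. This is the vanishing of a determinant with two equal adjacent rows,
  -- the only form of alternation that is used.
  ι²≡0 : ∀ φ G js → ι φ (ι φ G) js ≡ 0ℤ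
  ι²≡0 φ G []       = refl
  ι²≡0 φ G (j ∷ js) = begin
    φ j * ι φ G js - ι φ (λ r → φ j * G r - ι φ (λ s → G (j ∷ s)) r) js
      ≡⟨ cong (λ z → φ j * ι φ G js - z) (ι-cong (λ _ → refl) (λ r → lemma₁ (φ j) (G r) _) js) ⟩
    φ j * ι φ G js - ι φ (λ r → φ j * G r + (- 1ℤ) * ι φ (λ s → G (j ∷ s)) r) js
      ≡⟨ cong (λ z → φ j * ι φ G js - z) (ι-linear φ (φ j) G _ js) ⟩
    φ j * ι φ G js - (φ j * ι φ G js + ι φ (λ r → (- 1ℤ) * ι φ (λ s → G (j ∷ s)) r) js)
      ≡⟨ cong (λ z → φ j * ι φ G js - (φ j * ι φ G js + z))
              (trans (ι-scale φ (- 1ℤ) _ js) (cong (λ z → (- 1ℤ) * z) (ι²≡0 φ (λ s → G (j ∷ s)) js))) ⟩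
    φ j * ι φ G js - (φ j * ι φ G js + (- 1ℤ) * 0ℤ)
      ≡⟨ lemma₂ (φ j * ι φ G js) ⟩
    0ℤ ∎
    where
    open ≡-Reasoning
    lemma₁ : ∀ f g u → f * g - u ≡ f * g + (- 1ℤ) * u
    lemma₁ = solve-∀
    lemma₂ : ∀ a → a - (a + (- 1ℤ) * 0ℤ) ≡ 0ℤ
    lemma₂ = solve-∀

  -- The truncation of `pred` at 0 is harmless, because the factor `+ x` is zero there.
  fall : ℕ → ℕ → ℤ
  fall x zero    = 1ℤ
  fall x (suc j) = + x * fall (pred x) j

  fall-suc : ∀ x j → fall x (suc j) ≡ (+ x - + j) * fall x j
  fall-suc x       zero    = lemma (+ x)
    where
    lemma : ∀ x → x * 1ℤ ≡ (x - 0ℤ) * 1ℤ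
    lemma = solve-∀
  fall-suc zero    (suc j) = lemma (+ suc j)
    where
    lemma : ∀ j → 0ℤ ≡ (0ℤ - j) * 0ℤ
    lemma = solve-∀
  fall-suc (suc x) (suc j) rewrite fall-suc x j = lemma (+ x) (+ j) (fall x j)
    where
    lemma : ∀ x j f → (1ℤ + x) * ((x - j) * f) ≡ ((1ℤ + x) - (1ℤ + j)) * ((1ℤ + x) * f)
    lemma = solve-∀

  det : List ℕ → List ℕ → ℤ
  det xs = detRows (map fall xs)

  total : List ℕ → ℤ
  total []       = 0ℤ
  total (x ∷ xs) = + x + total xs

  -- The derivation behind the removal of a corner. The weight `+ x` is the quotient of `x !` by
  -- `pred x !`, and at `x = 0` it cancels the junk value of `pred`.
  lowerSum : (List ℕ → ℤ) → List ℕ → ℤ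
  lowerSum G []       = 0ℤ
  lowerSum G (x ∷ xs) = + x * G (pred x ∷ xs) + lowerSum (λ r → G (x ∷ r)) xs

  lowerSum-ι : ∀ φ (G : List ℕ → List ℕ → ℤ) xs js →
    lowerSum (λ ys → ι φ (G ys) js) xs ≡ ι φ (λ r → lowerSum (λ ys → G ys r) xs) js
  lowerSum-ι φ G []       js = sym (ι-zero {φ} (λ _ → refl) js)
  lowerSum-ι φ G (x ∷ xs) js = trans
    (cong (λ z → + x * ι φ (G (pred x ∷ xs)) js + z) (lowerSum-ι φ (λ r → G (x ∷ r)) xs js))
    (sym (ι-linear φ (+ x) _ _ js))

  -- Lowering the row `x` with weight `x` multiplies its entry in column `j` by `x - j`, so in each
  -- Laplace term the factors add up to the row total minus the column total. `a` stands for the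
  -- total of the remaining rows; it is a free integer because skipping the column `j` subtracts `j`
  -- from it.
  fall-step : ∀ x G a js →
    + x * ι (fall (pred x)) G js + ι (fall x) (λ r → (a - total r) * G r) js
      ≡ (+ x + a - total js) * ι (fall x) G js
  fall-step x G a []       = lemma (+ x) a
    where
    lemma : ∀ x a → x * 0ℤ + 0ℤ ≡ (x + a - 0ℤ) * 0ℤ
    lemma = solve-∀
  fall-step x G a (j ∷ js) = begin
    + x * (fall (pred x) j * G js - u) + (fall x j * ((a - t) * G js) - v)
      ≡⟨ lemma₁ (+ x) (fall (pred x) j) (G js) u (fall x j) (a - t) v ⟩
    (+ x * fall (pred x) j) * G js + fall x j * ((a - t) * G js) - (+ x * u + v)
      ≡⟨ cong₂ (λ y z → y * G js + fall x j * ((a - t) * G js) - z) (fall-suc x j)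
           (trans (cong (λ z → + x * u + z) (ι-cong (λ _ → refl) (λ r → cong (_* G (j ∷ r)) (lemma₂ a (+ j) (total r))) js))
                  (fall-step x (λ r → G (j ∷ r)) (a - + j) js)) ⟩
    (+ x - + j) * fall x j * G js + fall x j * ((a - t) * G js) - (+ x + (a - + j) - t) * w
      ≡⟨ lemma₃ (+ x) (+ j) (fall x j) (G js) a t w ⟩
    (+ x + a - (+ j + t)) * (fall x j * G js - w) ∎
    where
    open ≡-Reasoning
    t = total js
    u = ι (fall (pred x)) (λ r → G (j ∷ r)) js
    v = ι (fall x) (λ r → (a - (+ j + total r)) * G (j ∷ r)) js
    w = ι (fall x) (λ r → G (j ∷ r)) js
    lemma₁ : ∀ x f g u f′ b v → x * (f * g - u) + (f′ * (b * g) - v) ≡ (x * f) * g + f′ * (b * g) - (x * u + v)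
    lemma₁ = solve-∀
    lemma₂ : ∀ a j t → a - (j + t) ≡ (a - j) - t
    lemma₂ = solve-∀
    lemma₃ : ∀ x j f g a t w →
      (x - j) * f * g + f * ((a - t) * g) - (x + (a - j) - t) * w ≡ (x + a - (j + t)) * (f * g - w)
    lemma₃ = solve-∀

  -- The recurrence f^λ = ∑ f^(λ minus a corner) in determinantal form.
  lowerSum-det : ∀ xs js → lowerSum (λ ys → det ys js) xs ≡ (total xs - total js) * det xs js
  lowerSum-det []       []       = refl
  lowerSum-det []       (j ∷ js) = sym (ℤₚ.*-zeroʳ (0ℤ - total (j ∷ js)))
  lowerSum-det (x ∷ xs) js = trans
    (cong (λ z → + x * det (pred x ∷ xs) js + z)
      (trans (lowerSum-ι (fall x) det xs js)
             (ι-cong (λ _ → refl) (lowerSum-det xs) js)))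
    (fall-step x (det xs) (total xs) js)

  down : ℕ → ℕ → List ℕ
  down q zero    = []
  down q (suc p) = (q ℕ.+ p) ∷ down q p

  falldiff : ℕ → ℕ → ℤ
  falldiff x zero    = 0ℤ
  falldiff x (suc j) = + suc j * fall x j

  fall-split : ∀ x j → fall (suc x) j ≡ falldiff x j + fall x j
  fall-split x zero    = refl
  fall-split x (suc j) rewrite fall-suc x j = lemma (+ x) (+ j) (fall x j)
    where
    lemma : ∀ x j f → (1ℤ + x) * f ≡ (1ℤ + j) * f + (x - j) * f
    lemma = solve-∀

  diffRows : ℕ → ℕ → List (ℕ → ℤ)
  diffRows q p = map falldiff (down q p) ++ fall q ∷ []

  -- Each row is replaced by its difference from the row below it: the part split off repeats the
  -- next row and dies by `ι²≡0`. The last row has nothing below it and stays.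
  det-down-diff : ∀ q p js → det (down q (suc p)) js ≡ detRows (diffRows q p) js
  det-down-diff q zero    js rewrite ℕₚ.+-identityʳ q = refl
  det-down-diff q (suc p) js rewrite ℕₚ.+-suc q p = begin
    ι (fall (suc (q ℕ.+ p))) (ι (fall (q ℕ.+ p)) G) js
      ≡⟨ ι-cong (fall-split (q ℕ.+ p)) (λ _ → refl) js ⟩
    ι (λ j → falldiff (q ℕ.+ p) j + fall (q ℕ.+ p) j) (ι (fall (q ℕ.+ p)) G) js
      ≡⟨ ι-row-plus (falldiff (q ℕ.+ p)) (fall (q ℕ.+ p)) _ js ⟩
    ι (falldiff (q ℕ.+ p)) (ι (fall (q ℕ.+ p)) G) js + ι (fall (q ℕ.+ p)) (ι (fall (q ℕ.+ p)) G) js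
      ≡⟨ cong₂ _+_ (ι-cong (λ _ → refl) (det-down-diff q p) js) (ι²≡0 (fall (q ℕ.+ p)) G js) ⟩
    detRows (diffRows q (suc p)) js + 0ℤ
      ≡⟨ ℤₚ.+-identityʳ _ ⟩
    detRows (diffRows q (suc p)) js ∎
    where
    open ≡-Reasoning
    G = det (down q p)

  prodSuc : List ℕ → ℤ
  prodSuc []       = 1ℤ
  prodSuc (j ∷ js) = + suc j * prodSuc js

  shift : List ℕ → List ℕ
  shift js = map suc js ++ 0 ∷ []

  -- The difference of a falling factorial is zero in column 0 and in column `suc j` is `suc j`
  -- times an entry of column `j`; this factor depends on the column only and comes out of the
  -- determinant.
  ι-shift : ∀ x G H → (∀ r → G (shift r) ≡ prodSuc r * H r) →
    ∀ js → ι (falldiff x) G (shift js) ≡ prodSuc js * ι (fall x) H js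
  ι-shift x G H e []       = refl
  ι-shift x G H e (j ∷ js) = begin
    + suc j * fall x j * G (shift js) - ι (falldiff x) (λ r → G (suc j ∷ r)) (shift js)
      ≡⟨ cong₂ (λ y z → + suc j * fall x j * y - z) (e js)
           (ι-shift x (λ r → G (suc j ∷ r)) (λ r → + suc j * H (j ∷ r))
             (λ r → trans (e (j ∷ r)) (lemma₁ (+ suc j) (prodSuc r) (H (j ∷ r)))) js) ⟩
    + suc j * fall x j * (prodSuc js * H js) - prodSuc js * ι (fall x) (λ r → + suc j * H (j ∷ r)) js
      ≡⟨ cong (λ z → + suc j * fall x j * (prodSuc js * H js) - prodSuc js * z) (ι-scale (fall x) (+ suc j) _ js) ⟩
    + suc j * fall x j * (prodSuc js * H js) - prodSuc js * (+ suc j * w)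
      ≡⟨ lemma₂ (+ suc j) (fall x j) (prodSuc js) (H js) w ⟩
    + suc j * prodSuc js * (fall x j * H js - w) ∎
    where
    open ≡-Reasoning
    w = ι (fall x) (λ r → H (j ∷ r)) js
    lemma₁ : ∀ j p h → (j * p) * h ≡ p * (j * h)
    lemma₁ = solve-∀
    lemma₂ : ∀ j f p h w → j * f * (p * h) - p * (j * w) ≡ j * p * (f * h - w)
    lemma₂ = solve-∀

  detRows-[]-++ : ∀ js j → detRows [] (js ++ j ∷ []) ≡ 0ℤ
  detRows-[]-++ []       j = refl
  detRows-[]-++ (_ ∷ js) j = refl

  -- Column 0 vanishes in all difference rows and has the entry 1 in the last row, so that row
  -- enters only through this 1 and `q` may be arbitrary.
  det-shift : ∀ q xs js →
    detRows (map falldiff xs ++ fall q ∷ []) (shift js) ≡ prodSuc js * det xs js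
  det-shift q []       []       = refl
  det-shift q []       (j ∷ js)
    rewrite detRows-[]-++ (map suc js) 0
          | ι-zero {fall q} {λ r → 0ℤ} (λ _ → refl) (shift js) = lemma (fall q (suc j)) (prodSuc (j ∷ js))
    where
    lemma : ∀ f p → f * 0ℤ - 0ℤ ≡ p * 0ℤ
    lemma = solve-∀
  det-shift q (x ∷ xs) js = ι-shift x _ _ (det-shift q xs) js

  down-shift : ∀ p → down 0 (suc p) ≡ shift (down 0 p)
  down-shift zero    = refl
  down-shift (suc p) = cong (suc p ∷_) (down-shift p)

  superfact : ℕ → ℕ
  superfact zero    = 1
  superfact (suc p) = p ℕ.! ℕ.* superfact p

  prodSuc-down : ∀ p → prodSuc (down 0 p) ≡ + (p ℕ.!)
  prodSuc-down zero    = refl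
  prodSuc-down (suc p) = trans (cong (+ suc p *_) (prodSuc-down p)) (sym (ℤₚ.pos-* (suc p) (p ℕ.!)))

  -- A Vandermonde determinant at consecutive points: differencing and shifting reduce it to the
  -- same determinant of the next smaller size.
  det-down : ∀ q p → det (down q p) (down 0 p) ≡ + superfact p
  det-down q zero    = refl
  det-down q (suc p) = begin
    det (down q (suc p)) (down 0 (suc p))          ≡⟨ cong (det (down q (suc p))) (down-shift p) ⟩
    det (down q (suc p)) (shift (down 0 p))        ≡⟨ det-down-diff q p _ ⟩
    detRows (diffRows q p) (shift (down 0 p))      ≡⟨ det-shift q (down q p) (down 0 p) ⟩
    prodSuc (down 0 p) * det (down q p) (down 0 p) ≡⟨ cong₂ _*_ (prodSuc-down p) (det-down q p) ⟩
    + (p ℕ.!) * + superfact p                      ≡⟨ ℤₚ.pos-* (p ℕ.!) (superfact p) ⟨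
    + superfact (suc p)                            ∎
    where open ≡-Reasoning

-- Lattice words and the hook length formula for rectangles.

module HookLength where

  open Determinants
  open import Data.Integer using (ℤ; +_; _+_; _*_; _-_; -_; 0ℤ)
  import Data.Integer.Properties as ℤₚ
  open import Data.Integer.Tactic.RingSolver using (solve-∀)

  ∑ : ∀ {p} → (Fin p → ℕ) → ℕ
  ∑ {zero}  g = 0
  ∑ {suc p} g = g zero ℕ.+ ∑ (g ∘ suc)

  head₀ : ∀ {p} → Vec ℕ p → ℕ
  head₀ []      = 0
  head₀ (x ∷ _) = x

  removable : ∀ {p} → Vec ℕ p → Fin p → Bool
  removable (x ∷ v) zero    = head₀ v <ᵇ x
  removable (x ∷ v) (suc i) = removable v i

  remove : ∀ {p} → Vec ℕ p → Fin p → Vec ℕ p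
  remove (x ∷ v) zero    = pred x ∷ v
  remove (x ∷ v) (suc i) = x ∷ remove v i

  -- Standard Young tableaux of shape v with n cells, counted through their lattice words.
  #words : ∀ {p} → ℕ → Vec ℕ p → ℕ
  #words zero    v = 1
  #words (suc n) v = ∑ λ i → if removable v i then #words n (remove v i) else 0

  Partition : ∀ {p} → Vec ℕ p → Set
  Partition []      = ⊤
  Partition (x ∷ v) = head₀ v ℕ.≤ x × Partition v

  size : ∀ {p} → Vec ℕ p → ℕ
  size []      = 0
  size (x ∷ v) = x ℕ.+ size v

  head₀-remove : ∀ {p} (v : Vec ℕ p) i → head₀ (remove v i) ℕ.≤ head₀ v
  head₀-remove (x ∷ v) zero    = ℕₚ.pred[n]≤n
  head₀-remove (x ∷ v) (suc i) = ℕₚ.≤-refl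

  remove-partition : ∀ {p} (v : Vec ℕ p) i → Partition v → T (removable v i) → Partition (remove v i)
  remove-partition (x ∷ v) zero    (_ , pv) t = ℕₚ.<⇒≤pred (ℕₚ.<ᵇ⇒< (head₀ v) x t) , pv
  remove-partition (x ∷ v) (suc i) (h , pv) t =
    ℕₚ.≤-trans (head₀-remove v i) h , remove-partition v i pv t

  remove-size : ∀ {p} (v : Vec ℕ p) i → T (removable v i) → suc (size (remove v i)) ≡ size v
  remove-size (zero ∷ v)  zero    t = contradiction (ℕₚ.<ᵇ⇒< (head₀ v) 0 t) λ ()
  remove-size (suc x ∷ v) zero    t = refl
  remove-size (x ∷ v)     (suc i) t =
    trans (sym (ℕₚ.+-suc x _)) (cong (x ℕ.+_) (remove-size v i t))

  -- The hook lengths of the first column. They are strictly decreasing for a partition, and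
  -- shortening a row that equals the next one makes two of them collide.
  beta : ∀ {p} → Vec ℕ p → List ℕ
  beta []              = []
  beta {suc p} (x ∷ v) = (x ℕ.+ p) ∷ beta v

  factorials : List ℕ → ℕ
  factorials []       = 1
  factorials (x ∷ xs) = x ℕ.! ℕ.* factorials xs

  det-repeat : ∀ pre x post js → det (pre ++ x ∷ x ∷ post) js ≡ 0ℤ
  det-repeat []        x post js = ι²≡0 (fall x) (det post) js
  det-repeat (y ∷ pre) x post js = ι-zero (det-repeat pre x post) js

  -- Generalised for an induction over the rows: `X` collects the factorials of the rows already
  -- passed, and `c` and `G` have these rows fixed. A row that is not removable gives 0 on the left;
  -- on the right its lowered number equals the next one, so `alt` kills the term, or it is an empty
  -- last row, whose weight is 0.
  #words-step : ∀ {p} (v : Vec ℕ p) (c : Vec ℕ p → ℕ) (G : List ℕ → ℤ) (X M : ℕ) → Partition v →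
    (∀ pre x post → G (pre ++ x ∷ x ∷ post) ≡ 0ℤ) →
    (∀ i → T (removable v i) →
       + c (remove v i) * + (X ℕ.* factorials (beta (remove v i))) ≡ + M * G (beta (remove v i))) →
    + ∑ (λ i → if removable v i then c (remove v i) else 0) * + (X ℕ.* factorials (beta v))
      ≡ + M * lowerSum G (beta v)
  #words-step [] c G X M _ _ _ = sym (ℤₚ.*-zeroʳ (+ M))
  #words-step {suc p} (x ∷ v) c G X M (h≤x , pv) alt rel = begin
    + (t ℕ.+ s) * + (X ℕ.* (b ℕ.! ℕ.* f))
      ≡⟨ cong₂ _*_ (ℤₚ.pos-+ t s) (cong +_ (sym (ℕₚ.*-assoc X (b ℕ.!) f))) ⟩
    (+ t + + s) * + (X ℕ.* b ℕ.! ℕ.* f)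
      ≡⟨ ℤₚ.*-distribʳ-+ (+ (X ℕ.* b ℕ.! ℕ.* f)) (+ t) (+ s) ⟩
    + t * + (X ℕ.* b ℕ.! ℕ.* f) + + s * + (X ℕ.* b ℕ.! ℕ.* f)
      ≡⟨ cong₂ _+_ (head-term x v h≤x rel (removable (x ∷ v) zero) refl)
           (#words-step v (λ r → c (x ∷ r)) (λ r → G (b ∷ r)) (X ℕ.* b ℕ.!) M pv
             (λ pre → alt (b ∷ pre))
             (λ i ok → trans (cong (λ z → + c (x ∷ remove v i) * + z) (ℕₚ.*-assoc X (b ℕ.!) _)) (rel (suc i) ok))) ⟩
    + M * (+ b * G (pred b ∷ beta v)) + + M * lowerSum (λ r → G (b ∷ r)) (beta v)
      ≡⟨ ℤₚ.*-distribˡ-+ (+ M) _ _ ⟨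
    + M * (+ b * G (pred b ∷ beta v) + lowerSum (λ r → G (b ∷ r)) (beta v)) ∎
    where
    open ≡-Reasoning
    b = x ℕ.+ p
    f = factorials (beta v)
    t = if removable (x ∷ v) zero then c (remove (x ∷ v) zero) else 0
    s = ∑ (λ i → if removable v i then c (x ∷ remove v i) else 0)

    zero-case : ∀ x {p} (v : Vec ℕ p) (G : List ℕ → ℤ) → (∀ pre x post → G (pre ++ x ∷ x ∷ post) ≡ 0ℤ) →
      head₀ v ℕ.≤ x → (head₀ v <ᵇ x) ≡ false → + (x ℕ.+ p) * G (pred (x ℕ.+ p) ∷ beta v) ≡ 0ℤ
    zero-case zero    []      G alt h e = refl
    zero-case (suc x) []      G alt h ()
    zero-case x {suc p} (y ∷ v) G alt h e with ℕₚ.≤-antisym h (ℕₚ.≮⇒≥ (λ y<x → subst T e (ℕₚ.<⇒<ᵇ y<x)))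
    ... | refl rewrite ℕₚ.+-suc y p | alt [] (y ℕ.+ p) (beta v) = ℤₚ.*-zeroʳ (+ suc (y ℕ.+ p))

    head-term : ∀ x v → head₀ v ℕ.≤ x →
      (∀ i → T (removable (x ∷ v) i) →
        + c (remove (x ∷ v) i) * + (X ℕ.* factorials (beta (remove (x ∷ v) i))) ≡ + M * G (beta (remove (x ∷ v) i))) →
      ∀ ok → removable (x ∷ v) zero ≡ ok →
      + (if ok then c (remove (x ∷ v) zero) else 0) * + (X ℕ.* (x ℕ.+ p) ℕ.! ℕ.* factorials (beta v))
        ≡ + M * (+ (x ℕ.+ p) * G (pred (x ℕ.+ p) ∷ beta v))
    head-term x v h rel false e =
      sym (trans (cong (+ M *_) (zero-case x v G alt h e)) (ℤₚ.*-zeroʳ (+ M)))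
    head-term zero v h rel true e = contradiction (ℕₚ.<ᵇ⇒< (head₀ v) 0 (subst T (sym e) tt)) λ ()
    head-term (suc x) v h rel true e = begin
      + C * + (X ℕ.* (suc (x ℕ.+ p) ℕ.* (x ℕ.+ p) ℕ.!) ℕ.* φ)
        ≡⟨ cong (λ z → + C * z) (trans (cong +_ (shuffle X (suc (x ℕ.+ p)) ((x ℕ.+ p) ℕ.!) φ))
                                       (ℤₚ.pos-* (suc (x ℕ.+ p)) _)) ⟩
      + C * (+ suc (x ℕ.+ p) * + (X ℕ.* ((x ℕ.+ p) ℕ.! ℕ.* φ)))
        ≡⟨ swap (+ C) (+ suc (x ℕ.+ p)) _ ⟩
      + suc (x ℕ.+ p) * (+ C * + (X ℕ.* ((x ℕ.+ p) ℕ.! ℕ.* φ)))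
        ≡⟨ cong (+ suc (x ℕ.+ p) *_) (rel zero (subst T (sym e) tt)) ⟩
      + suc (x ℕ.+ p) * (+ M * G ((x ℕ.+ p) ∷ beta v))
        ≡⟨ swap (+ suc (x ℕ.+ p)) (+ M) _ ⟩
      + M * (+ suc (x ℕ.+ p) * G ((x ℕ.+ p) ∷ beta v)) ∎
      where
      C = c (x ∷ v)
      φ = factorials (beta v)
      swap : ∀ a b d → a * (b * d) ≡ b * (a * d)
      swap = solve-∀
      shuffle : ∀ X s y φ → X ℕ.* (s ℕ.* y) ℕ.* φ ≡ s ℕ.* (X ℕ.* (y ℕ.* φ))
      shuffle X s y φ = trans (ℕₚ.*-assoc X (s ℕ.* y) φ) (trans (cong (X ℕ.*_) (ℕₚ.*-assoc s y φ))
        (trans (sym (ℕₚ.*-assoc X s _)) (trans (cong (ℕ._* (y ℕ.* φ)) (ℕₚ.*-comm X s)) (ℕₚ.*-assoc s X _))))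

  beta-empty : ∀ {p} (v : Vec ℕ p) → size v ≡ 0 → beta v ≡ down 0 p
  beta-empty []         e = refl
  beta-empty (zero ∷ v) e = cong (_ ∷_) (beta-empty v e)

  factorials-down : ∀ p → factorials (down 0 p) ≡ superfact p
  factorials-down zero    = refl
  factorials-down (suc p) = cong (p ℕ.! ℕ.*_) (factorials-down p)

  total-beta : ∀ {p} (v : Vec ℕ p) → total (beta v) ≡ + size v + total (down 0 p)
  total-beta []              = refl
  total-beta {suc p} (x ∷ v) rewrite total-beta v | ℤₚ.pos-+ x (size v) | ℤₚ.pos-+ x p =
    lemma (+ x) (+ p) (+ size v) (total (down 0 p))
    where
    lemma : ∀ x p s t → (x + p) + (s + t) ≡ (x + s) + (p + t)
    lemma = solve-∀

  -- Frobenius' formula for the number of standard tableaux of any shape. The recurrence of the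
  -- words meets `lowerSum-det`, in which the row total exceeds the column total by exactly the
  -- number of cells.
  #words-det : ∀ n {p} (v : Vec ℕ p) → Partition v → size v ≡ n →
    + #words n v * + factorials (beta v) ≡ + (n ℕ.!) * det (beta v) (down 0 p)
  #words-det zero {p} v pv e rewrite beta-empty v e | det-down 0 p | factorials-down p = refl
  #words-det (suc n) {p} v pv e = begin
    + #words (suc n) v * + factorials (beta v)
      ≡⟨ cong (λ z → + #words (suc n) v * + z) (sym (ℕₚ.+-identityʳ _)) ⟩
    + #words (suc n) v * + (1 ℕ.* factorials (beta v))
      ≡⟨ #words-step v (#words n) (λ xs → det xs (down 0 p)) 1 (n ℕ.!) pv
           (λ pre x post → det-repeat pre x post (down 0 p))
           (λ i ok → trans (cong (λ z → + #words n (remove v i) * + z) (ℕₚ.+-identityʳ _))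
             (#words-det n (remove v i) (remove-partition v i pv ok)
               (ℕₚ.suc-injective (trans (remove-size v i ok) e)))) ⟩
    + (n ℕ.!) * lowerSum (λ xs → det xs (down 0 p)) (beta v)
      ≡⟨ cong (+ (n ℕ.!) *_) (lowerSum-det (beta v) (down 0 p)) ⟩
    + (n ℕ.!) * ((total (beta v) - total (down 0 p)) * D)
      ≡⟨ cong (λ z → + (n ℕ.!) * ((z - total (down 0 p)) * D)) (trans (total-beta v) (cong (λ z → + z + total (down 0 p)) e)) ⟩
    + (n ℕ.!) * ((+ suc n + total (down 0 p) - total (down 0 p)) * D)
      ≡⟨ lemma (+ (n ℕ.!)) (+ suc n) (total (down 0 p)) D ⟩
    + suc n * + (n ℕ.!) * D
      ≡⟨ cong (_* D) (ℤₚ.pos-* (suc n) (n ℕ.!)) ⟨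
    + (suc n ℕ.!) * D ∎
    where
    open ≡-Reasoning
    D = det (beta v) (down 0 p)
    lemma : ∀ f s t d → f * ((s + t - t) * d) ≡ s * f * d
    lemma = solve-∀

  rect : ∀ p q → Vec ℕ p
  rect p q = replicate p q

  rect-partition : ∀ p q → Partition (rect p q)
  rect-partition zero    q = tt
  rect-partition (suc p) q = head p , rect-partition p q
    where
    head : ∀ p → head₀ (rect p q) ℕ.≤ q
    head zero    = z≤n
    head (suc p) = ℕₚ.≤-refl

  rect-size : ∀ p q → size (rect p q) ≡ p ℕ.* q
  rect-size zero    q = refl
  rect-size (suc p) q = cong (q ℕ.+_) (rect-size p q)

  rect-beta : ∀ p q → beta (rect p q) ≡ down q p
  rect-beta zero    q = refl
  rect-beta (suc p) q = cong ((q ℕ.+ p) ∷_) (rect-beta p q)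

  rowProd-! : ∀ i q → rowProd i q ℕ.* i ℕ.! ≡ (q ℕ.+ i) ℕ.!
  rowProd-! i zero    = ℕₚ.+-identityʳ _
  rowProd-! i (suc q) = begin
    rowProd i q ℕ.* suc (i ℕ.+ q) ℕ.* i ℕ.!    ≡⟨ cong (ℕ._* i ℕ.!) (ℕₚ.*-comm (rowProd i q) _) ⟩
    suc (i ℕ.+ q) ℕ.* rowProd i q ℕ.* i ℕ.!    ≡⟨ ℕₚ.*-assoc (suc (i ℕ.+ q)) (rowProd i q) (i ℕ.!) ⟩
    suc (i ℕ.+ q) ℕ.* (rowProd i q ℕ.* i ℕ.!)  ≡⟨ cong₂ ℕ._*_ (cong suc (ℕₚ.+-comm i q)) (rowProd-! i q) ⟩
    (suc q ℕ.+ i) ℕ.!                          ∎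
    where open ≡-Reasoning

  factorials-rect : ∀ p q → factorials (down q p) ≡ hookProd p q ℕ.* superfact p
  factorials-rect zero    q = refl
  factorials-rect (suc p) q = begin
    (q ℕ.+ p) ℕ.! ℕ.* factorials (down q p)
      ≡⟨ cong₂ ℕ._*_ (sym (rowProd-! p q)) (factorials-rect p q) ⟩
    rowProd p q ℕ.* p ℕ.! ℕ.* (hookProd p q ℕ.* superfact p)
      ≡⟨ ℕₚ.*-comm (rowProd p q ℕ.* p ℕ.!) _ ⟩
    hookProd p q ℕ.* superfact p ℕ.* (rowProd p q ℕ.* p ℕ.!)
      ≡⟨ ℕₚ.[m*n]*[o*p]≡[m*o]*[n*p] (hookProd p q) (superfact p) (rowProd p q) (p ℕ.!) ⟩
    hookProd p q ℕ.* rowProd p q ℕ.* (superfact p ℕ.* p ℕ.!)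
      ≡⟨ cong (hookProd p q ℕ.* rowProd p q ℕ.*_) (ℕₚ.*-comm (superfact p) _) ⟩
    hookProd p q ℕ.* rowProd p q ℕ.* (p ℕ.! ℕ.* superfact p) ∎
    where open ≡-Reasoning

  superfact≢0 : ∀ p → ℕ.NonZero (superfact p)
  superfact≢0 zero    = _
  superfact≢0 (suc p) = ℕₚ.m*n≢0 (p ℕ.!) (superfact p) {{ℕₚ._!≢0 p}} {{superfact≢0 p}}

  -- `superfact p` appears twice, as the value of the Vandermonde determinant and as the excess of
  -- the product of factorials over the hook product, and cancels.
  hook-length : ∀ p q → #words (p ℕ.* q) (rect p q) ℕ.* hookProd p q ≡ (p ℕ.* q) ℕ.!
  hook-length p q = ℕₚ.*-cancelʳ-≡ _ _ (superfact p) {{superfact≢0 p}} (ℤₚ.+-injective (begin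
    + (c ℕ.* hookProd p q ℕ.* superfact p)           ≡⟨ cong +_ (ℕₚ.*-assoc c _ _) ⟩
    + (c ℕ.* (hookProd p q ℕ.* superfact p))         ≡⟨ ℤₚ.pos-* c _ ⟩
    + c * + (hookProd p q ℕ.* superfact p)           ≡⟨ cong (λ z → + c * + z) (sym (factorials-rect p q)) ⟩
    + c * + factorials (down q p)                    ≡⟨ cong (λ z → + c * + factorials z) (sym (rect-beta p q)) ⟩
    + c * + factorials (beta (rect p q))             ≡⟨ #words-det (p ℕ.* q) (rect p q) (rect-partition p q) (rect-size p q) ⟩
    + ((p ℕ.* q) ℕ.!) * det (beta (rect p q)) (down 0 p)
      ≡⟨ cong (λ z → + ((p ℕ.* q) ℕ.!) * z) (trans (cong (λ z → det z (down 0 p)) (rect-beta p q)) (det-down q p)) ⟩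
    + ((p ℕ.* q) ℕ.!) * + superfact p                ≡⟨ ℤₚ.pos-* ((p ℕ.* q) ℕ.!) _ ⟨
    + ((p ℕ.* q) ℕ.! ℕ.* superfact p)                ∎))
    where
    open ≡-Reasoning
    c = #words (p ℕ.* q) (rect p q)

  fRect≡#words : ∀ p q → fRect p q ≡ #words (p ℕ.* q) (rect p q)
  fRect≡#words p q = trans
    (cong (λ z → ℕ._/_ z (hookProd p q) {{hookProd≢0 p q}}) (sym (hook-length p q)))
    (DivMod.m*n/n≡m (#words (p ℕ.* q) (rect p q)) (hookProd p q) {{hookProd≢0 p q}})

  -- A numbering of the lattice words of a shape.

  inject∑ : ∀ {p} (g : Fin p → ℕ) i → Fin (g i) → Fin (∑ g)
  inject∑ {suc p} g zero    x = x ↑ˡ ∑ (g ∘ suc)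
  inject∑ {suc p} g (suc i) x = g zero ↑ʳ inject∑ (g ∘ suc) i x

  inject∑-injective : ∀ {p} (g : Fin p → ℕ) i x j y →
    inject∑ g i x ≡ inject∑ g j y → Σ (i ≡ j) λ e → subst (Fin ∘ g) e x ≡ y
  inject∑-injective {suc p} g zero x zero y e = refl , Fₚ.↑ˡ-injective _ x y e
  inject∑-injective {suc p} g (suc i) x (suc j) y e
    with inject∑-injective (g ∘ suc) i x j y (Fₚ.↑ʳ-injective (g zero) _ _ e)
  ... | refl , e′ = refl , e′
  inject∑-injective {suc p} g zero x (suc j) y e
    with trans (sym (Fₚ.splitAt-↑ˡ (g zero) x (∑ (g ∘ suc)))) (trans (cong (splitAt (g zero)) e) (Fₚ.splitAt-↑ʳ (g zero) _ _))
  ... | ()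
  inject∑-injective {suc p} g (suc i) x zero y e
    with trans (sym (Fₚ.splitAt-↑ʳ (g zero) _ _)) (trans (cong (splitAt (g zero)) e) (Fₚ.splitAt-↑ˡ (g zero) y (∑ (g ∘ suc))))
  ... | ()

  project∑ : ∀ {p} (g : Fin p → ℕ) (z : Fin (∑ g)) → ∃ λ i → ∃ λ x → inject∑ g i x ≡ z
  project∑ {suc p} g z with splitAt (g zero) z in eq
  ... | inj₁ x = zero , x , Fₚ.splitAt⁻¹-↑ˡ eq
  ... | inj₂ y with project∑ (g ∘ suc) y
  ... | i , x , e = suc i , x , trans (cong (g zero ↑ʳ_) e) (Fₚ.splitAt⁻¹-↑ʳ eq)

  -- Letters are read from the last cell to the first.
  Lattice : ∀ {p n} → Vec (Fin p) n → Vec ℕ p → Set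
  Lattice []      v = ⊤
  Lattice (r ∷ w) v = T (removable v r) × Lattice w (remove v r)

  guard : ∀ {c} b → T b → Fin c → Fin (if b then c else 0)
  guard true _ x = x

  guard-injective : ∀ {c} b (t t′ : T b) (x y : Fin c) → guard b t x ≡ guard b t′ y → x ≡ y
  guard-injective true _ _ x y e = e

  unguard : ∀ {c} b (x : Fin (if b then c else 0)) → Σ (T b) λ t → ∃ λ y → guard {c} b t y ≡ x
  unguard true x = tt , x , refl

  encode : ∀ {p n} (w : Vec (Fin p) n) {v} → Lattice w v → Fin (#words n v)
  encode []      _             = zero
  encode (r ∷ w) {v} (ok , lw) = inject∑ _ r (guard (removable v r) ok (encode w lw))

  encode-injective : ∀ {p n} (w w′ : Vec (Fin p) n) {v} (l : Lattice w v) (l′ : Lattice w′ v) →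
    encode w l ≡ encode w′ l′ → w ≡ w′
  encode-injective []      []        _ _ _ = refl
  encode-injective (r ∷ w) (r′ ∷ w′) {v} (ok , l) (ok′ , l′) e
    with inject∑-injective (λ i → if removable v i then _ else 0) r _ r′ (guard (removable v r′) ok′ (encode w′ l′)) e
  ... | refl , e′ = cong (r ∷_) (encode-injective w w′ l l′ (guard-injective (removable v r) ok ok′ _ _ e′))

  decode : ∀ {p} n (v : Vec ℕ p) (z : Fin (#words n v)) →
    Σ (Vec (Fin p) n) λ w → Σ (Lattice w v) λ l → encode w l ≡ z
  decode zero    v zero = [] , tt , refl
  decode (suc n) v z with project∑ (λ i → if removable v i then #words n (remove v i) else 0) z
  ... | r , x , refl with unguard (removable v r) x
  ... | ok , y , refl with decode n (remove v r) y
  ... | w , l , refl = r ∷ w , (ok , l) , refl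

-- Finite injections, monotone maps and the enumeration of words.

module Counting where

  open HookLength using (∑)
  open import Data.List using (filter; concatMap; cartesianProductWith; allFin)
  open import Data.List.Membership.Propositional using (_∈_)
  open import Data.List.Membership.Propositional.Properties using (∈-cartesianProductWith⁺; ∈-allFin; ∈-filter⁺; ∈-filter⁻; ∈-lookup)
  open import Data.List.Relation.Unary.Any using (here; index)
  open import Data.List.Relation.Unary.Any.Properties using (lookup-index)
  open import Data.List.Relation.Unary.All using ([]) renaming (lookup to All-lookup)
  open import Data.List.Relation.Unary.AllPairs using ([]; _∷_)
  open import Data.List.Relation.Unary.Unique.Propositional using (Unique)
  import Data.List.Relation.Unary.Unique.Propositional.Properties as Uniqueₚ

  StrictMono : ∀ {m n} → (Fin m → Fin n) → Set
  StrictMono f = ∀ i j → i F.< j → f i F.< f j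

  strictMono⇒≥ : ∀ {m n} (f : Fin m → Fin n) → StrictMono f → ∀ i → toℕ i ≤ toℕ (f i)
  strictMono⇒≥ {m} f mono i = go (toℕ i) i refl
    where
    go : ∀ a i → toℕ i ≡ a → a ≤ toℕ (f i)
    go zero    i e = z≤n
    go (suc a) i e = ℕₚ.≤-<-trans (go a i′ (Fₚ.toℕ-fromℕ< a<m)) (mono i′ i i′<i)
      where
      a<m : a < m
      a<m = ℕₚ.<-trans (subst (a <_) (sym e) ℕₚ.≤-refl) (Fₚ.toℕ<n i)
      i′ = fromℕ< a<m
      i′<i : i′ F.< i
      i′<i = subst₂ _<_ (sym (Fₚ.toℕ-fromℕ< a<m)) (sym e) ℕₚ.≤-refl

  opposite-< : ∀ {n} (i j : Fin n) → i F.< j → opposite j F.< opposite i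
  opposite-< {n} i j i<j rewrite Fₚ.opposite-prop i | Fₚ.opposite-prop j =
    ℕₚ.∸-monoʳ-< (s≤s i<j) (Fₚ.toℕ<n j)

  opposite-injective : ∀ {n} {i j : Fin n} → opposite i ≡ opposite j → i ≡ j
  opposite-injective {i = i} {j} e =
    trans (sym (Fₚ.opposite-involutive i)) (trans (cong opposite e) (Fₚ.opposite-involutive j))

  opposite-≤⁻ : ∀ {n} (i j : Fin n) → toℕ (opposite i) ≤ toℕ (opposite j) → toℕ j ≤ toℕ i
  opposite-≤⁻ i j h = ℕₚ.≮⇒≥ λ i<j → ℕₚ.<⇒≱ (opposite-< i j i<j) h

  -- A strictly increasing self-map never falls below the identity; conjugating by `opposite` gives
  -- the reverse bound.
  strictMono⇒id : ∀ {n} (f : Fin n → Fin n) → StrictMono f → ∀ i → f i ≡ i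
  strictMono⇒id f mono i = Fₚ.toℕ-injective (ℕₚ.≤-antisym upper (strictMono⇒≥ f mono i))
    where
    g = opposite ∘ f ∘ opposite
    g-mono : StrictMono g
    g-mono i j i<j = opposite-< _ _ (mono _ _ (opposite-< i j i<j))
    upper : toℕ (f i) ≤ toℕ i
    upper = opposite-≤⁻ i (f i)
      (subst (λ z → toℕ (opposite i) ≤ toℕ (opposite (f z))) (Fₚ.opposite-involutive i)
        (strictMono⇒≥ g g-mono (opposite i)))

  Injective : ∀ {A B : Set} → (A → B) → Set
  Injective f = ∀ {x y} → f x ≡ f y → x ≡ y

  -- If `y` were missed, punching it out of the codomain would inject `suc n` elements into `n`.
  injective⇒surjective : ∀ {n} (f : Fin n → Fin n) → Injective f → ∀ y → ∃ λ x → f x ≡ y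
  injective⇒surjective {zero}  f inj ()
  injective⇒surjective {suc n} f inj y with Fₚ.any? (λ x → f x Fₚ.≟ y)
  ... | yes r = r
  ... | no ¬r = contradiction
    (Fₚ.injective⇒≤ {f = λ x → punchOut {i = y} {j = f x} (λ e → ¬r (x , sym e))}
      (λ {a} {b} e → inj (Fₚ.punchOut-injective (λ e′ → ¬r (a , sym e′)) (λ e′ → ¬r (b , sym e′)) e)))
    ℕₚ.1+n≰n

  count : ∀ {n} → (Fin n → Bool) → ℕ
  count P = ∑ λ i → if P i then 1 else 0

  count-mono : ∀ {n} (P Q : Fin n → Bool) → (∀ i → T (P i) → T (Q i)) → count P ≤ count Q
  count-mono {zero}  P Q h = z≤n
  count-mono {suc n} P Q h with P zero | Q zero | h zero
  ... | true  | true  | _ = s≤s (count-mono (P ∘ suc) (Q ∘ suc) (h ∘ suc))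
  ... | true  | false | g = contradiction (g tt) λ ()
  ... | false | true  | _ = ℕₚ.m≤n⇒m≤1+n (count-mono (P ∘ suc) (Q ∘ suc) (h ∘ suc))
  ... | false | false | _ = count-mono (P ∘ suc) (Q ∘ suc) (h ∘ suc)

  count-strict : ∀ {n} (P Q : Fin n → Bool) → (∀ i → T (P i) → T (Q i)) →
    ∀ i → ¬ T (P i) → T (Q i) → count P < count Q
  count-strict {suc n} P Q h zero ¬p q with P zero | Q zero
  ... | true  | _    = contradiction tt ¬p
  ... | false | true = s≤s (count-mono (P ∘ suc) (Q ∘ suc) (h ∘ suc))
  count-strict {suc n} P Q h (suc i) ¬p q with P zero | Q zero | h zero
  ... | true  | true  | _ = s≤s (count-strict (P ∘ suc) (Q ∘ suc) (h ∘ suc) i ¬p q)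
  ... | true  | false | g = contradiction (g tt) λ ()
  ... | false | true  | _ = ℕₚ.m≤n⇒m≤1+n (count-strict (P ∘ suc) (Q ∘ suc) (h ∘ suc) i ¬p q)
  ... | false | false | _ = count-strict (P ∘ suc) (Q ∘ suc) (h ∘ suc) i ¬p q

  count-true : ∀ n → count {n} (λ _ → true) ≡ n
  count-true zero    = refl
  count-true (suc n) = cong suc (count-true n)

  count-cong : ∀ {n} (P Q : Fin n → Bool) → (∀ i → P i ≡ Q i) → count P ≡ count Q
  count-cong {zero}  P Q h = refl
  count-cong {suc n} P Q h rewrite h zero = cong ((if Q zero then 1 else 0) ℕ.+_) (count-cong (P ∘ suc) (Q ∘ suc) (h ∘ suc))

  count-insert : ∀ {n} (P Q : Fin n → Bool) i → P i ≡ false → Q i ≡ true →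
    (∀ j → j ≢ i → P j ≡ Q j) → count Q ≡ suc (count P)
  count-insert P Q zero    p q h rewrite p | q =
    cong suc (sym (count-cong (P ∘ suc) (Q ∘ suc) (λ j → h (suc j) λ ())))
  count-insert P Q (suc i) p q h rewrite h zero (λ ()) = trans
    (cong ((if Q zero then 1 else 0) ℕ.+_)
      (count-insert (P ∘ suc) (Q ∘ suc) i p q (λ j ne → h (suc j) (ne ∘ Fₚ.suc-injective))))
    (ℕₚ.+-suc (if Q zero then 1 else 0) _)

  concatMap-map : ∀ {A B C : Set} (f : A → B → C) xs ys →
    concatMap (λ x → List.map (f x) ys) xs ≡ cartesianProductWith f xs ys
  concatMap-map f []       ys = refl
  concatMap-map f (x ∷ xs) ys = cong (List.map (f x) ys ++_) (concatMap-map f xs ys)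

  allVecs-complete : ∀ {n m} (v : Vec (Fin n) m) → v ∈ allVecs n m
  allVecs-complete []                  = here refl
  allVecs-complete {n} {suc m} (i ∷ v) =
    subst (i ∷ v ∈_) (sym (concatMap-map _∷_ (allFin n) (allVecs n m)))
      (∈-cartesianProductWith⁺ _∷_ (∈-allFin i) (allVecs-complete v))

  allVecs-unique : ∀ n m → Unique (allVecs n m)
  allVecs-unique n zero    = [] ∷ []
  allVecs-unique n (suc m) =
    subst Unique (sym (concatMap-map _∷_ (allFin n) (allVecs n m)))
      (Uniqueₚ.cartesianProductWith⁺ _∷_ Vecₚ.∷-injective (Uniqueₚ.allFin⁺ n) (allVecs-unique n m))

  unique⇒lookup-injective : ∀ {A : Set} {xs : List A} → Unique xs →
    ∀ i j → List.lookup xs i ≡ List.lookup xs j → i ≡ j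
  unique⇒lookup-injective (x ∷ u) zero    zero    e = refl
  unique⇒lookup-injective (x ∷ u) zero    (suc j) e = contradiction e (All-lookup x (∈-lookup j))
  unique⇒lookup-injective (x ∷ u) (suc i) zero    e = contradiction (sym e) (All-lookup x (∈-lookup i))
  unique⇒lookup-injective (x ∷ u) (suc i) (suc j) e = cong suc (unique⇒lookup-injective u i j e)

  filter-length-≤ : ∀ {A : Set} {P : A → Set} (P? : ∀ x → Dec (P x)) {xs M} → Unique xs →
    (h : ∀ x → P x → Fin M) → (∀ x y px py → h x px ≡ h y py → x ≡ y) → length (filter P? xs) ≤ M
  filter-length-≤ {A} {P} P? {xs} u h inj = Fₚ.injective⇒≤ {f = λ i → h (List.lookup ys i) (sat i)}
    λ {i} {j} e → unique⇒lookup-injective (Uniqueₚ.filter⁺ P? u) i j (inj _ _ _ _ e)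
    where
    ys = filter P? xs
    sat : ∀ i → P (List.lookup ys i)
    sat i = proj₂ (∈-filter⁻ P? {xs = xs} (∈-lookup {xs = ys} i))

  ≤-filter-length : ∀ {A : Set} {P : A → Set} (P? : ∀ x → Dec (P x)) {xs N} → (∀ x → x ∈ xs) →
    (h : Fin N → A) → (∀ i → P (h i)) → Injective h → N ≤ length (filter P? xs)
  ≤-filter-length P? {xs} complete h sat inj = Fₚ.injective⇒≤ {f = λ i → index (mem i)}
    λ {i} {j} e → inj (trans (lookup-index (mem i)) (trans (cong (List.lookup (filter P? xs)) e) (sym (lookup-index (mem j)))))
    where
    mem : ∀ i → h i ∈ filter P? xs
    mem i = ∈-filter⁺ P? (complete (h i)) (sat i)

-- Chains and the Erdős-Szekeres argument.

module UpperBound where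

  open HookLength
  open Counting
  open import Data.Nat using (_*_)

  module Chains {n} (R : Fin n → Fin n → Set) (R? : ∀ x y → Dec (R x y)) where

    -- The index counts steps, so a `Chain l x` has `l + 1` entries. Excluding `Chain k x` therefore
    -- allows at most `k` entries, and the labels below fit into `Fin k`.
    Chain : ℕ → Fin n → Set
    Chain zero    x = ⊤
    Chain (suc l) x = ∃ λ y → R y x × Chain l y

    chain? : ∀ l x → Dec (Chain l x)
    chain? zero    x = yes tt
    chain? (suc l) x = Fₚ.any? λ y → R? y x ×-dec chain? l y

    shorten : ∀ {l m} → l ≤ m → ∀ {x} → Chain m x → Chain l x
    shorten z≤n       _           = tt
    shorten (s≤s l≤m) (y , r , c) = y , r , shorten l≤m c

    longest : ∀ k x → ¬ Chain k x → ∃ λ l → l < k × Chain l x × ¬ Chain (suc l) x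
    longest zero    x ¬c = contradiction tt ¬c
    longest (suc k) x ¬c with chain? k x
    ... | yes c = k , ℕₚ.≤-refl , c , ¬c
    ... | no ¬c′ with longest k x ¬c′
    ... | l , l<k , p = l , ℕₚ.m≤n⇒m≤1+n l<k , p

    -- The chain is listed from its end `x` backwards, so growing indices descend along `R`; where
    -- the natural order is wanted, the listing is composed with `opposite`.
    listing : (∀ {x y z} → R x y → R y z → R x z) → ∀ l x → Chain l x →
      Σ (Fin (suc l) → Fin n) λ c → c zero ≡ x × (∀ i j → i F.< j → R (c j) (c i))
    listing tr zero    x _ = (λ _ → x) , refl , λ { zero zero () }
    listing tr (suc l) x (y , r , ch) with listing tr l y ch
    ... | c , c₀ , desc = c′ , refl , desc′
      where
      c′ : Fin (suc (suc l)) → Fin n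
      c′ zero    = x
      c′ (suc i) = c i
      desc′ : ∀ i j → i F.< j → R (c′ j) (c′ i)
      desc′ zero    (suc zero)    _       = subst (λ z → R z x) (sym c₀) r
      desc′ zero    (suc (suc j)) _       = tr (subst (R (c (suc j))) c₀ (desc zero (suc j) (s≤s z≤n))) r
      desc′ (suc i) (suc j)       (s≤s h) = desc i j h

    module Label (k : ℕ) (bounded : ∀ x → ¬ Chain k x) where

      label : Fin n → Fin k
      label x = fromℕ< (proj₁ (proj₂ (longest k x (bounded x))))

      label-mono : ∀ {y x} → R y x → label y F.< label x
      label-mono {y} {x} r with longest k y (bounded y) | longest k x (bounded x)
      ... | l , l<k , c , _ | m , m<k , _ , ¬c =
        subst₂ _<_ (sym (Fₚ.toℕ-fromℕ< l<k)) (sym (Fₚ.toℕ-fromℕ< m<k))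
          -- If `m ≤ l`, the chain ending at `y`, extended by `x`, would be longer than the longest
          -- one ending at `x`.
          (ℕₚ.≰⇒> λ m≤l → ¬c (y , r , shorten m≤l c))

  module ErdősSzekeres {n} (f : Fin n → ℕ) (f-injective : Injective f) where

    Asc Desc : Fin n → Fin n → Set
    Asc  x y = x F.< y × f x < f y
    Desc x y = x F.< y × f y < f x

    Asc-trans : ∀ {x y z} → Asc x y → Asc y z → Asc x z
    Asc-trans (a , b) (c , d) = ℕₚ.<-trans a c , ℕₚ.<-trans b d

    Desc-trans : ∀ {x y z} → Desc x y → Desc y z → Desc x z
    Desc-trans (a , b) (c , d) = ℕₚ.<-trans a c , ℕₚ.<-trans d b

    module A = Chains Asc (λ x y → (x Fₚ.<? y) ×-dec (f x ℕₚ.<? f y))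
    module D = Chains Desc (λ x y → (x Fₚ.<? y) ×-dec (f y ℕₚ.<? f x))

    module Labels (p q : ℕ) (no-desc : ∀ x → ¬ D.Chain p x) (no-asc : ∀ x → ¬ A.Chain q x) where

      open D.Label p no-desc public renaming (label to down; label-mono to down-mono)
      open A.Label q no-asc public renaming (label to up; label-mono to up-mono)

      ordered : ∀ {x y} → x F.< y → up x F.< up y ⊎ down x F.< down y
      ordered {x} {y} x<y with ℕₚ.<-cmp (f x) (f y)
      ... | tri< l _ _ = inj₁ (up-mono (x<y , l))
      ... | tri≈ _ e _ = contradiction (f-injective e) λ { refl → ℕₚ.<-irrefl refl x<y }
      ... | tri> _ _ g = inj₂ (down-mono (x<y , g))

      labels-distinct : ∀ {x y} → x F.< y → down x ≡ down y → up x ≡ up y → ⊥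
      labels-distinct x<y e e′ with ordered x<y
      ... | inj₁ l = ℕₚ.<-irrefl (cong toℕ e′) l
      ... | inj₂ l = ℕₚ.<-irrefl (cong toℕ e) l

      labels-injective : ∀ {x y} → down x ≡ down y → up x ≡ up y → x ≡ y
      labels-injective {x} {y} e e′ with Fₚ.<-cmp x y
      ... | tri< l _ _ = contradiction (labels-distinct l e e′) λ ()
      ... | tri≈ _ z _ = z
      ... | tri> _ _ g = contradiction (labels-distinct g (sym e) (sym e′)) λ ()

    erdős-szekeres : ∀ p q → p * q < n → (∀ x → ¬ D.Chain p x) → ¬ (∀ x → ¬ A.Chain q x)
    erdős-szekeres p q h nd na with Fₚ.pigeonhole h (λ x → combine (Labels.down p q nd na x) (Labels.up p q nd na x))
    ... | x , y , x<y , e = L.labels-distinct x<y (proj₁ both) (proj₂ both)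
      where
      module L = Labels p q nd na
      both = Fₚ.combine-injective (L.down x) (L.up x) (L.down y) (L.up y) e

  avoids⇒no-increasing : ∀ {n m} (w : Word n) → Avoids w (identityPattern m) → (s : Fin m → Fin n) →
    (∀ i j → i F.< j → s i F.< s j) → (∀ i j → i F.< j → lookup w (s i) F.< lookup w (s j)) → ⊥
  avoids⇒no-increasing {n} {m} w avoids s pos val = avoids (tabulate s , pos′ , λ j l → from j l , to j l)
    where
    pos′ : ∀ j l → j F.< l → lookup (tabulate s) j F.< lookup (tabulate s) l
    pos′ j l h rewrite Vecₚ.lookup∘tabulate s j | Vecₚ.lookup∘tabulate s l = pos j l h
    to : ∀ j l → lookup (identityPattern m) j F.< lookup (identityPattern m) l →
      lookup w (lookup (tabulate s) j) F.< lookup w (lookup (tabulate s) l)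
    to j l h rewrite Vecₚ.lookup-allFin j | Vecₚ.lookup-allFin l
                   | Vecₚ.lookup∘tabulate s j | Vecₚ.lookup∘tabulate s l = val j l h
    from : ∀ j l → lookup w (lookup (tabulate s) j) F.< lookup w (lookup (tabulate s) l) →
      lookup (identityPattern m) j F.< lookup (identityPattern m) l
    from j l h rewrite Vecₚ.lookup-allFin j | Vecₚ.lookup-allFin l
                     | Vecₚ.lookup∘tabulate s j | Vecₚ.lookup∘tabulate s l with Fₚ.<-cmp j l
    ... | tri< j<l _ _ = j<l
    ... | tri≈ _ refl _ = contradiction h (ℕₚ.<-irrefl refl)
    ... | tri> _ _ l<j = contradiction h (ℕₚ.<-asym (val l j l<j))

  module _ {n} (w : Word n) (perm : IsPerm w) where

    value : Fin n → ℕ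
    value x = toℕ (lookup w x)

    value-injective : Injective value
    value-injective e = perm _ _ (Fₚ.toℕ-injective e)

    open ErdősSzekeres value value-injective

    no-long-asc : ∀ {k} → Avoids w (identityPattern (suc k)) → ∀ x → ¬ A.Chain k x
    no-long-asc {k} avoids x ch with A.listing Asc-trans k x ch
    ... | c , _ , asc = avoids⇒no-increasing w avoids (c ∘ opposite)
            (λ i j h → proj₁ (asc _ _ (opposite-< i j h))) (λ i j h → proj₂ (asc _ _ (opposite-< i j h)))

    -- A decreasing chain c of π longer than k² has an image on which π has a long
    -- ascent (a long ascent of π) or a long descent (a long ascent of π² along c).
    no-long-desc : ∀ {k} → StronglyAvoids w (identityPattern (suc k)) → ∀ x → ¬ D.Chain (k * k) x
    no-long-desc {k} (av , av²) x ch with D.listing Desc-trans (k * k) x ch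
    ... | c , _ , desc = ES.erdős-szekeres k k ℕₚ.≤-refl no-desc no-asc
      where
      f : Fin (suc (k * k)) → ℕ
      f i = value (lookup w (c i))
      c-injective : Injective c
      c-injective {i} {j} e with Fₚ.<-cmp i j
      ... | tri< l _ _ = contradiction (proj₁ (desc i j l)) (ℕₚ.<-irrefl (cong toℕ (sym e)))
      ... | tri≈ _ z _ = z
      ... | tri> _ _ g = contradiction (proj₁ (desc j i g)) (ℕₚ.<-irrefl (cong toℕ e))
      f-injective : Injective f
      f-injective e = c-injective (perm _ _ (value-injective e))
      module ES = ErdősSzekeres f f-injective
      no-asc : ∀ x → ¬ ES.A.Chain k x
      no-asc x ch′ with ES.A.listing ES.Asc-trans k x ch′
      ... | d , _ , asc = avoids⇒no-increasing w av (λ i → lookup w (c (d (opposite i))))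
              (λ i j h → proj₂ (desc _ _ (proj₁ (asc _ _ (opposite-< i j h)))))
              (λ i j h → proj₂ (asc _ _ (opposite-< i j h)))
      no-desc : ∀ x → ¬ ES.D.Chain k x
      no-desc x ch′ with ES.D.listing ES.Desc-trans k x ch′
      ... | d , _ , dsc = avoids⇒no-increasing (square w) av² (λ i → c (d i))
              (λ i j h → proj₁ (desc _ _ (proj₁ (dsc i j h))))
              (λ i j h → subst₂ F._<_ (sym (Vecₚ.lookup∘tabulate _ (c (d i)))) (sym (Vecₚ.lookup∘tabulate _ (c (d j))))
                           (proj₂ (dsc i j h)))

  -- Rectangular tableaux of positions and values.

  record Tableau (p q n : ℕ) : Set where
    field
      row    : Fin n → Fin p
      col    : Fin n → Fin q
      at     : Fin p → Fin q → Fin n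
      at-cell : ∀ t → at (row t) (col t) ≡ t
      row-at : ∀ i j → row (at i j) ≡ i
      col-at : ∀ i j → col (at i j) ≡ j
      row-mono : ∀ i j j′ → j F.< j′ → at i j F.< at i j′
      col-mono : ∀ i i′ j → i F.< i′ → at i j F.< at i′ j

  removable-tabulate : ∀ {p} (f : Fin p → ℕ) r → 0 < f r →
    (∀ i → toℕ i ≡ suc (toℕ r) → f i < f r) → T (removable (tabulate f) r)
  removable-tabulate {suc zero}    f zero    pos h = ℕₚ.<⇒<ᵇ pos
  removable-tabulate {suc (suc p)} f zero    pos h = ℕₚ.<⇒<ᵇ (h (suc zero) refl)
  removable-tabulate {suc p}       f (suc r) pos h =
    removable-tabulate (f ∘ suc) r pos (λ i e → h (suc i) (cong suc e))

  remove-tabulate : ∀ {p} (f g : Fin p → ℕ) r → f r ≡ suc (g r) → (∀ i → i ≢ r → f i ≡ g i) →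
    remove (tabulate f) r ≡ tabulate g
  remove-tabulate f g zero    e h = cong₂ _∷_ (cong ℕ.pred e) (Vecₚ.tabulate-cong (λ i → h (suc i) λ ()))
  remove-tabulate f g (suc r) e h =
    cong₂ _∷_ (h zero λ ()) (remove-tabulate (f ∘ suc) (g ∘ suc) r e (λ i ne → h (suc i) (ne ∘ Fₚ.suc-injective)))

  <ᵇ-true : ∀ {a b} → a < b → (a <ᵇ b) ≡ true
  <ᵇ-true {a} {b} h with a <ᵇ b | ℕₚ.<⇒<ᵇ h
  ... | true | _ = refl

  <ᵇ-false : ∀ {a b} → ¬ a < b → (a <ᵇ b) ≡ false
  <ᵇ-false {a} {b} h with a <ᵇ b in e
  ... | true  = contradiction (ℕₚ.<ᵇ⇒< a b (subst T (sym e) tt)) h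
  ... | false = refl

  tabulate-const : ∀ {p} (f : Fin p → ℕ) c → (∀ i → f i ≡ c) → tabulate f ≡ replicate p c
  tabulate-const {zero}  f c h = refl
  tabulate-const {suc p} f c h = cong₂ _∷_ (h zero) (tabulate-const (f ∘ suc) c (h ∘ suc))

  module _ {p q n} (tab : Tableau p q n) where
    open Tableau tab

    word : ∀ t → t ≤ n → Vec (Fin p) t
    word zero    _ = []
    word (suc t) h = row (fromℕ< h) ∷ word t (ℕₚ.<⇒≤ h)

    rowLength : ℕ → Fin p → ℕ
    rowLength t i = count λ j → toℕ (at i j) <ᵇ t

    shape : ℕ → Vec ℕ p
    shape t = tabulate (rowLength t)

    -- The row `r` of the entry `t` is longer than the next row at that time: every filled cell of
    -- the next row lies under a filled cell of `r`, while the cell under `t` is still empty.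
    -- Dropping `t` leads from the shape at time `suc t` to the shape at time `t`.
    word-lattice : ∀ t h → Lattice (word t h) (shape t)
    word-lattice zero    h = tt
    word-lattice (suc t) h =
      removable-tabulate (rowLength (suc t)) r
        (subst (0 <_) (sym grow) (s≤s z≤n)) below ,
      subst (Lattice (word t _)) (sym (remove-tabulate (rowLength (suc t)) (rowLength t) r grow other))
        (word-lattice t (ℕₚ.<⇒≤ h))
      where
      x = fromℕ< h
      r = row x
      c = col x
      at≡t : toℕ (at r c) ≡ t
      at≡t = trans (cong toℕ (at-cell x)) (Fₚ.toℕ-fromℕ< h)
      unchanged : ∀ i j → toℕ (at i j) ≢ t → (toℕ (at i j) <ᵇ t) ≡ (toℕ (at i j) <ᵇ suc t)
      unchanged i j ne with ℕₚ.<-cmp (toℕ (at i j)) t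
      ... | tri< l _ _ = trans (<ᵇ-true l) (sym (<ᵇ-true (ℕₚ.m≤n⇒m≤1+n l)))
      ... | tri≈ _ e _ = contradiction e ne
      ... | tri> ¬l _ g = trans (<ᵇ-false ¬l) (sym (<ᵇ-false λ l → ℕₚ.<⇒≱ g (ℕ.s≤s⁻¹ l)))
      cell : ∀ i j → toℕ (at i j) ≡ t → at i j ≡ x
      cell i j e = Fₚ.toℕ-injective (trans e (sym (Fₚ.toℕ-fromℕ< h)))
      grow : rowLength (suc t) r ≡ suc (rowLength t r)
      grow = count-insert _ _ c
        (<ᵇ-false λ l → ℕₚ.<-irrefl at≡t l) (<ᵇ-true (s≤s (ℕₚ.≤-reflexive at≡t)))
        (λ j ne → unchanged r j λ e → ne (trans (sym (col-at r j)) (cong col (cell r j e))))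
      other : ∀ i → i ≢ r → rowLength (suc t) i ≡ rowLength t i
      other i ne = sym (count-cong _ _ λ j →
        unchanged i j λ e → ne (trans (sym (row-at i j)) (cong row (cell i j e))))
      below : ∀ i → toℕ i ≡ suc (toℕ r) → rowLength (suc t) i < rowLength (suc t) r
      below i e = count-strict _ _
        (λ j l → ℕₚ.<⇒<ᵇ {toℕ (at r j)} {suc t} (ℕₚ.<-trans (col-mono r i j r<i) (ℕₚ.<ᵇ⇒< (toℕ (at i j)) (suc t) l)))
        c (λ l → ℕₚ.<⇒≱ (col-mono r i c r<i) (ℕₚ.≤-trans (ℕ.s≤s⁻¹ (ℕₚ.<ᵇ⇒< _ _ l)) (ℕₚ.≤-reflexive (sym at≡t))))
        (ℕₚ.<⇒<ᵇ (s≤s (ℕₚ.≤-reflexive at≡t)))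
        where
        r<i : r F.< i
        r<i = subst (toℕ r <_) (sym e) ℕₚ.≤-refl

    shape-full : shape n ≡ rect p q
    shape-full = tabulate-const _ q λ i →
      trans (count-cong _ (λ _ → true) (λ j → <ᵇ-true (Fₚ.toℕ<n (at i j)))) (count-true q)

    full-lattice : Lattice (word n ℕₚ.≤-refl) (rect p q)
    full-lattice = subst (Lattice (word n ℕₚ.≤-refl)) shape-full (word-lattice n ℕₚ.≤-refl)

    code : Fin (#words n (rect p q))
    code = encode (word n ℕₚ.≤-refl) full-lattice

  module _ {p q n} (S S′ : Tableau p q n) where
    private
      module S  = Tableau S
      module S′ = Tableau S′

    word-row : ∀ t h → word S t h ≡ word S′ t h → ∀ (x : Fin n) → toℕ x < t → S.row x ≡ S′.row x
    word-row (suc t) h e x (s≤s x≤t) with ℕₚ.m≤n⇒m<n∨m≡n x≤t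
    ... | inj₁ x<t = word-row t _ (Vecₚ.∷-injectiveʳ e) x x<t
    ... | inj₂ refl = subst (λ z → S.row z ≡ S′.row z) (Fₚ.fromℕ<-toℕ x h) (Vecₚ.∷-injectiveˡ e)

    -- The word records rows only. Columns are recovered because entries increase along a row: the
    -- map `θ` from the columns of one tableau to those of the other is strictly increasing, hence
    -- the identity.
    code-injective : code S ≡ code S′ → ∀ i j → S.at i j ≡ S′.at i j
    code-injective e i j = trans (sym (same j)) (cong (S′.at i) (strictMono⇒id θ θ-mono j))
      where
      rows : ∀ x → S.row x ≡ S′.row x
      rows x = word-row n ℕₚ.≤-refl (encode-injective _ _ (full-lattice S) (full-lattice S′) e) x (Fₚ.toℕ<n x)
      θ : Fin q → Fin q
      θ j = S′.col (S.at i j)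
      same : ∀ j → S′.at i (θ j) ≡ S.at i j
      same j = trans (cong (λ z → S′.at z (θ j)) (trans (sym (S.row-at i j)) (rows _))) (S′.at-cell (S.at i j))
      θ-mono : StrictMono θ
      θ-mono a b a<b = ℕₚ.≰⇒> λ θb≤θa → ℕₚ.<⇒≱ (S.row-mono i a b a<b) (subst₂ (λ y z → toℕ y ≤ toℕ z) (same b) (same a) (weak θb≤θa))
        where
        weak : ∀ {a b} → toℕ a ≤ toℕ b → toℕ (S′.at i a) ≤ toℕ (S′.at i b)
        weak {a} {b} h with ℕₚ.m≤n⇒m<n∨m≡n h
        ... | inj₁ l = ℕₚ.<⇒≤ (S′.row-mono i _ _ l)
        ... | inj₂ e = ℕₚ.≤-reflexive (cong (λ z → toℕ (S′.at i z)) (Fₚ.toℕ-injective e))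

  module Extremal {p q} (w : Word (p * q)) (perm : IsPerm w)
    (no-desc : ∀ x → ¬ ErdősSzekeres.D.Chain (value w perm) (value-injective w perm) p x)
    (no-asc : ∀ x → ¬ ErdősSzekeres.A.Chain (value w perm) (value-injective w perm) q x) where

    open ErdősSzekeres (value w perm) (value-injective w perm)
    open Labels p q no-desc no-asc public

    cell : Fin (p * q) → Fin (p * q)
    cell x = combine (down x) (up x)

    cell-injective : Injective cell
    cell-injective {x} {y} e = labels-injective (proj₁ both) (proj₂ both)
      where both = Fₚ.combine-injective (down x) (up x) (down y) (up y) e

    -- The labels inject `p * q` positions into `p * q` cells, so no cell stays empty; this is where
    -- the extremal length enters.
    place : ∀ (i : Fin p) (j : Fin q) → ∃ λ x → cell x ≡ combine i j
    place i j = injective⇒surjective cell cell-injective (combine i j)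

    pos : Fin p → Fin q → Fin (p * q)
    pos i j = proj₁ (place i j)

    down-pos : ∀ i j → down (pos i j) ≡ i
    down-pos i j = proj₁ (Fₚ.combine-injective (down (pos i j)) (up (pos i j)) i j (proj₂ (place i j)))

    up-pos : ∀ i j → up (pos i j) ≡ j
    up-pos i j = proj₂ (Fₚ.combine-injective (down (pos i j)) (up (pos i j)) i j (proj₂ (place i j)))

    pos-cell : ∀ x → pos (down x) (up x) ≡ x
    pos-cell x = cell-injective (proj₂ (place (down x) (up x)))

    -- The contrapositive of `ordered`: a later position has a larger label of at least one kind.
    pos-mono : ∀ {x y} → down x F.≤ down y → up x F.≤ up y → x ≢ y → x F.< y
    pos-mono {x} {y} d u ne with Fₚ.<-cmp x y
    ... | tri< l _ _ = l
    ... | tri≈ _ e _ = contradiction e ne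
    ... | tri> _ _ g with ordered g
    ... | inj₁ l = contradiction u (ℕₚ.<⇒≱ l)
    ... | inj₂ l = contradiction d (ℕₚ.<⇒≱ l)

    position-row : ∀ i j j′ → j F.< j′ → pos i j F.< pos i j′
    position-row i j j′ h = pos-mono
      (ℕₚ.≤-reflexive (cong toℕ (trans (down-pos i j) (sym (down-pos i j′)))))
      (subst₂ F._≤_ (sym (up-pos i j)) (sym (up-pos i j′)) (ℕₚ.<⇒≤ h))
      (λ e → ℕₚ.<-irrefl (cong toℕ (trans (sym (up-pos i j)) (trans (cong up e) (up-pos i j′)))) h)

    position-col : ∀ i i′ j → i F.< i′ → pos i j F.< pos i′ j
    position-col i i′ j h = pos-mono
      (subst₂ F._≤_ (sym (down-pos i j)) (sym (down-pos i′ j)) (ℕₚ.<⇒≤ h))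
      (ℕₚ.≤-reflexive (cong toℕ (trans (up-pos i j) (sym (up-pos i′ j)))))
      (λ e → ℕₚ.<-irrefl (cong toℕ (trans (sym (down-pos i j)) (trans (cong down e) (down-pos i′ j)))) h)

    -- A descent between two positions raises the label `down`, which is constant along a row. In
    -- `value-col` the same is said of ascents and `up`.
    value-row : ∀ i j j′ → j F.< j′ → lookup w (pos i j) F.< lookup w (pos i j′)
    value-row i j j′ h with ℕₚ.<-cmp (value w perm (pos i j)) (value w perm (pos i j′))
    ... | tri< l _ _ = l
    ... | tri≈ _ e _ = contradiction (value-injective w perm e) (λ e → ℕₚ.<-irrefl (cong toℕ e) (position-row i j j′ h))
    ... | tri> _ _ g = contradiction (down-mono (position-row i j j′ h , g))
                         (ℕₚ.<-irrefl (cong toℕ (trans (down-pos i j) (sym (down-pos i j′)))))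

    value-col : ∀ i i′ j → i F.< i′ → lookup w (pos i′ j) F.< lookup w (pos i j)
    value-col i i′ j h with ℕₚ.<-cmp (value w perm (pos i′ j)) (value w perm (pos i j))
    ... | tri< l _ _ = l
    ... | tri≈ _ e _ = contradiction (value-injective w perm (sym e)) (λ e → ℕₚ.<-irrefl (cong toℕ e) (position-col i i′ j h))
    ... | tri> _ _ g = contradiction (up-mono (position-col i i′ j h , g))
                         (ℕₚ.<-irrefl (cong toℕ (trans (up-pos i j) (sym (up-pos i′ j)))))

    inverse : ∀ y → ∃ λ x → lookup w x ≡ y
    inverse = injective⇒surjective (lookup w) (perm _ _)

    positionTableau : Tableau p q (p * q)
    positionTableau = record
      { row = down ; col = up ; at = pos ; at-cell = pos-cell ; row-at = down-pos ; col-at = up-pos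
      ; row-mono = position-row ; col-mono = position-col }

    valueTableau : Tableau p q (p * q)
    valueTableau = record
      -- Values decrease down the columns of the position tableau, so the rows are reversed to
      -- obtain a standard tableau.
      { row = opposite ∘ down ∘ proj₁ ∘ inverse
      ; col = up ∘ proj₁ ∘ inverse
      ; at = λ i j → lookup w (pos (opposite i) j)
      ; at-cell = λ y → trans (cong (lookup w) (trans (cong (λ z → pos z (up (proj₁ (inverse y)))) (Fₚ.opposite-involutive _))
                                                      (pos-cell (proj₁ (inverse y))))) (proj₂ (inverse y))
      ; row-at = λ i j → trans (cong (opposite ∘ down) (back i j)) (trans (cong opposite (down-pos _ _)) (Fₚ.opposite-involutive i))
      ; col-at = λ i j → trans (cong up (back i j)) (up-pos _ _)
      ; row-mono = λ i → value-row (opposite i)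
      ; col-mono = λ i i′ j h → value-col _ _ j (opposite-< i i′ h) }
      where
      back : ∀ i j → proj₁ (inverse (lookup w (pos (opposite i) j))) ≡ pos (opposite i) j
      back i j = perm _ _ (proj₂ (inverse _))

  upper-bound : ∀ k n → n ≡ k * k * k → #SAv n (identityPattern (suc k)) ≤ fRect (k * k) k ^ 2
  upper-bound k _ refl = subst (λ z → #SAv (k * k * k) (identityPattern (suc k)) ≤ z ^ 2) (sym (fRect≡#words (k * k) k))
    (subst (#SAv (k * k * k) (identityPattern (suc k)) ≤_) (cong (c *_) (sym (ℕₚ.*-identityʳ c)))
      (filter-length-≤ (sav? (identityPattern (suc k))) (allVecs-unique _ _) encodePair encodePair-injective))
    where
    c = #words (k * k * k) (rect (k * k) k)
    SAv : Word (k * k * k) → Set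
    SAv w = IsPerm w × StronglyAvoids w (identityPattern (suc k))
    module Ex (w : Word (k * k * k)) (sav : SAv w) =
      Extremal {k * k} {k} w (proj₁ sav) (no-long-desc w (proj₁ sav) {k} (proj₂ sav)) (no-long-asc w (proj₁ sav) {k} (proj₁ (proj₂ sav)))
    encodePair : ∀ w → SAv w → Fin (c * c)
    encodePair w sav = combine (code (Ex.positionTableau w sav)) (code (Ex.valueTableau w sav))
    encodePair-injective : ∀ w w′ sav sav′ → encodePair w sav ≡ encodePair w′ sav′ → w ≡ w′
    encodePair-injective w w′ sav sav′ e =
      trans (sym (Vecₚ.tabulate∘lookup w)) (trans (Vecₚ.tabulate-cong same) (Vecₚ.tabulate∘lookup w′))
      where
      module E  = Ex w sav
      module E′ = Ex w′ sav′
      both = Fₚ.combine-injective (code E.positionTableau) (code E.valueTableau)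
                                  (code E′.positionTableau) (code E′.valueTableau) e
      positions : ∀ i j → E.pos i j ≡ E′.pos i j
      positions = code-injective E.positionTableau E′.positionTableau (proj₁ both)
      values : ∀ i j → lookup w (E.pos (opposite i) j) ≡ lookup w′ (E′.pos (opposite i) j)
      values = code-injective E.valueTableau E′.valueTableau (proj₂ both)
      same : ∀ x → lookup w x ≡ lookup w′ x
      same x = begin
        lookup w x                        ≡⟨ cong (lookup w) (sym (E.pos-cell x)) ⟩
        lookup w (E.pos d u)              ≡⟨ cong (λ z → lookup w (E.pos z u)) (sym (Fₚ.opposite-involutive d)) ⟩
        lookup w (E.pos (opposite (opposite d)) u)    ≡⟨ values (opposite d) u ⟩
        lookup w′ (E′.pos (opposite (opposite d)) u)  ≡⟨ cong (λ z → lookup w′ (E′.pos z u)) (Fₚ.opposite-involutive d) ⟩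
        lookup w′ (E′.pos d u)            ≡⟨ cong (lookup w′) (trans (sym (positions d u)) (E.pos-cell x)) ⟩
        lookup w′ x                       ∎
        where
        open ≡-Reasoning
        d = E.down x
        u = E.up x

-- Standard tableaux read from lattice words.

module Tableaux where

  open HookLength
  open Counting
  open import Data.Nat using (_+_; _*_)
  open import Data.List.Properties using (∷-injectiveʳ)

  lookup-remove-≡ : ∀ {p} (v : Vec ℕ p) r → lookup (remove v r) r ≡ pred (lookup v r)
  lookup-remove-≡ (x ∷ v) zero    = refl
  lookup-remove-≡ (x ∷ v) (suc r) = lookup-remove-≡ v r

  lookup-remove-≢ : ∀ {p} (v : Vec ℕ p) r i → i ≢ r → lookup (remove v r) i ≡ lookup v i
  lookup-remove-≢ (x ∷ v) zero    zero    ne = contradiction refl ne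
  lookup-remove-≢ (x ∷ v) zero    (suc i) ne = refl
  lookup-remove-≢ (x ∷ v) (suc r) zero    ne = refl
  lookup-remove-≢ (x ∷ v) (suc r) (suc i) ne = lookup-remove-≢ v r i (ne ∘ cong suc)

  lookup≤head₀ : ∀ {p} (v : Vec ℕ p) → Partition v → ∀ i → lookup v i ≤ head₀ v
  lookup≤head₀ (x ∷ v) pv      zero    = ℕₚ.≤-refl
  lookup≤head₀ (x ∷ v) (h , pv) (suc i) = ℕₚ.≤-trans (lookup≤head₀ v pv i) h

  removable⇒drop : ∀ {p} (v : Vec ℕ p) → Partition v → ∀ r i → T (removable v r) → r F.< i → lookup v i < lookup v r
  removable⇒drop (x ∷ v) (_ , pv) zero    (suc i) ok _       =
    ℕₚ.≤-<-trans (lookup≤head₀ v pv i) (ℕₚ.<ᵇ⇒< (head₀ v) x ok)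
  removable⇒drop (x ∷ v) (_ , pv) (suc r) (suc i) ok (s≤s h) = removable⇒drop v pv r i ok h

  removable⇒pos : ∀ {p} (v : Vec ℕ p) r → T (removable v r) → 0 < lookup v r
  removable⇒pos (x ∷ v) zero    ok = ℕₚ.≤-<-trans z≤n (ℕₚ.<ᵇ⇒< (head₀ v) x ok)
  removable⇒pos (x ∷ v) (suc r) ok = removable⇒pos v r ok

  LastCell : ∀ {p} → Vec ℕ p → Fin p → Fin p → ℕ → Set
  LastCell v r i j = i ≡ r × suc j ≡ lookup v i

  lastCell? : ∀ {p} (v : Vec ℕ p) r i j → Dec (LastCell v r i j)
  lastCell? v r i j = (i Fₚ.≟ r) ×-dec (suc j ℕₚ.≟ lookup v i)

  -- The entry of cell (i , j) in the tableau with lattice word w, junk outside the shape.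
  entry : ∀ {p n} → Vec (Fin p) n → Vec ℕ p → Fin p → ℕ → ℕ
  entry []              v i j = 0
  entry {n = suc n} (r ∷ w) v i j with lastCell? v r i j
  ... | yes _ = n
  ... | no _  = entry w (remove v r) i j

  stays : ∀ {p} (v : Vec ℕ p) r i j → ¬ LastCell v r i j → j < lookup v i → j < lookup (remove v r) i
  stays v r i j ¬l j<v with i Fₚ.≟ r
  ... | yes refl = subst (j <_) (sym (lookup-remove-≡ v i))
                     (ℕₚ.<⇒≤pred (ℕₚ.≤∧≢⇒< j<v λ e → ¬l (refl , e)))
  ... | no ne    = subst (j <_) (sym (lookup-remove-≢ v r i ne)) j<v

  lookup≤size : ∀ {p} (v : Vec ℕ p) i → lookup v i ≤ size v
  lookup≤size (x ∷ v) zero    = ℕₚ.m≤m+n x (size v)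
  lookup≤size (x ∷ v) (suc i) = ℕₚ.≤-trans (lookup≤size v i) (ℕₚ.m≤n+m (size v) x)

  entry-bound : ∀ {p n} (w : Vec (Fin p) n) v → Lattice w v → size v ≡ n → ∀ i j → j < lookup v i → entry w v i j < n
  entry-bound [] v _ e i j h = contradiction (ℕₚ.<-≤-trans h (subst (lookup v i ≤_) e (lookup≤size v i))) λ ()
  entry-bound (r ∷ w) v (ok , l) e i j h with lastCell? v r i j
  ... | yes _ = ℕₚ.≤-refl
  ... | no ¬l = ℕₚ.m≤n⇒m≤1+n (entry-bound w _ l (ℕₚ.suc-injective (trans (remove-size v r ok) e)) i j (stays v r i j ¬l h))

  module _ {p n} (r : Fin p) (w : Vec (Fin p) n) (v : Vec ℕ p) (ok : T (removable v r)) (l : Lattice w (remove v r))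
           (e : size v ≡ suc n) where

    size′ : size (remove v r) ≡ n
    size′ = ℕₚ.suc-injective (trans (remove-size v r ok) e)

    earlier : ∀ i j → ¬ LastCell v r i j → j < lookup v i → entry w (remove v r) i j < n
    earlier i j ¬l h = entry-bound w _ l size′ i j (stays v r i j ¬l h)

  entry-row : ∀ {p n} (w : Vec (Fin p) n) v → Lattice w v → size v ≡ n →
    ∀ i j j′ → j < j′ → j′ < lookup v i → entry w v i j < entry w v i j′
  entry-row [] v _ e i j j′ _ h = contradiction (ℕₚ.<-≤-trans h (subst (lookup v i ≤_) e (lookup≤size v i))) λ ()
  entry-row (r ∷ w) v (ok , l) e i j j′ j<j′ h with lastCell? v r i j | lastCell? v r i j′
  ... | yes (_ , eq) | _      = contradiction h (ℕₚ.≤⇒≯ (subst (_≤ j′) eq j<j′))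
  ... | no ¬l | yes _  = earlier r w v ok l e i j ¬l (ℕₚ.<-trans j<j′ h)
  ... | no ¬l | no ¬l′ = entry-row w _ l (size′ r w v ok l e) i j j′ j<j′ (stays v r i j′ ¬l′ h)

  -- The largest entry sits at a removable corner, and by `removable⇒drop` every lower row is too
  -- short to reach its column. The remaining cells keep their entries in the smaller shape.
  entry-col : ∀ {p n} (w : Vec (Fin p) n) v → Partition v → Lattice w v → size v ≡ n →
    ∀ i i′ j → i F.< i′ → j < lookup v i → j < lookup v i′ → entry w v i j < entry w v i′ j
  entry-col [] v pv _ e i i′ j _ h _ = contradiction (ℕₚ.<-≤-trans h (subst (lookup v i ≤_) e (lookup≤size v i))) λ ()
  entry-col (r ∷ w) v pv (ok , l) e i i′ j i<i′ h h′ with lastCell? v r i j | lastCell? v r i′ j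
  ... | yes (refl , eq) | _ = contradiction (removable⇒drop v pv r i′ ok i<i′) (ℕₚ.≤⇒≯ (subst (_≤ lookup v i′) eq h′))
  ... | no ¬l | yes _  = earlier r w v ok l e i j ¬l h
  ... | no ¬l | no ¬l′ = entry-col w _ (remove-partition v r pv ok) l (size′ r w v ok l e) i i′ j i<i′
                           (stays v r i j ¬l h) (stays v r i′ j ¬l′ h′)

  entry-injective : ∀ {p n} (w : Vec (Fin p) n) v → Lattice w v → size v ≡ n →
    ∀ i j i′ j′ → j < lookup v i → j′ < lookup v i′ → entry w v i j ≡ entry w v i′ j′ → i ≡ i′ × j ≡ j′
  entry-injective [] v _ e i j i′ j′ h _ _ = contradiction (ℕₚ.<-≤-trans h (subst (lookup v i ≤_) e (lookup≤size v i))) λ ()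
  entry-injective (r ∷ w) v (ok , l) e i j i′ j′ h h′ q with lastCell? v r i j | lastCell? v r i′ j′
  ... | yes (refl , a) | yes (refl , b) = refl , ℕₚ.suc-injective (trans a (sym b))
  ... | yes _ | no ¬l  = contradiction (earlier r w v ok l e i′ j′ ¬l h′) (ℕₚ.<-irrefl (sym q))
  ... | no ¬l | yes _  = contradiction (earlier r w v ok l e i j ¬l h) (ℕₚ.<-irrefl q)
  ... | no ¬l | no ¬l′ = entry-injective w _ l (size′ r w v ok l e) i j i′ j′ (stays v r i j ¬l h) (stays v r i′ j′ ¬l′ h′) q

  entry-last : ∀ {p n} r (w : Vec (Fin p) n) v i j → LastCell v r i j → entry (r ∷ w) v i j ≡ n
  entry-last r w v i j lc with lastCell? v r i j
  ... | yes _ = refl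
  ... | no ¬l = contradiction lc ¬l

  entry-tail : ∀ {p n} r (w : Vec (Fin p) n) v i j → ¬ LastCell v r i j → entry (r ∷ w) v i j ≡ entry w (remove v r) i j
  entry-tail r w v i j ¬lc with lastCell? v r i j
  ... | yes lc = contradiction lc ¬lc
  ... | no _   = refl

  unstays : ∀ {p} (v : Vec ℕ p) r i j → j < lookup (remove v r) i → ¬ LastCell v r i j × j < lookup v i
  unstays v r i j h with i Fₚ.≟ r
  ... | yes refl = (λ { (_ , e) → ℕₚ.<-irrefl refl (subst (λ z → j < pred z) (sym e) h′) }) ,
                   ℕₚ.<-≤-trans h′ ℕₚ.pred[n]≤n
    where h′ = subst (j <_) (lookup-remove-≡ v i) h
  ... | no ne    = (λ { (e , _) → ne e }) , subst (j <_) (lookup-remove-≢ v r i ne) h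

  -- The first letter is the row of the largest entry: if two words begin differently, the end of
  -- row `r` holds that entry in one tableau and a smaller one in the other.
  entry-determines : ∀ {p n} (w w′ : Vec (Fin p) n) v → Lattice w v → Lattice w′ v → size v ≡ n →
    (∀ i j → j < lookup v i → entry w v i j ≡ entry w′ v i j) → w ≡ w′
  entry-determines []      []        v _ _ _ _ = refl
  entry-determines {n = suc n} (r ∷ w) (r′ ∷ w′) v (ok , l) (ok′ , l′) e h with r Fₚ.≟ r′
  ... | no ne = contradiction (trans (sym (entry-last r w v r j lc)) (h r j j<)) (ℕₚ.<⇒≢ (subst (_< n) (sym (entry-tail r′ w′ v r j ¬lc)) (earlier r′ w′ v ok′ l′ e r j ¬lc j<)) ∘ sym)
    where
    j = pred (lookup v r)
    sj : suc j ≡ lookup v r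
    sj = ℕₚ.suc-pred (lookup v r) {{ℕ.>-nonZero (removable⇒pos v r ok)}}
    lc : LastCell v r r j
    lc = refl , sj
    j< : j < lookup v r
    j< = ℕₚ.≤-reflexive sj
    ¬lc : ¬ LastCell v r′ r j
    ¬lc (e , _) = ne e
  ... | yes refl = cong (r ∷_) (entry-determines w w′ _ l l′ (size′ r w v ok l e) λ i j j< →
          let ¬lc , j<′ = unstays v r i j j<
          in trans (sym (entry-tail r w v i j ¬lc)) (trans (h i j j<′) (entry-tail r w′ v i j ¬lc)))

  record IsStandard {p q} (A : Fin p → Fin q → ℕ) : Set where
    field
      bound     : ∀ i j → A i j < p * q
      row-mono  : ∀ i j j′ → j F.< j′ → A i j < A i j′
      col-mono  : ∀ i i′ j → i F.< i′ → A i j < A i′ j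
      injective : ∀ i j i′ j′ → A i j ≡ A i′ j′ → i ≡ i′ × j ≡ j′

    flat : Fin (p * q) → Fin (p * q)
    flat x = fromℕ< (bound (F.quotient q x) (F.remainder {p} q x))

    toℕ-flat : ∀ i j → toℕ (flat (combine i j)) ≡ A i j
    toℕ-flat i j = trans (Fₚ.toℕ-fromℕ< _) (cong (λ z → A (proj₁ z) (proj₂ z)) (Fₚ.remQuot-combine {p} {q} i j))

    flat-injective : Injective flat
    flat-injective {x} {y} e = trans (sym (Fₚ.combine-remQuot {p} q x)) (trans (cong₂ combine (proj₁ both) (proj₂ both)) (Fₚ.combine-remQuot {p} q y))
      where both = injective _ _ _ _ (trans (sym (Fₚ.toℕ-fromℕ< _)) (trans (cong toℕ e) (Fₚ.toℕ-fromℕ< _)))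

    surjective : ∀ t → t < p * q → ∃ λ i → ∃ λ j → A i j ≡ t
    surjective t t< with injective⇒surjective flat flat-injective (fromℕ< t<)
    ... | x , e = F.quotient q x , F.remainder {p} q x ,
                  trans (sym (Fₚ.toℕ-fromℕ< _)) (trans (cong toℕ e) (Fₚ.toℕ-fromℕ< t<))

  -- Both fillings use exactly the numbers below `p * q`, so sending each entry of `A` to the entry
  -- of `B` in the same cell is a strictly increasing self-map. Hence the relative order of the
  -- cells is all that has to be recovered from a permutation.
  order-determines : ∀ {p q} {A B : Fin p → Fin q → ℕ} → IsStandard A → IsStandard B →
    (∀ i j i′ j′ → A i j < A i′ j′ → B i j < B i′ j′) → ∀ i j → A i j ≡ B i j
  order-determines {p} {q} {A} {B} sA sB h i j = begin
    A i j                        ≡⟨ sA.toℕ-flat i j ⟨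
    toℕ (sA.flat x)              ≡⟨ cong toℕ (strictMono⇒id θ θ-mono (sA.flat x)) ⟨
    toℕ (θ (sA.flat x))          ≡⟨ cong (toℕ ∘ sB.flat) (sA.flat-injective (proj₂ (inv (sA.flat x)))) ⟩
    toℕ (sB.flat x)              ≡⟨ sB.toℕ-flat i j ⟩
    B i j                        ∎
    where
    open ≡-Reasoning
    module sA = IsStandard sA
    module sB = IsStandard sB
    x = combine i j
    inv = injective⇒surjective sA.flat sA.flat-injective
    θ : Fin (p * q) → Fin (p * q)
    θ y = sB.flat (proj₁ (inv y))
    flat-mono : ∀ x y → sA.flat x F.< sA.flat y → sB.flat x F.< sB.flat y
    flat-mono x y l = subst₂ _<_ (sym (Fₚ.toℕ-fromℕ< _)) (sym (Fₚ.toℕ-fromℕ< _))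
      (h _ _ _ _ (subst₂ _<_ (Fₚ.toℕ-fromℕ< _) (Fₚ.toℕ-fromℕ< _) l))
    θ-mono : StrictMono θ
    θ-mono y y′ l = flat-mono _ _ (subst₂ F._<_ (sym (proj₂ (inv y))) (sym (proj₂ (inv y′))) l)

  #SYT : ℕ → ℕ → ℕ
  #SYT p q = #words (p * q) (rect p q)

  module _ (p q : ℕ) where

    private
      wordOf : Fin (#SYT p q) → Vec (Fin p) (p * q)
      wordOf z = proj₁ (decode (p * q) (rect p q) z)

      latticeOf : ∀ z → Lattice (wordOf z) (rect p q)
      latticeOf z = proj₁ (proj₂ (decode (p * q) (rect p q) z))

      inside : ∀ i (j : Fin q) → toℕ j < lookup (rect p q) i
      inside i j = subst (toℕ j <_) (sym (Vecₚ.lookup-replicate i q)) (Fₚ.toℕ<n j)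

    tableau : Fin (#SYT p q) → Fin p → Fin q → ℕ
    tableau z i j = entry (wordOf z) (rect p q) i (toℕ j)

    tableau-standard : ∀ z → IsStandard (tableau z)
    tableau-standard z = record
      { bound     = λ i j → entry-bound w v l s i (toℕ j) (inside i j)
      ; row-mono  = λ i j j′ h → entry-row w v l s i _ _ h (inside i j′)
      ; col-mono  = λ i i′ j h → entry-col w v (rect-partition p q) l s i i′ _ h (inside i j) (inside i′ j)
      ; injective = λ i j i′ j′ e → let e₁ , e₂ = entry-injective w v l s i _ i′ _ (inside i j) (inside i′ j′) e
                                    in e₁ , Fₚ.toℕ-injective e₂ }
      where
      w = wordOf z
      v = rect p q
      l = latticeOf z
      s = rect-size p q

    tableau-injective : ∀ z z′ → (∀ i j → tableau z i j ≡ tableau z′ i j) → z ≡ z′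
    tableau-injective z z′ h = trans (sym (proj₂ (proj₂ d))) (trans (go _ _ _ _ same) (proj₂ (proj₂ d′)))
      where
      d  = decode (p * q) (rect p q) z
      d′ = decode (p * q) (rect p q) z′
      same : wordOf z ≡ wordOf z′
      same = entry-determines _ _ (rect p q) (latticeOf z) (latticeOf z′) (rect-size p q) λ i j j< →
        let j<q = subst (j <_) (Vecₚ.lookup-replicate i q) j<
        in subst (λ y → entry (wordOf z) (rect p q) i y ≡ entry (wordOf z′) (rect p q) i y) (Fₚ.toℕ-fromℕ< j<q) (h i (fromℕ< j<q))
      T-irr : ∀ b (x y : T b) → x ≡ y
      T-irr true _ _ = refl
      lattice-irr : ∀ {n} (w : Vec (Fin p) n) v (l l′ : Lattice w v) → l ≡ l′
      lattice-irr []      v _ _ = refl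
      lattice-irr (r ∷ w) v (a , l) (b , l′) = cong₂ _,_ (T-irr _ a b) (lattice-irr w _ l l′)
      go : ∀ w w′ (l : Lattice w (rect p q)) l′ → w ≡ w′ → encode w l ≡ encode w′ l′
      go w _ l l′ refl = cong (encode w) (lattice-irr w _ l l′)

  -- Shuffles as words in two letters.

  num : Bool → List Bool → ℕ
  num c []              = 0
  num true  (true ∷ w)  = suc (num true w)
  num true  (false ∷ w) = num true w
  num false (true ∷ w)  = num false w
  num false (false ∷ w) = suc (num false w)

  -- The position of the x-th letter c; past the last letter c it is junk, but stays increasing in x.
  pos : Bool → List Bool → ℕ → ℕ
  pos c     []          x       = x
  pos true  (true ∷ w)  zero    = 0
  pos true  (true ∷ w)  (suc x) = suc (pos true w x)
  pos true  (false ∷ w) x       = suc (pos true w x)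
  pos false (false ∷ w) zero    = 0
  pos false (false ∷ w) (suc x) = suc (pos false w x)
  pos false (true ∷ w)  x       = suc (pos false w x)

  pos-mono : ∀ c w {x y} → x < y → pos c w x < pos c w y
  pos-mono c     []          h                     = h
  pos-mono true  (true ∷ w)  {zero}  {suc y} h     = z<s
  pos-mono true  (true ∷ w)  {suc x} {suc y} h     = s<s (pos-mono true w (ℕ.s<s⁻¹ h))
  pos-mono true  (false ∷ w) h                     = s<s (pos-mono true w h)
  pos-mono false (false ∷ w) {zero}  {suc y} h     = z<s
  pos-mono false (false ∷ w) {suc x} {suc y} h     = s<s (pos-mono false w (ℕ.s<s⁻¹ h))
  pos-mono false (true ∷ w)  h                     = s<s (pos-mono false w h)

  pos-bound : ∀ c w {x} → x < num c w → pos c w x < length w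
  pos-bound true  (true ∷ w)  {zero}  h = z<s
  pos-bound true  (true ∷ w)  {suc x} h = s<s (pos-bound true w (ℕ.s<s⁻¹ h))
  pos-bound true  (false ∷ w) h         = s<s (pos-bound true w h)
  pos-bound false (false ∷ w) {zero}  h = z<s
  pos-bound false (false ∷ w) {suc x} h = s<s (pos-bound false w (ℕ.s<s⁻¹ h))
  pos-bound false (true ∷ w)  h         = s<s (pos-bound false w h)

  pos-disjoint : ∀ w {x y} → x < num false w → y < num true w → pos false w x ≢ pos true w y
  pos-disjoint (true ∷ w)  {x}     {zero}  hx hy ()
  pos-disjoint (true ∷ w)  {x}     {suc y} hx hy e = pos-disjoint w hx (ℕ.s<s⁻¹ hy) (ℕₚ.suc-injective e)
  pos-disjoint (false ∷ w) {zero}  {y}     hx hy ()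
  pos-disjoint (false ∷ w) {suc x} {y}     hx hy e = pos-disjoint w (ℕ.s<s⁻¹ hx) hy (ℕₚ.suc-injective e)

  -- Comparisons between different letters suffice: if the words begin differently, their first
  -- `false` and first `true` are ordered oppositely.
  pos-determines : ∀ w w′ → num false w ≡ num false w′ → num true w ≡ num true w′ →
    (∀ x y → x < num false w → y < num true w → pos false w x < pos true w y → pos false w′ x < pos true w′ y) →
    (∀ x y → x < num false w → y < num true w → pos false w′ x < pos true w′ y → pos false w x < pos true w y) →
    w ≡ w′
  pos-determines []          []           e e′ f g = refl
  pos-determines []          (true ∷ _)   e () f g
  pos-determines []          (false ∷ _)  () e′ f g
  pos-determines (true ∷ _)  []           e () f g
  pos-determines (false ∷ _) []           () e′ f g
  pos-determines (true ∷ w)  (true ∷ w′)  e e′ f g = cong (true ∷_) (pos-determines w w′ e (ℕₚ.suc-injective e′)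
    (λ x y hx hy l → ℕ.s<s⁻¹ (f x (suc y) hx (s<s hy) (s<s l)))
    (λ x y hx hy l → ℕ.s<s⁻¹ (g x (suc y) hx (s<s hy) (s<s l))))
  pos-determines (false ∷ w) (false ∷ w′) e e′ f g = cong (false ∷_) (pos-determines w w′ (ℕₚ.suc-injective e) e′
    (λ x y hx hy l → ℕ.s<s⁻¹ (f (suc x) y (s<s hx) hy (s<s l)))
    (λ x y hx hy l → ℕ.s<s⁻¹ (g (suc x) y (s<s hx) hy (s<s l))))
  pos-determines (true ∷ w)  (false ∷ w′) e e′ f g = contradiction (g 0 0 (subst (0 <_) (sym e) z<s) z<s z<s) λ ()
  pos-determines (false ∷ w) (true ∷ w′)  e e′ f g = contradiction (f 0 0 z<s (subst (0 <_) (sym e′) z<s) z<s) λ ()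

  num-length : ∀ w → num false w + num true w ≡ length w
  num-length []          = refl
  num-length (true ∷ w)  = trans (ℕₚ.+-suc _ _) (cong suc (num-length w))
  num-length (false ∷ w) = cong suc (num-length w)

  Shuffle : ℕ → ℕ → Set
  Shuffle a b = Σ (List Bool) λ w → num false w ≡ a × num true w ≡ b

  #shuffles : ℕ → ℕ → ℕ
  #shuffles zero    b       = 1
  #shuffles (suc a) zero    = 1
  #shuffles (suc a) (suc b) = #shuffles a (suc b) + #shuffles (suc a) b

  #shuffles≡C : ∀ a b → #shuffles a b ≡ (a + b) C a
  #shuffles≡C zero    b       = refl
  #shuffles≡C (suc a) zero    = sym (trans (cong (_C suc a) (ℕₚ.+-identityʳ (suc a))) (nCn≡1 (suc a)))
  #shuffles≡C (suc a) (suc b) = begin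
    #shuffles a (suc b) + #shuffles (suc a) b   ≡⟨ cong₂ _+_ (#shuffles≡C a (suc b)) (#shuffles≡C (suc a) b) ⟩
    (a + suc b) C a + (suc a + b) C suc a       ≡⟨ cong (λ z → (a + suc b) C a + z C suc a) (sym (ℕₚ.+-suc a b)) ⟩
    (a + suc b) C a + (a + suc b) C suc a       ≡⟨ nCk+nC[k+1]≡[n+1]C[k+1] (a + suc b) a ⟩
    (suc a + suc b) C suc a                     ∎
    where open ≡-Reasoning

  shuffle : ∀ a b → Fin (#shuffles a b) → Shuffle a b
  shuffle zero    zero    _ = [] , refl , refl
  shuffle zero    (suc b) z with shuffle zero b zero
  ... | w , e , e′ = true ∷ w , e , cong suc e′
  shuffle (suc a) zero    _ with shuffle a zero (subst Fin (sym (#shuffles-zero a)) zero)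
    where
    #shuffles-zero : ∀ a → #shuffles a zero ≡ 1
    #shuffles-zero zero    = refl
    #shuffles-zero (suc a) = refl
  ... | w , e , e′ = false ∷ w , cong suc e , e′
  shuffle (suc a) (suc b) z with splitAt (#shuffles a (suc b)) z
  ... | inj₁ x = let w , e , e′ = shuffle a (suc b) x in false ∷ w , cong suc e , e′
  ... | inj₂ y = let w , e , e′ = shuffle (suc a) b y in true ∷ w , e , cong suc e′

  shuffle-injective : ∀ a b x y → proj₁ (shuffle a b x) ≡ proj₁ (shuffle a b y) → x ≡ y
  shuffle-injective zero    b       zero zero _ = refl
  shuffle-injective (suc a) zero    zero zero _ = refl
  shuffle-injective (suc a) (suc b) x y e
    with splitAt (#shuffles a (suc b)) x in ex | splitAt (#shuffles a (suc b)) y in ey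
  ... | inj₁ u | inj₁ v = trans (sym (Fₚ.splitAt⁻¹-↑ˡ ex)) (trans (cong (_↑ˡ _) (shuffle-injective a (suc b) u v (∷-injectiveʳ e))) (Fₚ.splitAt⁻¹-↑ˡ ey))
  ... | inj₂ u | inj₂ v = trans (sym (Fₚ.splitAt⁻¹-↑ʳ ex)) (trans (cong (_ ↑ʳ_) (shuffle-injective (suc a) b u v (∷-injectiveʳ e))) (Fₚ.splitAt⁻¹-↑ʳ ey))
  ... | inj₁ u | inj₂ v = contradiction e λ ()
  ... | inj₂ u | inj₁ v = contradiction e λ ()

  bits : ∀ N → Fin (2 ^ N) → List Bool
  bits zero    _ = []
  bits (suc N) z with splitAt (2 ^ N) z
  ... | inj₁ x = false ∷ bits N x
  ... | inj₂ y with splitAt (2 ^ N) y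
  ... | inj₁ x  = true ∷ bits N x
  ... | inj₂ ()

  bits-length : ∀ N z → length (bits N z) ≡ N
  bits-length zero    z = refl
  bits-length (suc N) z with splitAt (2 ^ N) z
  ... | inj₁ x = cong suc (bits-length N x)
  ... | inj₂ y with splitAt (2 ^ N) y
  ... | inj₁ x  = cong suc (bits-length N x)
  ... | inj₂ ()

  bits-injective : ∀ N x y → bits N x ≡ bits N y → x ≡ y
  bits-injective zero    zero zero _ = refl
  bits-injective (suc N) x y e with splitAt (2 ^ N) x in ex | splitAt (2 ^ N) y in ey
  ... | inj₁ u | inj₁ v = trans (sym (Fₚ.splitAt⁻¹-↑ˡ ex)) (trans (cong (_↑ˡ _) (bits-injective N u v (∷-injectiveʳ e))) (Fₚ.splitAt⁻¹-↑ˡ ey))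
  bits-injective (suc N) x y e | inj₂ u | inj₂ v with splitAt (2 ^ N) u in eu | splitAt (2 ^ N) v in ev
  ... | inj₁ a | inj₁ b = trans (sym (Fₚ.splitAt⁻¹-↑ʳ ex)) (trans (cong ((2 ^ N) ↑ʳ_)
          (trans (sym (Fₚ.splitAt⁻¹-↑ˡ eu)) (trans (cong (_↑ˡ _) (bits-injective N a b (∷-injectiveʳ e))) (Fₚ.splitAt⁻¹-↑ˡ ev)))) (Fₚ.splitAt⁻¹-↑ʳ ey))
  bits-injective (suc N) x y e | inj₁ u | inj₂ v with splitAt (2 ^ N) v
  ... | inj₁ b  = contradiction e λ ()
  ... | inj₂ ()
  bits-injective (suc N) x y e | inj₂ u | inj₁ v with splitAt (2 ^ N) u
  ... | inj₁ b  = contradiction e λ ()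
  ... | inj₂ ()

-- Shuffles that are symmetric under reflection.

module LayerOrder where

  open Counting
  open Tableaux
  open import Data.Nat using (_+_; _*_)

  reflect-reflect : ∀ {m t} → t < m → m ∸ suc (m ∸ suc t) ≡ t
  reflect-reflect {suc m} (s≤s t≤m) = ℕₚ.m∸[m∸n]≡n t≤m

  reflect-< : ∀ {m t} → t < m → m ∸ suc t < m
  reflect-< {suc m} {t} _ = s≤s (ℕₚ.m∸n≤m m t)

  reflect-anti : ∀ {m s t} → s < t → t < m → m ∸ suc t < m ∸ suc s
  reflect-anti s<t t<m = ℕₚ.∸-monoʳ-< (s≤s s<t) t<m

  -- A word w of length N describes a shuffle of N points with their mirror images in
  -- [0 , 2N] that is symmetric about N: the letters of w list the first half.
  module Mirror (N : ℕ) (w : List Bool) (len : length w ≡ N) where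

    r : ℕ
    r = num false w

    data View (x : ℕ) : ℕ → Set where
      low  : x < r → pos false w x < N → View x (pos false w x)
      high : r ≤ x → ∀ y → y ≡ N ∸ suc x → y < num true w → pos true w y < N → View x ((N + N) ∸ pos true w y)

    r+ : r + num true w ≡ N
    r+ = trans (num-length w) len

    abstract
      mirror : ℕ → ℕ
      mirror x with x ℕₚ.<? r
      ... | yes _ = pos false w x
      -- Reflection reverses the order of the images, so the letter `true` number `y` is the image
      -- of the point `N ∸ suc y`; the point itself lies at the reflected place.
      ... | no _  = (N + N) ∸ pos true w (N ∸ suc x)

      view : ∀ x → x < N → View x (mirror x)
      view x x<N with x ℕₚ.<? r
      ... | yes x<r = low x<r (subst (_ <_) len (pos-bound false w x<r))
      ... | no x≮r  = high (ℕₚ.≮⇒≥ x≮r) (N ∸ suc x) refl y< (subst (pos true w (N ∸ suc x) <_) len (pos-bound true w y<))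
        where
        y< : N ∸ suc x < num true w
        y< = subst (N ∸ suc x <_) (trans (cong (_∸ r) (sym r+)) (ℕₚ.m+n∸m≡n r _)) (ℕₚ.∸-monoʳ-< (s≤s (ℕₚ.≮⇒≥ x≮r)) x<N)

      mirror-low : ∀ {x} → x < r → mirror x ≡ pos false w x
      mirror-low {x} h with x ℕₚ.<? r
      ... | yes _ = refl
      ... | no h′ = contradiction h h′

    far : ∀ {a} → a < N → N < (N + N) ∸ a
    far {a} a<N = subst (_< (N + N) ∸ a) (ℕₚ.m+n∸n≡m N N) (ℕₚ.∸-monoʳ-< a<N (ℕₚ.m≤n+m N N))

    within : ∀ {a} → a < N → a ≤ N + N
    within a<N = ℕₚ.≤-trans (ℕₚ.<⇒≤ a<N) (ℕₚ.m≤m+n N N)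

    mirror-mono : ∀ {x y} → x < y → y < N → mirror x < mirror y
    mirror-mono {x} {y} x<y y<N with mirror x | view x (ℕₚ.<-trans x<y y<N) | mirror y | view y y<N
    ... | _ | low _ _ | _ | low _ _ = pos-mono false w x<y
    ... | _ | low _ a | _ | high _ _ _ _ b = ℕₚ.<-trans a (far b)
    ... | _ | high r≤x _ _ _ _ | _ | low y<r _ = contradiction (ℕₚ.<-≤-trans x<y (ℕₚ.<⇒≤ y<r)) (ℕₚ.≤⇒≯ r≤x)
    ... | _ | high _ _ refl _ a | _ | high _ _ refl _ _ = ℕₚ.∸-monoʳ-< (pos-mono true w (reflect-anti x<y y<N)) (within a)

    mirror-≤ : ∀ {x} → x < N → mirror x ≤ N + N
    mirror-≤ {x} h with mirror x | view x h
    ... | _ | low _ a        = within a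
    ... | _ | high _ y _ _ _ = ℕₚ.m∸n≤m (N + N) (pos true w y)

    -- Keeps the place `N` free for the central cell of the layer, which is its own image.
    mirror≢centre : ∀ {x} → x < N → mirror x ≢ N
    mirror≢centre {x} h with mirror x | view x h
    ... | _ | low _ a        = ℕₚ.<⇒≢ a
    ... | _ | high _ _ _ _ a = ℕₚ.<⇒≢ (far a) ∘ sym

    mirror≢reflection : ∀ {x y} → x < N → y < N → mirror x ≢ (N + N) ∸ mirror y
    mirror≢reflection {x} {y} hx hy e with mirror x | view x hx | mirror y | view y hy
    ... | _ | low _ a | _ | low _ b = ℕₚ.<-asym a (subst (N <_) (sym e) (far b))
    ... | _ | low x< a | _ | high _ _ _ y< b = pos-disjoint w x< y< (trans e (ℕₚ.m∸[m∸n]≡n (within b)))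
    ... | _ | high _ _ _ x< a | _ | low y< b = pos-disjoint w y< x<
            (trans (sym (ℕₚ.m∸[m∸n]≡n (within b))) (trans (cong ((N + N) ∸_) (sym e)) (ℕₚ.m∸[m∸n]≡n (within a))))
    ... | _ | high _ _ _ _ a | _ | high _ _ _ _ b =
            ℕₚ.<-asym (far a) (subst (_< N) (sym (trans e (ℕₚ.m∸[m∸n]≡n (within b)))) b)

    mirror-injective : ∀ {x y} → x < N → y < N → mirror x ≡ mirror y → x ≡ y
    mirror-injective {x} {y} hx hy e with ℕₚ.<-cmp x y
    ... | tri< l _ _ = contradiction e (ℕₚ.<⇒≢ (mirror-mono l hy))
    ... | tri≈ _ l _ = l
    ... | tri> _ _ l = contradiction (sym e) (ℕₚ.<⇒≢ (mirror-mono l hx))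

    -- Together with `first-half⁻` this makes the number of letters `false` visible in the order:
    -- they belong to the points that precede their own image.
    first-half : ∀ {x} → x < N → x < r → mirror x < (N + N) ∸ mirror x
    first-half {x} h x<r with mirror x | view x h
    ... | _ | low _ a          = ℕₚ.<-trans a (far a)
    ... | _ | high r≤x _ _ _ _ = contradiction x<r (ℕₚ.≤⇒≯ r≤x)

    first-half⁻ : ∀ {x} → x < N → mirror x < (N + N) ∸ mirror x → x < r
    first-half⁻ {x} h l with mirror x | view x h
    ... | _ | low x<r _ = x<r
    ... | _ | high _ y _ _ a = contradiction (ℕₚ.<-trans (subst ((N + N) ∸ pos true w y <_) (ℕₚ.m∸[m∸n]≡n (within a)) l) a) (ℕₚ.<-asym (far a))

    mirror-high : ∀ {y} → y < num true w → (N + N) ∸ mirror (N ∸ suc y) ≡ pos true w y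
    mirror-high {y} h with mirror (N ∸ suc y) | view (N ∸ suc y) (reflect-< y<N)
      where
      y<N : y < N
      y<N = subst (y <_) r+ (ℕₚ.<-≤-trans h (ℕₚ.m≤n+m _ r))
    ... | _ | low x<r _ = contradiction x<r (ℕₚ.≤⇒≯ r≤)
      where
      r≤ : r ≤ N ∸ suc y
      r≤ = subst (_≤ N ∸ suc y) (trans (cong (_∸ num true w) (sym r+)) (ℕₚ.m+n∸n≡m r (num true w))) (ℕₚ.∸-monoʳ-≤ N h)
    ... | _ | high _ y′ e _ a = trans (ℕₚ.m∸[m∸n]≡n (within a)) (cong (pos true w) (trans e (reflect-reflect y<N)))
      where
      y<N : y < N
      y<N = subst (y <_) r+ (ℕₚ.<-≤-trans h (ℕₚ.m≤n+m _ r))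

  module _ (N : ℕ) (w w′ : List Bool) (len : length w ≡ N) (len′ : length w′ ≡ N) where
    private
      module M  = Mirror N w len
      module M′ = Mirror N w′ len′

    SameSide : Set
    SameSide = ∀ x y → x < N → y < N → M.mirror x < (N + N) ∸ M.mirror y → M′.mirror x < (N + N) ∸ M′.mirror y

  module _ (N : ℕ) (w w′ : List Bool) (len : length w ≡ N) (len′ : length w′ ≡ N) where
    private
      module M  = Mirror N w len
      module M′ = Mirror N w′ len′

    false-≤ : SameSide N w w′ len len′ → num false w ≤ num false w′
    false-≤ h = ℕₚ.≮⇒≥ λ r′<r → ℕₚ.<-irrefl refl
      (M′.first-half⁻ (<N r′<r) (h _ _ (<N r′<r) (<N r′<r) (M.first-half (<N r′<r) r′<r)))
      where
      <N : ∀ {x} → x < M.r → x < N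
      <N l = subst (_ <_) M.r+ (ℕₚ.<-≤-trans l (ℕₚ.m≤m+n M.r _))

    transfer : SameSide N w w′ len len′ → num false w ≡ num false w′ → num true w ≡ num true w′ →
      ∀ x y → x < num false w → y < num true w → pos false w x < pos true w y → pos false w′ x < pos true w′ y
    transfer h e e′ x y hx hy l = subst₂ _<_ (M′.mirror-low (subst (x <_) e hx)) (M′.mirror-high (subst (y <_) e′ hy))
      (h x (N ∸ suc y) (subst (x <_) M.r+ (ℕₚ.<-≤-trans hx (ℕₚ.m≤m+n M.r _)))
         (reflect-< (subst (y <_) M.r+ (ℕₚ.<-≤-trans hy (ℕₚ.m≤n+m _ M.r))))
         (subst₂ _<_ (sym (M.mirror-low hx)) (sym (M.mirror-high hy)) l))

  -- Comparing each point with its own image gives the number of letters of each kind, and comparing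
  -- points with images inside the first half gives their interleaving.
  mirror-determines : ∀ N w w′ len len′ → SameSide N w w′ len len′ → SameSide N w′ w len′ len → w ≡ w′
  mirror-determines N w w′ len len′ h h′ = pos-determines w w′ falses trues
    (transfer N w w′ len len′ h falses trues)
    (λ x y hx hy → transfer N w′ w len′ len h′ (sym falses) (sym trues) x y (subst (x <_) falses hx) (subst (y <_) trues hy))
    where
    falses : num false w ≡ num false w′
    falses = ℕₚ.≤-antisym (false-≤ N w w′ len len′ h) (false-≤ N w′ w len′ len h′)
    trues : num true w ≡ num true w′
    trues = ℕₚ.+-cancelˡ-≡ (num false w) _ _
      (trans (Mirror.r+ N w len) (trans (sym (Mirror.r+ N w′ len′)) (cong (_+ num true w′) (sym falses))))

  -- The splitting of the coordinates into low, middle and high.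

  module Coordinates (p e : ℕ) (e≤1 : e ≤ 1) where

    data Coord : Set where
      lo : Fin p → Coord
      mi : Fin e → Coord
      hi : Fin p → Coord

    data _≺_ : Coord → Coord → Set where
      lo-lo : ∀ {a b} → a F.< b → lo a ≺ lo b
      lo-mi : ∀ {a x} → lo a ≺ mi x
      lo-hi : ∀ {a b} → lo a ≺ hi b
      mi-hi : ∀ {x b} → mi x ≺ hi b
      hi-hi : ∀ {a b} → a F.< b → hi a ≺ hi b

    dual : Coord → Coord
    dual (lo a) = hi (opposite a)
    dual (mi x) = mi x
    dual (hi a) = lo (opposite a)

    middle-unique : (x y : Fin e) → x ≡ y
    middle-unique x y = Fₚ.toℕ-injective (trans (small x) (sym (small y)))
      where
      small : (x : Fin e) → toℕ x ≡ 0
      small x = ℕₚ.n<1⇒n≡0 (ℕₚ.<-≤-trans (Fₚ.toℕ<n x) e≤1)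

  module Embedding (p e : ℕ) (e≤1 : e ≤ 1) where
    open Coordinates p e e≤1

    k : ℕ
    k = p + (e + p)

    coord : Fin k → Coord
    coord i with splitAt p i
    ... | inj₁ a = lo a
    ... | inj₂ u with splitAt e u
    ... | inj₁ x = mi x
    ... | inj₂ b = hi b

    place : Coord → Fin k
    place (lo a) = a ↑ˡ (e + p)
    place (mi x) = p ↑ʳ (x ↑ˡ p)
    place (hi b) = p ↑ʳ (e ↑ʳ b)

    coord-place : ∀ x → coord (place x) ≡ x
    coord-place (lo a) rewrite Fₚ.splitAt-↑ˡ p a (e + p) = refl
    coord-place (mi x) rewrite Fₚ.splitAt-↑ʳ p (e + p) (x ↑ˡ p) | Fₚ.splitAt-↑ˡ e x p = refl
    coord-place (hi b) rewrite Fₚ.splitAt-↑ʳ p (e + p) (e ↑ʳ b) | Fₚ.splitAt-↑ʳ e p b = refl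

    place-coord : ∀ i → place (coord i) ≡ i
    place-coord i with splitAt p i in eq
    ... | inj₁ a = Fₚ.splitAt⁻¹-↑ˡ eq
    ... | inj₂ u with splitAt e u in eq′
    ... | inj₁ x = trans (cong (p ↑ʳ_) (Fₚ.splitAt⁻¹-↑ˡ eq′)) (Fₚ.splitAt⁻¹-↑ʳ eq)
    ... | inj₂ b = trans (cong (p ↑ʳ_) (Fₚ.splitAt⁻¹-↑ʳ eq′)) (Fₚ.splitAt⁻¹-↑ʳ eq)

    coord-injective : ∀ {i j} → coord i ≡ coord j → i ≡ j
    coord-injective {i} {j} h = trans (sym (place-coord i)) (trans (cong place h) (place-coord j))

    toℕ-lo : ∀ a → toℕ (place (lo a)) ≡ toℕ a
    toℕ-lo a = Fₚ.toℕ-↑ˡ a (e + p)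

    toℕ-mi : ∀ x → toℕ (place (mi x)) ≡ p + toℕ x
    toℕ-mi x = trans (Fₚ.toℕ-↑ʳ p (x ↑ˡ p)) (cong (p +_) (Fₚ.toℕ-↑ˡ x p))

    toℕ-hi : ∀ b → toℕ (place (hi b)) ≡ p + (e + toℕ b)
    toℕ-hi b = trans (Fₚ.toℕ-↑ʳ p (e ↑ʳ b)) (cong (p +_) (Fₚ.toℕ-↑ʳ e b))

    place-mono⁻ : ∀ x y → place x F.< place y → x ≺ y
    place-mono⁻ (lo a) (lo b) h = lo-lo (subst₂ _<_ (toℕ-lo a) (toℕ-lo b) h)
    place-mono⁻ (lo a) (mi x) h = lo-mi
    place-mono⁻ (lo a) (hi b) h = lo-hi
    place-mono⁻ (mi x) (lo b) h = contradiction (subst₂ _<_ (toℕ-mi x) (toℕ-lo b) h)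
      (ℕₚ.<-asym (ℕₚ.<-≤-trans (Fₚ.toℕ<n b) (ℕₚ.m≤m+n p (toℕ x))))
    place-mono⁻ (mi x) (mi y) h = contradiction h (ℕₚ.<-irrefl (cong (toℕ ∘ place ∘ mi) (middle-unique x y)))
    place-mono⁻ (mi x) (hi b) h = mi-hi
    place-mono⁻ (hi a) (lo b) h = contradiction (subst₂ _<_ (toℕ-hi a) (toℕ-lo b) h)
      (ℕₚ.<-asym (ℕₚ.<-≤-trans (Fₚ.toℕ<n b) (ℕₚ.m≤m+n p (e + toℕ a))))
    place-mono⁻ (hi a) (mi x) h = contradiction (ℕₚ.+-cancelˡ-< p _ _ (subst₂ _<_ (toℕ-hi a) (toℕ-mi x) h))
      (ℕₚ.<-asym (ℕₚ.<-≤-trans (Fₚ.toℕ<n x) (ℕₚ.m≤m+n e (toℕ a))))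
    place-mono⁻ (hi a) (hi b) h = hi-hi (ℕₚ.+-cancelˡ-< e _ _ (ℕₚ.+-cancelˡ-< p _ _ (subst₂ _<_ (toℕ-hi a) (toℕ-hi b) h)))

    coord-mono : ∀ {i j} → i F.< j → coord i ≺ coord j
    coord-mono {i} {j} h = place-mono⁻ _ _ (subst₂ F._<_ (sym (place-coord i)) (sym (place-coord j)) h)

    dual-place : ∀ x → place (dual x) ≡ opposite (place x)
    dual-place x = Fₚ.toℕ-injective (sym (trans (Fₚ.opposite-prop (place x)) (sym (go x))))
      where
      open ≡-Reasoning
      go : ∀ x → toℕ (place (dual x)) ≡ k ∸ suc (toℕ (place x))
      go (lo a) = begin
        toℕ (place (hi (opposite a)))     ≡⟨ toℕ-hi (opposite a) ⟩
        p + (e + toℕ (opposite a))        ≡⟨ cong (λ z → p + (e + z)) (Fₚ.opposite-prop a) ⟩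
        p + (e + (p ∸ suc (toℕ a)))       ≡⟨ cong (p +_) (sym (ℕₚ.+-∸-assoc e (Fₚ.toℕ<n a))) ⟩
        p + (e + p ∸ suc (toℕ a))         ≡⟨ sym (ℕₚ.+-∸-assoc p (ℕₚ.≤-trans (Fₚ.toℕ<n a) (ℕₚ.m≤n+m p e))) ⟩
        k ∸ suc (toℕ a)                   ≡⟨ cong (λ z → k ∸ suc z) (sym (toℕ-lo a)) ⟩
        k ∸ suc (toℕ (place (lo a)))      ∎
      go (mi x) = begin
        toℕ (place (mi x))                ≡⟨ toℕ-mi x ⟩
        p + toℕ x                         ≡⟨ cong (p +_) x≡0 ⟩
        p + 0                             ≡⟨ ℕₚ.+-identityʳ p ⟩
        p                                 ≡⟨ sym (ℕₚ.m+n∸m≡n (suc p) p) ⟩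
        suc (p + p) ∸ suc p               ≡⟨ cong₂ (λ u v → u ∸ suc v) (sym k≡) (sym (trans (toℕ-mi x) (trans (cong (p +_) x≡0) (ℕₚ.+-identityʳ p)))) ⟩
        k ∸ suc (toℕ (place (mi x)))      ∎
        where
        x≡0 : toℕ x ≡ 0
        x≡0 = ℕₚ.n<1⇒n≡0 (ℕₚ.<-≤-trans (Fₚ.toℕ<n x) e≤1)
        e≡1 : e ≡ 1
        e≡1 = ℕₚ.≤-antisym e≤1 (ℕₚ.≤-trans (s≤s z≤n) (Fₚ.toℕ<n x))
        k≡ : k ≡ suc (p + p)
        k≡ = trans (cong (λ z → p + (z + p)) e≡1) (ℕₚ.+-suc p p)
      go (hi a) = begin
        toℕ (place (lo (opposite a)))     ≡⟨ toℕ-lo (opposite a) ⟩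
        toℕ (opposite a)                  ≡⟨ Fₚ.opposite-prop a ⟩
        p ∸ suc (toℕ a)                   ≡⟨ sym (ℕₚ.[m+n]∸[m+o]≡n∸o e p (suc (toℕ a))) ⟩
        (e + p) ∸ (e + suc (toℕ a))       ≡⟨ sym (ℕₚ.[m+n]∸[m+o]≡n∸o p (e + p) (e + suc (toℕ a))) ⟩
        k ∸ (p + (e + suc (toℕ a)))       ≡⟨ cong (k ∸_) (trans (cong (p +_) (ℕₚ.+-suc e (toℕ a))) (trans (ℕₚ.+-suc p _) (cong suc (sym (toℕ-hi a))))) ⟩
        k ∸ suc (toℕ (place (hi a)))      ∎

    coord-opposite : ∀ i → coord (opposite i) ≡ dual (coord i)
    coord-opposite i = trans (cong (coord ∘ opposite) (sym (place-coord i)))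
      (trans (cong coord (sym (dual-place (coord i)))) (coord-place _))

  -- Rank of a cell within its layer: F and L hold the first and last m cells, Mid s the three middle stages.
  data Cell : Set where
    F   : ℕ → Cell
    Mid : ℕ → ℕ → Cell
    L   : ℕ → Cell

  data _⊏_ : Cell → Cell → Set where
    F⊏F   : ∀ {t t′} → t < t′ → F t ⊏ F t′
    F⊏Mid : ∀ {t s′ t′} → F t ⊏ Mid s′ t′
    F⊏L   : ∀ {t t′} → F t ⊏ L t′
    stage : ∀ {s t s′ t′} → s < s′ → Mid s t ⊏ Mid s′ t′
    same  : ∀ {s t t′} → t < t′ → Mid s t ⊏ Mid s t′
    Mid⊏L : ∀ {s t t′} → Mid s t ⊏ L t′
    L⊏L   : ∀ {t t′} → t < t′ → L t ⊏ L t′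

  ⊏-tri : ∀ c c′ → c ⊏ c′ ⊎ c ≡ c′ ⊎ c′ ⊏ c
  ⊏-tri (F t) (F t′) with ℕₚ.<-cmp t t′
  ... | tri< l _ _ = inj₁ (F⊏F l)
  ... | tri≈ _ l _ = inj₂ (inj₁ (cong F l))
  ... | tri> _ _ l = inj₂ (inj₂ (F⊏F l))
  ⊏-tri (F t) (Mid s′ t′) = inj₁ F⊏Mid
  ⊏-tri (F t) (L t′) = inj₁ F⊏L
  ⊏-tri (Mid s t) (F t′) = inj₂ (inj₂ F⊏Mid)
  ⊏-tri (Mid s t) (Mid s′ t′) with ℕₚ.<-cmp s s′
  ... | tri< l _ _ = inj₁ (stage l)
  ... | tri> _ _ l = inj₂ (inj₂ (stage l))
  ... | tri≈ _ refl _ with ℕₚ.<-cmp t t′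
  ... | tri< l _ _ = inj₁ (same l)
  ... | tri≈ _ l _ = inj₂ (inj₁ (cong (Mid s) l))
  ... | tri> _ _ l = inj₂ (inj₂ (same l))
  ⊏-tri (Mid s t) (L t′) = inj₁ Mid⊏L
  ⊏-tri (L t) (F t′) = inj₂ (inj₂ F⊏L)
  ⊏-tri (L t) (Mid s′ t′) = inj₂ (inj₂ Mid⊏L)
  ⊏-tri (L t) (L t′) with ℕₚ.<-cmp t t′
  ... | tri< l _ _ = inj₁ (L⊏L l)
  ... | tri≈ _ l _ = inj₂ (inj₁ (cong L l))
  ... | tri> _ _ l = inj₂ (inj₂ (L⊏L l))

  ⊏-F⁻ : ∀ {t t′} → F t ⊏ F t′ → t < t′
  ⊏-F⁻ (F⊏F l) = l

  ⊏-Mid⁻ : ∀ {s t t′} → Mid s t ⊏ Mid s t′ → t < t′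
  ⊏-Mid⁻ (stage l) = contradiction l (ℕₚ.<-irrefl refl)
  ⊏-Mid⁻ (same l)  = l

  -- The filling of a single layer.

  module Layer (p e : ℕ) (e≤1 : e ≤ 1) where
    open Coordinates p e e≤1 public

    q m N : ℕ
    q = p + e
    m = p * q
    N = p * p

    -- Stage 1 holds the places 0 to 2N of the symmetric shuffle, centre included; stages 0 and 2
    -- hold the left and right parts of the middle row.
    width : ℕ → ℕ
    width zero          = p
    width (suc zero)    = suc (N + N)
    width (suc (suc _)) = p

    Bounded : Cell → Set
    Bounded (F t)     = t < m
    Bounded (Mid s t) = s ≤ 2 × t < width s
    Bounded (L t)     = t < m

    reverse : Cell → Cell
    reverse (F t)     = L (m ∸ suc t)
    reverse (Mid s t) = Mid (2 ∸ s) (width s ∸ suc t)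
    reverse (L t)     = F (m ∸ suc t)

    reverse-anti : ∀ {c c′} → Bounded c → Bounded c′ → c ⊏ c′ → reverse c′ ⊏ reverse c
    reverse-anti _ b′ (F⊏F l)         = L⊏L (reflect-anti l b′)
    reverse-anti _ b′ F⊏Mid           = Mid⊏L
    reverse-anti _ b′ F⊏L             = F⊏L
    reverse-anti _ (b′ , _) (stage l) = stage (ℕₚ.∸-monoʳ-< l b′)
    reverse-anti _ (_ , b′) (same l)  = same (reflect-anti l b′)
    reverse-anti _ b′ Mid⊏L           = F⊏Mid
    reverse-anti _ b′ (L⊏L l)         = F⊏F (reflect-anti l b′)

    module Filling (A : Fin p → Fin q → ℕ) (stdA : IsStandard A) (S : Fin p → Fin p → ℕ) (stdS : IsStandard S)
                   (w : List Bool) (len : length w ≡ N) where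

      module A = IsStandard stdA
      module S = IsStandard stdS
      open Mirror N w len

      -- The middle row dictates the three stages: its left part must precede the centre and the
      -- `hi`-`lo` block below it, its right part must follow the centre and the `lo`-`hi` block
      -- above it. The `lo`-`hi` block is the half turn of the block filled by `S`, and the last
      -- corner is that of the corner filled by `A`.
      cell : Coord → Coord → Cell
      cell (lo a) (lo c) = F (A a (c ↑ˡ e))
      cell (lo a) (mi x) = F (A a (p ↑ʳ x))
      cell (lo a) (hi c) = Mid 1 ((N + N) ∸ mirror (S (opposite a) (opposite c)))
      cell (mi x) (lo c) = Mid 0 (toℕ c)
      cell (mi x) (mi y) = Mid 1 N
      cell (mi x) (hi c) = Mid 2 (toℕ c)
      cell (hi a) (lo c) = Mid 1 (mirror (S a c))
      cell (hi a) (mi x) = L (m ∸ suc (A (opposite a) (p ↑ʳ x)))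
      cell (hi a) (hi c) = L (m ∸ suc (A (opposite a) (opposite c ↑ˡ e)))

      cell-bounded : ∀ x y → Bounded (cell x y)
      cell-bounded (lo a) (lo c) = A.bound _ _
      cell-bounded (lo a) (mi x) = A.bound _ _
      cell-bounded (lo a) (hi c) = s≤s z≤n , s≤s (ℕₚ.m∸n≤m (N + N) (mirror (S (opposite a) (opposite c))))
      cell-bounded (mi x) (lo c) = z≤n , Fₚ.toℕ<n c
      cell-bounded (mi x) (mi y) = s≤s z≤n , s≤s (ℕₚ.m≤m+n N N)
      cell-bounded (mi x) (hi c) = s≤s (s≤s z≤n) , Fₚ.toℕ<n c
      cell-bounded (hi a) (lo c) = s≤s z≤n , s≤s (mirror-≤ (S.bound a c))
      cell-bounded (hi a) (mi x) = reflect-< (A.bound (opposite a) (p ↑ʳ x))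
      cell-bounded (hi a) (hi c) = reflect-< (A.bound (opposite a) (opposite c ↑ˡ e))

      cell-dual : ∀ x y → cell (dual x) (dual y) ≡ reverse (cell x y)
      cell-dual (lo a) (lo c) rewrite Fₚ.opposite-involutive a | Fₚ.opposite-involutive c = refl
      cell-dual (lo a) (mi x) rewrite Fₚ.opposite-involutive a = refl
      cell-dual (lo a) (hi c) = cong (Mid 1) (sym (ℕₚ.m∸[m∸n]≡n (mirror-≤ (S.bound _ _))))
      cell-dual (mi x) (lo c) = cong (Mid 2) (Fₚ.opposite-prop c)
      cell-dual (mi x) (mi y) = cong (Mid 1) (sym (ℕₚ.m+n∸n≡m N N))
      cell-dual (mi x) (hi c) = cong (Mid 0) (Fₚ.opposite-prop c)
      cell-dual (hi a) (lo c) rewrite Fₚ.opposite-involutive a | Fₚ.opposite-involutive c = refl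
      cell-dual (hi a) (mi x) = cong F (sym (reflect-reflect (A.bound _ _)))
      cell-dual (hi a) (hi c) = cong F (sym (reflect-reflect (A.bound _ _)))

      left<right : ∀ (c : Fin p) (x : Fin e) → (c ↑ˡ e) F.< (p ↑ʳ x)
      left<right c x = subst₂ _<_ (sym (Fₚ.toℕ-↑ˡ c e)) (sym (Fₚ.toℕ-↑ʳ p x)) (ℕₚ.<-≤-trans (Fₚ.toℕ<n c) (ℕₚ.m≤m+n p (toℕ x)))

      left-mono : ∀ {c c′ : Fin p} → c F.< c′ → (c ↑ˡ e) F.< (c′ ↑ˡ e)
      left-mono {c} {c′} = subst₂ _<_ (sym (Fₚ.toℕ-↑ˡ c e)) (sym (Fₚ.toℕ-↑ˡ c′ e))

      mirrored : ∀ {a c a′ c′} → S a c < S a′ c′ → mirror (S a c) < mirror (S a′ c′)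
      mirrored l = mirror-mono l (S.bound _ _)

      mirrored-anti : ∀ {a c a′ c′} → S a c < S a′ c′ → (N + N) ∸ mirror (S a′ c′) < (N + N) ∸ mirror (S a c)
      mirrored-anti l = ℕₚ.∸-monoʳ-< (mirrored l) (mirror-≤ (S.bound _ _))

      row-⊏ : ∀ x {y y′} → y ≺ y′ → cell x y ⊏ cell x y′
      row-⊏ (lo a) (lo-lo l)                   = F⊏F (A.row-mono a _ _ (left-mono l))
      row-⊏ (lo a) (lo-mi {c} {x})             = F⊏F (A.row-mono a _ _ (left<right c x))
      row-⊏ (lo a) lo-hi                       = F⊏Mid
      row-⊏ (lo a) mi-hi                       = F⊏Mid
      row-⊏ (lo a) (hi-hi l)                   = same (mirrored-anti (S.row-mono _ _ _ (opposite-< _ _ l)))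
      row-⊏ (mi x) (lo-lo l)                   = same l
      row-⊏ (mi x) lo-mi                       = stage (s≤s z≤n)
      row-⊏ (mi x) lo-hi                       = stage (s≤s z≤n)
      row-⊏ (mi x) mi-hi                       = stage (s≤s (s≤s z≤n))
      row-⊏ (mi x) (hi-hi l)                   = same l
      row-⊏ (hi a) (lo-lo l)                   = same (mirrored (S.row-mono _ _ _ l))
      row-⊏ (hi a) lo-mi                       = Mid⊏L
      row-⊏ (hi a) lo-hi                       = Mid⊏L
      row-⊏ (hi a) (mi-hi {x} {c})             = L⊏L (reflect-anti (A.row-mono _ _ _ (left<right (opposite c) x)) (A.bound _ _))
      row-⊏ (hi a) (hi-hi l)                   = L⊏L (reflect-anti (A.row-mono _ _ _ (left-mono (opposite-< _ _ l))) (A.bound _ _))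

      col-⊏ : ∀ {x x′} y → x ≺ x′ → cell x y ⊏ cell x′ y
      col-⊏ (lo c) (lo-lo l) = F⊏F (A.col-mono _ _ _ l)
      col-⊏ (lo c) lo-mi     = F⊏Mid
      col-⊏ (lo c) lo-hi     = F⊏Mid
      col-⊏ (lo c) mi-hi     = stage (s≤s z≤n)
      col-⊏ (lo c) (hi-hi l) = same (mirrored (S.col-mono _ _ _ l))
      col-⊏ (mi y) (lo-lo l) = F⊏F (A.col-mono _ _ _ l)
      col-⊏ (mi y) lo-mi     = F⊏Mid
      col-⊏ (mi y) lo-hi     = F⊏L
      col-⊏ (mi y) mi-hi     = Mid⊏L
      col-⊏ (mi y) (hi-hi l) = L⊏L (reflect-anti (A.col-mono _ _ _ (opposite-< _ _ l)) (A.bound _ _))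
      col-⊏ (hi c) (lo-lo l) = same (mirrored-anti (S.col-mono _ _ _ (opposite-< _ _ l)))
      col-⊏ (hi c) lo-mi     = stage (s≤s (s≤s z≤n))
      col-⊏ (hi c) lo-hi     = Mid⊏L
      col-⊏ (hi c) mi-hi     = Mid⊏L
      col-⊏ (hi c) (hi-hi l) = L⊏L (reflect-anti (A.col-mono _ _ _ (opposite-< _ _ l)) (A.bound _ _))

      leftOf : Fin q → Coord
      leftOf c with splitAt p c
      ... | inj₁ a = lo a
      ... | inj₂ x = mi x

      Corner : ℕ → Coord → Coord → Set
      Corner t x y = ∃ λ a → ∃ λ c → x ≡ lo a × y ≡ leftOf c × A a c ≡ t

      -- The fibre of `cell` over each rank. Comparing two descriptions of the same rank spares the
      -- injectivity proof a comparison of all pairs of blocks.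
      At : Cell → Coord → Coord → Set
      At (F t)               x y = Corner t x y
      At (L t)               x y = Corner (m ∸ suc t) (dual x) (dual y)
      At (Mid zero t)        x y = (∃ λ u → x ≡ mi u) × (∃ λ c → y ≡ lo c × toℕ c ≡ t)
      At (Mid (suc zero) t)  x y =
          (∃ λ a → ∃ λ c → x ≡ lo a × y ≡ hi c × (N + N) ∸ mirror (S (opposite a) (opposite c)) ≡ t)
        ⊎ (∃ λ u → ∃ λ v → x ≡ mi u × y ≡ mi v × N ≡ t)
        ⊎ (∃ λ a → ∃ λ c → x ≡ hi a × y ≡ lo c × mirror (S a c) ≡ t)
      At (Mid (suc (suc _)) t) x y = (∃ λ u → x ≡ mi u) × (∃ λ c → y ≡ hi c × toℕ c ≡ t)

      leftOf-↑ˡ : ∀ c → lo c ≡ leftOf (c ↑ˡ e)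
      leftOf-↑ˡ c rewrite Fₚ.splitAt-↑ˡ p c e = refl

      leftOf-↑ʳ : ∀ x → mi x ≡ leftOf (p ↑ʳ x)
      leftOf-↑ʳ x rewrite Fₚ.splitAt-↑ʳ p e x = refl

      at : ∀ x y → At (cell x y) x y
      at (lo a) (lo c) = a , _ , refl , leftOf-↑ˡ c , refl
      at (lo a) (mi x) = a , _ , refl , leftOf-↑ʳ x , refl
      at (lo a) (hi c) = inj₁ (a , c , refl , refl , refl)
      at (mi x) (lo c) = (x , refl) , c , refl , refl
      at (mi x) (mi y) = inj₂ (inj₁ (x , y , refl , refl , refl))
      at (mi x) (hi c) = (x , refl) , c , refl , refl
      at (hi a) (lo c) = inj₂ (inj₂ (a , c , refl , refl , refl))
      at (hi a) (mi x) = _ , _ , refl , leftOf-↑ʳ x , sym (reflect-reflect (A.bound _ _))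
      at (hi a) (hi c) = _ , _ , refl , leftOf-↑ˡ _ , sym (reflect-reflect (A.bound _ _))

      corner-unique : ∀ {t x y x′ y′} → Corner t x y → Corner t x′ y′ → x ≡ x′ × y ≡ y′
      corner-unique (a , c , refl , refl , h) (a′ , c′ , refl , refl , h′) with A.injective a c a′ c′ (trans h (sym h′))
      ... | refl , refl = refl , refl

      dual-injective : ∀ {x y} → dual x ≡ dual y → x ≡ y
      dual-injective {lo a} {lo b} h = cong lo (opposite-injective (hi-injective h))
        where
        hi-injective : ∀ {a b} → hi a ≡ hi b → a ≡ b
        hi-injective refl = refl
      dual-injective {mi x} {mi y} h = cong mi (middle-unique x y)
      dual-injective {hi a} {hi b} h = cong hi (opposite-injective (lo-injective h))
        where
        lo-injective : ∀ {a b} → lo a ≡ lo b → a ≡ b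
        lo-injective refl = refl
      dual-injective {lo a} {mi y} ()
      dual-injective {lo a} {hi b} ()
      dual-injective {mi x} {lo b} ()
      dual-injective {mi x} {hi b} ()
      dual-injective {hi a} {lo b} ()
      dual-injective {hi a} {mi y} ()

      S-unique : ∀ {a c a′ c′} → mirror (S a c) ≡ mirror (S a′ c′) → a ≡ a′ × c ≡ c′
      S-unique h = S.injective _ _ _ _ (mirror-injective (S.bound _ _) (S.bound _ _) h)

      unreflect : ∀ {s t} → s ≤ N + N → t ≤ N + N → (N + N) ∸ s ≡ (N + N) ∸ t → s ≡ t
      unreflect hs ht h = trans (sym (ℕₚ.m∸[m∸n]≡n hs)) (trans (cong ((N + N) ∸_) h) (ℕₚ.m∸[m∸n]≡n ht))

      off-centre : ∀ a c → (N + N) ∸ mirror (S a c) ≢ N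
      off-centre a c h = mirror≢centre (S.bound a c) (unreflect (mirror-≤ (S.bound a c)) (ℕₚ.m≤m+n N N) (trans h (sym (ℕₚ.m+n∸n≡m N N))))

      at-unique : ∀ c {x y x′ y′} → At c x y → At c x′ y′ → x ≡ x′ × y ≡ y′
      at-unique (F t) h h′ = corner-unique h h′
      at-unique (L t) h h′ = let e₁ , e₂ = corner-unique h h′ in dual-injective e₁ , dual-injective e₂
      at-unique (Mid zero t) ((u , refl) , c , refl , h) ((u′ , refl) , c′ , refl , h′) =
        cong mi (middle-unique u u′) , cong lo (Fₚ.toℕ-injective (trans h (sym h′)))
      at-unique (Mid (suc (suc _)) t) ((u , refl) , c , refl , h) ((u′ , refl) , c′ , refl , h′) =
        cong mi (middle-unique u u′) , cong hi (Fₚ.toℕ-injective (trans h (sym h′)))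
      at-unique (Mid (suc zero) t) (inj₁ (a , c , refl , refl , h)) (inj₁ (a′ , c′ , refl , refl , h′))
        with S-unique (unreflect (mirror-≤ (S.bound _ _)) (mirror-≤ (S.bound _ _)) (trans h (sym h′)))
      ... | e₁ , e₂ = cong lo (opposite-injective e₁) , cong hi (opposite-injective e₂)
      at-unique (Mid (suc zero) t) (inj₁ (a , c , _ , _ , h)) (inj₂ (inj₁ (_ , _ , _ , _ , h′))) =
        contradiction (trans h (sym h′)) (off-centre _ _)
      at-unique (Mid (suc zero) t) (inj₁ (a , c , _ , _ , h)) (inj₂ (inj₂ (a′ , c′ , _ , _ , h′))) =
        contradiction (trans h′ (sym h)) (mirror≢reflection (S.bound _ _) (S.bound _ _))
      at-unique (Mid (suc zero) t) (inj₂ (inj₁ (_ , _ , _ , _ , h))) (inj₁ (a , c , _ , _ , h′)) =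
        contradiction (trans h′ (sym h)) (off-centre _ _)
      at-unique (Mid (suc zero) t) (inj₂ (inj₁ (u , v , refl , refl , h))) (inj₂ (inj₁ (u′ , v′ , refl , refl , h′))) =
        cong mi (middle-unique u u′) , cong mi (middle-unique v v′)
      at-unique (Mid (suc zero) t) (inj₂ (inj₁ (_ , _ , _ , _ , h))) (inj₂ (inj₂ (a , c , _ , _ , h′))) =
        contradiction (trans h′ (sym h)) (mirror≢centre (S.bound _ _))
      at-unique (Mid (suc zero) t) (inj₂ (inj₂ (a′ , c′ , _ , _ , h))) (inj₁ (a , c , _ , _ , h′)) =
        contradiction (trans h (sym h′)) (mirror≢reflection (S.bound _ _) (S.bound _ _))
      at-unique (Mid (suc zero) t) (inj₂ (inj₂ (a , c , _ , _ , h))) (inj₂ (inj₁ (_ , _ , _ , _ , h′))) =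
        contradiction (trans h (sym h′)) (mirror≢centre (S.bound _ _))
      at-unique (Mid (suc zero) t) (inj₂ (inj₂ (a , c , refl , refl , h))) (inj₂ (inj₂ (a′ , c′ , refl , refl , h′)))
        with S-unique (trans h (sym h′))
      ... | refl , refl = refl , refl

      cell-injective : ∀ x y x′ y′ → cell x y ≡ cell x′ y′ → x ≡ x′ × y ≡ y′
      cell-injective x y x′ y′ h = at-unique (cell x′ y′) (subst (λ c → At c x y) h (at x y)) (at x′ y′)

      cell-F : ∀ {x y t} → cell x y ≡ F t → (∃ λ a → x ≡ lo a) × (∀ b → y ≢ hi b)
      cell-F {lo a} {lo c} _ = (a , refl) , λ b ()
      cell-F {lo a} {mi c} _ = (a , refl) , λ b ()
      cell-F {lo a} {hi c} ()
      cell-F {mi x} {lo c} ()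
      cell-F {mi x} {mi y} ()
      cell-F {mi x} {hi c} ()
      cell-F {hi a} {lo c} ()
      cell-F {hi a} {mi x} ()
      cell-F {hi a} {hi c} ()

      cell-L : ∀ {x y t} → cell x y ≡ L t → (∃ λ a → x ≡ hi a) × (∀ b → y ≢ lo b)
      cell-L {lo a} {lo c} ()
      cell-L {lo a} {mi x} ()
      cell-L {lo a} {hi c} ()
      cell-L {mi x} {lo c} ()
      cell-L {mi x} {mi y} ()
      cell-L {mi x} {hi c} ()
      cell-L {hi a} {lo c} ()
      cell-L {hi a} {mi c} _ = (a , refl) , λ b ()
      cell-L {hi a} {hi c} _ = (a , refl) , λ b ()

      F-surjective : ∀ t → t < m → ∃ λ x → ∃ λ y → cell x y ≡ F t
      F-surjective t h with A.surjective t h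
      ... | a , c , e with splitAt p c in eq
      ... | inj₁ c′ = lo a , lo c′ , cong F (trans (cong (A a) (Fₚ.splitAt⁻¹-↑ˡ eq)) e)
      ... | inj₂ x  = lo a , mi x , cong F (trans (cong (A a) (Fₚ.splitAt⁻¹-↑ʳ eq)) e)

      L-surjective : ∀ t → t < m → ∃ λ x → ∃ λ y → cell x y ≡ L t
      L-surjective t h with F-surjective (m ∸ suc t) (reflect-< h)
      ... | x , y , e = dual x , dual y , trans (cell-dual x y) (trans (cong reverse e) (cong L (reflect-reflect h)))

-- Permutations built from orders of the cube.

module CubePermutations where

  open Counting
  open import Data.Nat using (_*_)

  index : ∀ {k} → Fin k × Fin k × Fin k → Fin (k * (k * k))
  index (b , i , j) = combine b (combine i j)

  point : ∀ {k} → Fin (k * (k * k)) → Fin k × Fin k × Fin k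
  point {k} x = F.quotient {k} (k * k) x , remQuot {k} k (F.remainder {k} (k * k) x)

  index-point : ∀ {k} (x : Fin (k * (k * k))) → index {k} (point {k} x) ≡ x
  index-point {k} x = trans (cong (combine (F.quotient {k} (k * k) x)) (Fₚ.combine-remQuot {k} k (F.remainder {k} (k * k) x)))
                            (Fₚ.combine-remQuot {k} (k * k) x)

  index-injective : ∀ {k} (e e′ : Fin k × Fin k × Fin k) → index {k} e ≡ index {k} e′ → e ≡ e′
  index-injective (b , i , j) (b′ , i′ , j′) h
    with Fₚ.combine-injective b (combine i j) b′ (combine i′ j′) h
  ... | refl , h′ with Fₚ.combine-injective i j i′ j′ h′
  ... | refl , refl = refl

  module Cube (k n : ℕ) (index : Fin k × Fin k × Fin k → Fin n) (point : Fin n → Fin k × Fin k × Fin k)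
    (index-point : ∀ x → index (point x) ≡ x) (index-injective : ∀ e e′ → index e ≡ index e′ → e ≡ e′) where

    Point : Set
    Point = Fin k × Fin k × Fin k

    col : Point → Fin k
    col (_ , _ , j) = j

    data Lex (b x b′ x′ : Fin k) : Set where
      outer : b F.< b′ → Lex b x b′ x′
      inner : b ≡ b′ → x F.< x′ → Lex b x b′ x′

    lex-tri : ∀ b x b′ x′ → Lex b x b′ x′ ⊎ (b ≡ b′ × x ≡ x′) ⊎ Lex b′ x′ b x
    lex-tri b x b′ x′ with Fₚ.<-cmp b b′ | Fₚ.<-cmp x x′
    ... | tri< l _ _ | _            = inj₁ (outer l)
    ... | tri> _ _ g | _            = inj₂ (inj₂ (outer g))
    ... | tri≈ _ e _ | tri< l _ _   = inj₁ (inner e l)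
    ... | tri≈ _ e _ | tri≈ _ e′ _  = inj₂ (inj₁ (e , e′))
    ... | tri≈ _ e _ | tri> _ _ g   = inj₂ (inj₂ (inner (sym e) g))

    lex-opposite : ∀ {b x b′ x′} → Lex b x b′ x′ → Lex (opposite b′) (opposite x′) (opposite b) (opposite x)
    lex-opposite {b} {b′ = b′} (outer l) = outer (opposite-< b b′ l)
    lex-opposite {x = x} {x′ = x′} (inner refl l) = inner refl (opposite-< x x′ l)

    turn : Point → Point
    turn (b , i , j) = opposite b , j , opposite i

    turn-injective : ∀ {e e′} → turn e ≡ turn e′ → e ≡ e′
    turn-injective {b , i , j} {b′ , i′ , j′} h
      with opposite-injective (cong proj₁ h) | cong (proj₁ ∘ proj₂) h | opposite-injective (cong (proj₂ ∘ proj₂) h)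
    ... | refl | refl | refl = refl

    -- An order of the points, given by distinct numbers of which only the order matters; this
    -- leaves room for gaps between layers. Duality is asked inside a layer only, since the square
    -- of `turn` preserves layers.
    record Key : Set where
      field
        key : Point → ℕ
        key-injective : ∀ {e e′} → key e ≡ key e′ → e ≡ e′
        along-row : ∀ {b j b′ j′} i → Lex b j b′ j′ → key (b , i , j) < key (b′ , i , j′)
        along-col : ∀ {b i b′ i′} j → Lex b i b′ i′ → key (b , i , j) < key (b′ , i′ , j)
        self-dual : ∀ b i j i′ j′ → key (b , i , j) < key (b , i′ , j′) →
          key (b , opposite i′ , opposite j′) < key (b , opposite i , opposite j)

    module Perm (K : Key) where
      open Key K

      below : Fin n → Fin n → Bool
      below x y = key (point y) <ᵇ key (point x)

      rank<n : ∀ x → count (below x) < n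
      rank<n x = subst (count (below x) <_) (count-true n)
        (count-strict (below x) (λ _ → true) _ x (λ t → ℕₚ.<-irrefl refl (ℕₚ.<ᵇ⇒< (key (point x)) (key (point x)) t)) tt)

      rank : Fin n → Fin n
      rank x = fromℕ< (rank<n x)

      rank-mono : ∀ x y → key (point x) < key (point y) → rank x F.< rank y
      rank-mono x y l = subst₂ _<_ (sym (Fₚ.toℕ-fromℕ< (rank<n x))) (sym (Fₚ.toℕ-fromℕ< (rank<n y)))
        (count-strict (below x) (below y)
          (λ z t → ℕₚ.<⇒<ᵇ {key (point z)} {key (point y)} (ℕₚ.<-trans (ℕₚ.<ᵇ⇒< (key (point z)) (key (point x)) t) l))
          x (λ t → ℕₚ.<-irrefl refl (ℕₚ.<ᵇ⇒< (key (point x)) (key (point x)) t)) (ℕₚ.<⇒<ᵇ l))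

      point-index : ∀ e → point (index e) ≡ e
      point-index e = index-injective _ _ (index-point (index e))

      pos : Point → Fin n
      pos e = rank (index e)

      pos-mono : ∀ {e e′} → key e < key e′ → pos e F.< pos e′
      pos-mono {e} {e′} l = rank-mono _ _ (subst₂ (λ u v → key u < key v) (sym (point-index e)) (sym (point-index e′)) l)

      pos-mono⁻ : ∀ {e e′} → pos e F.< pos e′ → key e < key e′
      pos-mono⁻ {e} {e′} l with ℕₚ.<-cmp (key e) (key e′)
      ... | tri< h _ _ = h
      ... | tri≈ _ h _ = contradiction l (ℕₚ.<-irrefl (cong (toℕ ∘ pos) (key-injective h)))
      ... | tri> _ _ h = contradiction l (ℕₚ.<-asym (pos-mono h))

      pos-injective : ∀ {e e′} → pos e ≡ pos e′ → e ≡ e′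
      pos-injective {e} {e′} h with ℕₚ.<-cmp (key e) (key e′)
      ... | tri< l _ _ = contradiction (pos-mono l) (ℕₚ.<-irrefl (cong toℕ h))
      ... | tri≈ _ l _ = key-injective l
      ... | tri> _ _ l = contradiction (pos-mono l) (ℕₚ.<-irrefl (cong toℕ (sym h)))

      rank-injective : Injective rank
      rank-injective {x} {y} h with ℕₚ.<-cmp (key (point x)) (key (point y))
      ... | tri< l _ _ = contradiction (rank-mono x y l) (ℕₚ.<-irrefl (cong toℕ h))
      ... | tri≈ _ l _ = trans (sym (index-point x)) (trans (cong index (key-injective l)) (index-point y))
      ... | tri> _ _ l = contradiction (rank-mono y x l) (ℕₚ.<-irrefl (cong toℕ (sym h)))

      preimage : ∀ x → ∃ λ y → rank y ≡ x
      preimage = injective⇒surjective rank rank-injective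

      who : Fin n → Point
      who x = point (proj₁ (preimage x))

      pos-who : ∀ x → pos (who x) ≡ x
      pos-who x = trans (cong rank (index-point _)) (proj₂ (preimage x))

      who-pos : ∀ e → who (pos e) ≡ e
      who-pos e = pos-injective (pos-who (pos e))

      who-mono : ∀ {x y} → x F.< y → key (who x) < key (who y)
      who-mono {x} {y} l = pos-mono⁻ (subst₂ F._<_ (sym (pos-who x)) (sym (pos-who y)) l)

      perm : Word n
      perm = tabulate (λ x → pos (turn (who x)))

      perm-who : ∀ x → lookup perm x ≡ pos (turn (who x))
      perm-who = Vecₚ.lookup∘tabulate _

      perm-pos : ∀ e → lookup perm (pos e) ≡ pos (turn e)
      perm-pos e = trans (perm-who (pos e)) (cong (pos ∘ turn) (who-pos e))

      perm-isPerm : IsPerm perm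
      perm-isPerm i j h = trans (sym (pos-who i)) (trans (cong pos (turn-injective (pos-injective
        (trans (sym (perm-who i)) (trans h (perm-who j)))))) (pos-who j))

      -- By pigeonhole two of the `k + 1` entries of an occurrence have the same colour, and on one
      -- colour `u` is decreasing.
      colour-avoids : ∀ (u : Word n) (f : Point → Point) (colour : Point → Fin k) →
        (∀ x → lookup u x ≡ pos (f (who x))) →
        (∀ e e′ → colour e ≡ colour e′ → key e < key e′ → key (f e′) < key (f e)) →
        Avoids u (identityPattern (suc k))
      colour-avoids u f colour eq dec (is , inc , iff)
        with Fₚ.pigeonhole ℕₚ.≤-refl (λ j → colour (who (lookup is j)))
      ... | j , l , j<l , same = ℕₚ.<-asym
              (proj₂ (iff j l) (subst₂ F._<_ (sym (Vecₚ.lookup-allFin j)) (sym (Vecₚ.lookup-allFin l)) j<l))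
              (subst₂ F._<_ (sym (eq _)) (sym (eq _)) (pos-mono (dec _ _ same (who-mono (inc j l j<l)))))

      -- A column is sorted by layer and then by row. `turn` carries it onto a row and reverses both
      -- coordinates, so the lexicographic order of that row runs the other way.
      turn-decreasing : ∀ e e′ → col e ≡ col e′ → key e < key e′ → key (turn e′) < key (turn e)
      turn-decreasing (b , i , j) (b′ , i′ , _) refl l with lex-tri b i b′ i′
      ... | inj₁ h                    = along-row j (lex-opposite h)
      ... | inj₂ (inj₁ (refl , refl)) = contradiction l (ℕₚ.<-irrefl refl)
      ... | inj₂ (inj₂ h)             = contradiction l (ℕₚ.<-asym (along-col j h))

      -- `turn` applied twice restores the layer and gives it a half turn, so `self-dual` is exactly
      -- the claim.
      turn²-decreasing : ∀ e e′ → proj₁ e ≡ proj₁ e′ → key e < key e′ → key (turn (turn e′)) < key (turn (turn e))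
      turn²-decreasing (b , i , j) (_ , i′ , j′) refl l rewrite Fₚ.opposite-involutive b = self-dual b i j i′ j′ l

      perm-strongly-avoids : StronglyAvoids perm (identityPattern (suc k))
      perm-strongly-avoids =
        colour-avoids perm turn col perm-who turn-decreasing ,
        colour-avoids (square perm) (turn ∘ turn) proj₁
          (λ x → trans (Vecₚ.lookup∘tabulate _ x) (trans (cong (lookup perm) (perm-who x)) (perm-pos (turn (who x)))))
          turn²-decreasing

      Ascent : Fin n → Fin n → Set
      Ascent x y = x F.< y × lookup perm x F.< lookup perm y

      -- Inside a layer, `turn` carries a row onto a column without reversing it.
      row-ascent : ∀ b i {j j′} → j F.< j′ → Ascent (pos (b , i , j)) (pos (b , i , j′))
      row-ascent b i {j} {j′} l = pos-mono (along-row i (inner refl l)) ,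
        subst₂ F._<_ (sym (perm-pos (b , i , j))) (sym (perm-pos (b , i , j′)))
          (pos-mono (along-col (opposite i) (inner refl l)))

      no-ascent-in-column : ∀ {x y} → col (who x) ≡ col (who y) → ¬ Ascent x y
      no-ascent-in-column {x} {y} same (l , l′) = ℕₚ.<-asym (pos-mono (turn-decreasing _ _ same (who-mono l)))
        (subst₂ F._<_ (perm-who x) (perm-who y) l′)

      -- Otherwise moving y along its row to the column of x would give an ascent inside a column.
      ascent-col : ∀ {x y} → Ascent x y → col (who x) F.< col (who y)
      ascent-col {x} {y} (l , l′) with Fₚ.<-cmp (col (who x)) (col (who y))
      ... | tri< h _ _ = h
      ... | tri≈ _ h _ = contradiction (l , l′) (no-ascent-in-column h)
      ... | tri> _ _ h = contradiction
              (ℕₚ.<-trans l (proj₁ step) , ℕₚ.<-trans l′ (proj₂ step))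
              (no-ascent-in-column (cong col (sym (who-pos y′))))
        where
        y′ : Point
        y′ = proj₁ (who y) , proj₁ (proj₂ (who y)) , col (who x)
        step : Ascent y (pos y′)
        step = subst (λ z → Ascent z (pos y′)) (pos-who y) (row-ascent _ _ h)

    module _ (K K′ : Key) where
      private
        module P  = Perm K
        module P′ = Perm K′

      -- The column of `x` is the number of steps of a longest ascent ending there, and so can be
      -- read from the word: stepping back along the row is an ascent for `K`, and every ascent
      -- raises the column for `K′`.
      col-≤ : P.perm ≡ P′.perm → ∀ c x → toℕ (col (P.who x)) ≡ c → c ≤ toℕ (col (P′.who x))
      col-≤ eq zero    x e = z≤n
      col-≤ eq (suc c) x e = ℕₚ.≤-<-trans (col-≤ eq c y (trans (cong (toℕ ∘ col) (P.who-pos y₀)) (Fₚ.toℕ-fromℕ< c<k)))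
        (P′.ascent-col (subst (λ u → y F.< x × lookup u y F.< lookup u x) eq asc))
        where
        c<k : c < k
        c<k = ℕₚ.<-trans (subst (c <_) (sym e) ℕₚ.≤-refl) (Fₚ.toℕ<n (col (P.who x)))
        y₀ : Point
        y₀ = proj₁ (P.who x) , proj₁ (proj₂ (P.who x)) , fromℕ< c<k
        y = P.pos y₀
        asc : P.Ascent y x
        asc = subst (P.Ascent y) (P.pos-who x)
          (P.row-ascent _ _ (subst₂ _<_ (sym (Fₚ.toℕ-fromℕ< c<k)) (sym e) ℕₚ.≤-refl))

    module _ (K K′ : Key) (eq : Perm.perm K ≡ Perm.perm K′) where
      private
        module K  = Key K
        module K′ = Key K′
        module P  = Perm K
        module P′ = Perm K′

      same-col : ∀ x → col (P.who x) ≡ col (P′.who x)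
      same-col x = Fₚ.toℕ-injective (ℕₚ.≤-antisym (col-≤ K K′ eq _ x refl) (col-≤ K′ K (sym eq) _ x refl))

      -- `turn` makes the column of a point the row of its image, so rows are inherited from
      -- columns.
      same-row : ∀ x → proj₁ (proj₂ (P.who x)) ≡ proj₁ (proj₂ (P′.who x))
      same-row x with injective⇒surjective (lookup P.perm) (P.perm-isPerm _ _) x
      ... | y , refl = begin
        row (P.who (lookup P.perm y))              ≡⟨ cong row (trans (cong P.who (P.perm-who y)) (P.who-pos _)) ⟩
        col (P.who y)                              ≡⟨ same-col y ⟩
        col (P′.who y)                             ≡⟨ cong row (trans (cong P′.who (P′.perm-who y)) (P′.who-pos _)) ⟨
        row (P′.who (lookup P′.perm y))            ≡⟨ cong (λ u → row (P′.who (lookup u y))) eq ⟨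
        row (P′.who (lookup P.perm y))             ∎
        where
        open ≡-Reasoning
        row : Point → Fin k
        row = proj₁ ∘ proj₂

      -- With row and column known only the layer is open. For fixed `i` and `j` both keys grow with
      -- the layer, so the induced map `θ` of layers is strictly increasing.
      same-who : ∀ b i j → P′.who (P.pos (b , i , j)) ≡ (b , i , j)
      same-who b i j = trans (split b) (cong (λ z → z , i , j) (strictMono⇒id θ θ-mono b))
        where
        θ : Fin k → Fin k
        θ b = proj₁ (P′.who (P.pos (b , i , j)))
        split : ∀ b → P′.who (P.pos (b , i , j)) ≡ (θ b , i , j)
        split b = cong₂ (λ u v → θ b , u , v)
          (trans (sym (same-row (P.pos (b , i , j)))) (cong (proj₁ ∘ proj₂) (P.who-pos (b , i , j))))
          (trans (sym (same-col (P.pos (b , i , j)))) (cong col (P.who-pos (b , i , j))))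
        θ-mono : StrictMono θ
        θ-mono a b a<b with Fₚ.<-cmp (θ a) (θ b)
        ... | tri< h _ _ = h
        ... | tri≈ _ h _ = contradiction (key< a b a<b) (ℕₚ.<-irrefl (cong (λ z → K′.key (z , i , j)) h))
          where
          key< : ∀ a b → a F.< b → K′.key (θ a , i , j) < K′.key (θ b , i , j)
          key< a b l = subst₂ (λ u v → K′.key u < K′.key v) (split a) (split b) (P′.who-mono (P.pos-mono (K.along-col j (outer l))))
        ... | tri> _ _ h = contradiction (K′.along-col j (outer h)) (ℕₚ.<-asym
                (subst₂ (λ u v → K′.key u < K′.key v) (split a) (split b) (P′.who-mono (P.pos-mono (K.along-col j (outer a<b))))))

      same-order : ∀ {e e′} → K.key e < K.key e′ → K′.key e < K′.key e′
      same-order {e} {e′} l = subst₂ (λ u v → K′.key u < K′.key v) (same-who _ _ _) (same-who _ _ _) (P′.who-mono (P.pos-mono l))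

-- Gluing the layers into an order of the cube.

module Assembly where

  open Counting
  open Tableaux
  open LayerOrder
  open CubePermutations
  open import Data.Nat using (_+_; _*_)

  sorted : ∀ a b → Shuffle a b
  sorted zero    zero    = [] , refl , refl
  sorted zero    (suc b) = let w , e , e′ = sorted zero b in true ∷ w , e , cong suc e′
  sorted (suc a) b       = let w , e , e′ = sorted a b in false ∷ w , cong suc e , e′

  odd : ℕ → Bool
  odd zero    = false
  odd (suc n) = not (odd n)

  module Family (p e : ℕ) (e≤1 : e ≤ 1) (k : ℕ)
    (coord : Fin k → Coordinates.Coord p e e≤1) (place : Coordinates.Coord p e e≤1 → Fin k) (coord-place : ∀ x → coord (place x) ≡ x)
    (coord-injective : ∀ {i j} → coord i ≡ coord j → i ≡ j) (coord-mono : ∀ {i j} → i F.< j → Coordinates._≺_ p e e≤1 (coord i) (coord j))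
    (coord-opposite : ∀ i → coord (opposite i) ≡ Coordinates.dual p e e≤1 (coord i))
    (#A #S #w #W : ℕ)
    (tabA : Fin #A → Fin p → Fin (p + e) → ℕ) (stdA : ∀ z → IsStandard (tabA z))
    (injA : ∀ z z′ → (∀ i j → tabA z i j ≡ tabA z′ i j) → z ≡ z′)
    (tabS : Fin #S → Fin p → Fin p → ℕ) (stdS : ∀ z → IsStandard (tabS z))
    (injS : ∀ z z′ → (∀ i j → tabS z i j ≡ tabS z′ i j) → z ≡ z′)
    (bitsOf : Fin #w → List Bool) (lenOf : ∀ z → length (bitsOf z) ≡ p * p) (injw : ∀ z z′ → bitsOf z ≡ bitsOf z′ → z ≡ z′)
    (shuffleOf : Fin #W → Shuffle (p * (p + e)) (p * (p + e))) (injW : ∀ z z′ → proj₁ (shuffleOf z) ≡ proj₁ (shuffleOf z′) → z ≡ z′)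
    where

    open Layer p e e≤1
    open Cube k (k * (k * k)) index point (index-point {k}) (index-injective {k})

    record Data : Set where
      constructor fill
      field
        corner : Fin #A
        side   : Fin #S
        mixing : Fin #w

    module Fill (d : Data) = Filling (tabA (Data.corner d)) (stdA (Data.corner d))
      (tabS (Data.side d)) (stdS (Data.side d)) (bitsOf (Data.mixing d)) (lenOf (Data.mixing d))

    -- Every second layer is transposed, so that the last cells of a layer and
    -- the first cells of the next one share no row and no column.
    oriented : Bool → Data → Coord → Coord → Cell
    oriented false d x y = Fill.cell d x y
    oriented true  d x y = Fill.cell d y x

    oriented-row : ∀ o d x {y y′} → y ≺ y′ → oriented o d x y ⊏ oriented o d x y′
    oriented-row false d x l = Fill.row-⊏ d x l
    oriented-row true  d x l = Fill.col-⊏ d x l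

    oriented-col : ∀ o d {x x′} y → x ≺ x′ → oriented o d x y ⊏ oriented o d x′ y
    oriented-col false d y l = Fill.col-⊏ d y l
    oriented-col true  d y l = Fill.row-⊏ d y l

    oriented-bounded : ∀ o d x y → Bounded (oriented o d x y)
    oriented-bounded false d x y = Fill.cell-bounded d x y
    oriented-bounded true  d x y = Fill.cell-bounded d y x

    oriented-dual : ∀ o d x y → oriented o d (dual x) (dual y) ≡ reverse (oriented o d x y)
    oriented-dual false d x y = Fill.cell-dual d x y
    oriented-dual true  d x y = Fill.cell-dual d y x

    oriented-injective : ∀ o d x y x′ y′ → oriented o d x y ≡ oriented o d x′ y′ → x ≡ x′ × y ≡ y′
    oriented-injective false d x y x′ y′ h = Fill.cell-injective d x y x′ y′ h
    oriented-injective true  d x y x′ y′ h = let e₁ , e₂ = Fill.cell-injective d y x y′ x′ h in e₂ , e₁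

    -- Equal orientations would clash in odd cubes: last cells occupy the columns `mi` and `hi`,
    -- first cells the columns `lo` and `mi`, and the middle column is common. With opposite
    -- orientations, up to exchanging rows and columns, last cells have row `hi` and a column other
    -- than `lo`, first cells have column `lo` and a row other than `hi`.
    oriented-clash : ∀ o d d′ x y x′ y′ {t t′} → oriented o d x y ≡ L t → oriented (not o) d′ x′ y′ ≡ F t′ → x ≢ x′ × y ≢ y′
    oriented-clash false d d′ x y x′ y′ h h′ with Fill.cell-L d {x} {y} h | Fill.cell-F d′ {y′} {x′} h′
    ... | (a , refl) , ¬lo | (b , refl) , ¬hi = (λ e → ¬hi a (sym e)) , (λ e → ¬lo b e)
    oriented-clash true d d′ x y x′ y′ h h′ with Fill.cell-L d {y} {x} h | Fill.cell-F d′ {x′} {y′} h′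
    ... | (a , refl) , ¬lo | (b , refl) , ¬hi = (λ e → ¬lo b e) , (λ e → ¬hi a (sym e))

    F-at : ∀ o d t → t < m → ∃ λ x → ∃ λ y → oriented o d x y ≡ F t
    F-at false d t h = Fill.F-surjective d t h
    F-at true  d t h = let x , y , e = Fill.F-surjective d t h in y , x , e

    L-at : ∀ o d t → t < m → ∃ λ x → ∃ λ y → oriented o d x y ≡ L t
    L-at false d t h = Fill.L-surjective d t h
    L-at true  d t h = let x , y , e = Fill.L-surjective d t h in y , x , e

    oriented-order⇒cell-order : ∀ o d d′ →
      (∀ x y x′ y′ → oriented o d x y ⊏ oriented o d x′ y′ → oriented o d′ x y ⊏ oriented o d′ x′ y′) →
      ∀ x y x′ y′ → Fill.cell d x y ⊏ Fill.cell d x′ y′ → Fill.cell d′ x y ⊏ Fill.cell d′ x′ y′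
    oriented-order⇒cell-order false d d′ h = h
    oriented-order⇒cell-order true  d d′ h x y x′ y′ = h y x y′ x′

    SameOrder : Data → Data → Set
    SameOrder d d′ = ∀ x y x′ y′ → Fill.cell d x y ⊏ Fill.cell d x′ y′ → Fill.cell d′ x y ⊏ Fill.cell d′ x′ y′

    cell-left : ∀ d a c → Fill.cell d (lo a) (Fill.leftOf d c) ≡ F (tabA (Data.corner d) a c)
    cell-left d a c with splitAt p c in eq
    ... | inj₁ c′ = cong (λ z → F (tabA (Data.corner d) a z)) (Fₚ.splitAt⁻¹-↑ˡ eq)
    ... | inj₂ x  = cong (λ z → F (tabA (Data.corner d) a z)) (Fₚ.splitAt⁻¹-↑ʳ eq)

    corner-determined : ∀ d d′ → SameOrder d d′ → Data.corner d ≡ Data.corner d′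
    corner-determined d d′ h = injA _ _
      (order-determines (stdA (Data.corner d)) (stdA (Data.corner d′)) λ a c a′ c′ l →
        ⊏-F⁻ (subst₂ _⊏_ (cell-left d′ a c) (cell-left d′ a′ c′)
          (h (lo a) (Fill.leftOf d c) (lo a′) (Fill.leftOf d c′)
            (subst₂ _⊏_ (sym (cell-left d a c)) (sym (cell-left d a′ c′)) (F⊏F l)))))

    -- `mirror` is increasing, so the order inside the `hi`-`lo` block is that of `S` whatever the
    -- mixing is; thus `S` is recovered before the mixing.
    side-determined : ∀ d d′ → SameOrder d d′ → Data.side d ≡ Data.side d′
    side-determined d d′ h = injS _ _
      (order-determines (stdS (Data.side d)) (stdS (Data.side d′)) λ a c a′ c′ l →
        unmirror a c a′ c′ (⊏-Mid⁻ (h (hi a) (lo c) (hi a′) (lo c′) (same (Fill.mirrored d l)))))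
      where
      open Mirror N (bitsOf (Data.mixing d′)) (lenOf (Data.mixing d′))
      S′ = tabS (Data.side d′)
      unmirror : ∀ a c a′ c′ → mirror (S′ a c) < mirror (S′ a′ c′) → S′ a c < S′ a′ c′
      unmirror a c a′ c′ l with ℕₚ.<-cmp (S′ a c) (S′ a′ c′)
      ... | tri< g _ _ = g
      ... | tri≈ _ g _ = contradiction l (ℕₚ.<-irrefl (cong mirror g))
      ... | tri> _ _ g = contradiction l (ℕₚ.<-asym (Fill.mirrored d′ g))

    -- `S` takes every value below `N`, so each comparison of a point with an image is one of a cell
    -- in the `hi`-`lo` block with the half turn of another such cell.
    same-side : ∀ d d′ → SameOrder d d′ → Data.side d ≡ Data.side d′ →
      SameSide N (bitsOf (Data.mixing d)) (bitsOf (Data.mixing d′)) (lenOf _) (lenOf _)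
    same-side d@(fill _ z w) d′@(fill _ _ w′) h refl x y hx hy l
      with IsStandard.surjective (stdS z) x hx | IsStandard.surjective (stdS z) y hy
    ... | a , c , refl | a′ , c′ , refl =
      subst (λ t → mirror′ (S a c) < (N + N) ∸ mirror′ t) back
        (⊏-Mid⁻ (h (hi a) (lo c) (lo (opposite a′)) (hi (opposite c′))
          (same (subst (λ t → mirror (S a c) < (N + N) ∸ mirror t) (sym back) l))))
      where
      S = tabS z
      open Mirror N (bitsOf w) (lenOf w) using (mirror)
      open Mirror N (bitsOf w′) (lenOf w′) using () renaming (mirror to mirror′)
      back : S (opposite (opposite a′)) (opposite (opposite c′)) ≡ S a′ c′
      back = cong₂ S (Fₚ.opposite-involutive a′) (Fₚ.opposite-involutive c′)

    data-determined : ∀ d d′ → SameOrder d d′ → SameOrder d′ d → d ≡ d′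
    data-determined d@(fill a b w) d′@(fill a′ b′ w′) h h′
      with corner-determined d d′ h | side-determined d d′ h
    ... | refl | refl = cong (fill a b) (injw w w′ (mirror-determines N _ _ _ _ (same-side d d′ h refl) (same-side d′ d h′ refl)))

    -- `Z` bounds the width of every stage, and a block of length `Λ` holds one window of `m + m`
    -- places followed by three stages.
    Z Λ : ℕ
    Z = suc (N + N) + p
    Λ = (m + m) + 3 * Z

    width≤Z : ∀ s → width s ≤ Z
    width≤Z zero          = ℕₚ.m≤n+m p (suc (N + N))
    width≤Z (suc zero)    = ℕₚ.m≤m+n (suc (N + N)) p
    width≤Z (suc (suc _)) = ℕₚ.m≤n+m p (suc (N + N))

    module Global (W : ℕ → Shuffle m m) where

      window : ℕ → List Bool
      window b = proj₁ (W b)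

      -- Window b interleaves the last cells of layer b - 1 (letters false) with the first cells of layer b.
      global : ℕ → Cell → ℕ
      global b (F t)     = b * Λ + pos true (window b) t
      global b (Mid s t) = b * Λ + ((m + m) + (s * Z + t))
      global b (L t)     = suc b * Λ + pos false (window (suc b)) t

      window-length : ∀ b → length (window b) ≡ m + m
      window-length b = trans (sym (num-length (window b))) (cong₂ _+_ (proj₁ (proj₂ (W b))) (proj₂ (proj₂ (W b))))

      true-bound : ∀ b {t} → t < m → pos true (window b) t < m + m
      true-bound b {t} h = subst (pos true (window b) t <_) (window-length b)
        (pos-bound true (window b) (subst (t <_) (sym (proj₂ (proj₂ (W b)))) h))

      false-bound : ∀ b {t} → t < m → pos false (window b) t < m + m
      false-bound b {t} h = subst (pos false (window b) t <_) (window-length b)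
        (pos-bound false (window b) (subst (t <_) (sym (proj₁ (proj₂ (W b)))) h))

      stage-bound : ∀ {s t} → t < width s → s * Z + t < suc s * Z
      stage-bound {s} {t} h = subst (s * Z + t <_) (ℕₚ.+-comm (s * Z) Z) (ℕₚ.+-monoʳ-< (s * Z) (ℕₚ.<-≤-trans h (width≤Z s)))

      mid-bound : ∀ {s t} → s ≤ 2 → t < width s → (m + m) + (s * Z + t) < Λ
      mid-bound {s} hs ht = ℕₚ.+-monoʳ-< (m + m) (ℕₚ.<-≤-trans (stage-bound {s} ht) (ℕₚ.*-monoˡ-≤ Z (s≤s hs)))

      2m≤Λ : m + m ≤ Λ
      2m≤Λ = ℕₚ.m≤m+n (m + m) (3 * Z)

      below-next : ∀ b {x} → x < Λ → b * Λ + x < suc b * Λ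
      below-next b {x} h = subst (b * Λ + x <_) (ℕₚ.+-comm (b * Λ) Λ) (ℕₚ.+-monoʳ-< (b * Λ) h)

      global-mono : ∀ b {c c′} → Bounded c → Bounded c′ → c ⊏ c′ → global b c < global b c′
      global-mono b _ _ (F⊏F l) = ℕₚ.+-monoʳ-< (b * Λ) (pos-mono true (window b) l)
      global-mono b h _ F⊏Mid = ℕₚ.+-monoʳ-< (b * Λ) (ℕₚ.<-≤-trans (true-bound b h) (ℕₚ.m≤m+n (m + m) _))
      global-mono b h _ F⊏L = ℕₚ.<-≤-trans (below-next b (ℕₚ.<-≤-trans (true-bound b h) 2m≤Λ)) (ℕₚ.m≤m+n _ _)
      global-mono b (_ , h) _ (stage {s} {t} {s′} {t′} l) = ℕₚ.+-monoʳ-< (b * Λ) (ℕₚ.+-monoʳ-< (m + m)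
        (ℕₚ.<-≤-trans (stage-bound {s} h) (ℕₚ.≤-trans (ℕₚ.*-monoˡ-≤ Z l) (ℕₚ.m≤m+n (s′ * Z) t′))))
      global-mono b _ _ (same {s} l) = ℕₚ.+-monoʳ-< (b * Λ) (ℕₚ.+-monoʳ-< (m + m) (ℕₚ.+-monoʳ-< (s * Z) l))
      global-mono b (hs , ht) _ Mid⊏L = ℕₚ.<-≤-trans (below-next b (mid-bound hs ht)) (ℕₚ.m≤m+n _ _)
      global-mono b _ _ (L⊏L l) = ℕₚ.+-monoʳ-< (suc b * Λ) (pos-mono false (window (suc b)) l)

      global-mono⁻ : ∀ b {c c′} → Bounded c → Bounded c′ → global b c < global b c′ → c ⊏ c′
      global-mono⁻ b {c} {c′} h h′ l with ⊏-tri c c′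
      ... | inj₁ g           = g
      ... | inj₂ (inj₁ refl) = contradiction l (ℕₚ.<-irrefl refl)
      ... | inj₂ (inj₂ g)    = contradiction l (ℕₚ.<-asym (global-mono b h′ h g))

      above-start : ∀ b c → b * Λ ≤ global b c
      above-start b (F t)     = ℕₚ.m≤m+n _ _
      above-start b (Mid s t) = ℕₚ.m≤m+n _ _
      above-start b (L t)     = ℕₚ.≤-trans (ℕₚ.m≤n+m (b * Λ) Λ) (ℕₚ.m≤m+n _ _)

      -- Only the last cells of layer `b` leave its block, for the window that opens the block of
      -- `suc b`. They still precede everything of later layers except the first cells sharing that
      -- window, which is the excluded case.
      cross : ∀ {b b′} c c′ → b < b′ → Bounded c → Bounded c′ →
        (∀ {t t′} → c ≡ L t → c′ ≡ F t′ → b′ ≡ suc b → ⊥) → global b c < global b′ c′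
      cross {b} {b′} (F t) c′ l h h′ _ = ℕₚ.<-≤-trans (below-next b (ℕₚ.<-≤-trans (true-bound b h) 2m≤Λ))
        (ℕₚ.≤-trans (ℕₚ.*-monoˡ-≤ Λ l) (above-start b′ c′))
      cross {b} {b′} (Mid s t) c′ l (hs , ht) h′ _ = ℕₚ.<-≤-trans (below-next b (mid-bound hs ht))
        (ℕₚ.≤-trans (ℕₚ.*-monoˡ-≤ Λ l) (above-start b′ c′))
      cross {b} {b′} (L t) (Mid s′ t′) l h h′ _ = ℕₚ.<-≤-trans
        (ℕₚ.+-monoʳ-< (suc b * Λ) (ℕₚ.<-≤-trans (false-bound (suc b) h) (ℕₚ.m≤m+n (m + m) (s′ * Z + t′))))
        (ℕₚ.+-monoˡ-≤ ((m + m) + (s′ * Z + t′)) (ℕₚ.*-monoˡ-≤ Λ l))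
      cross {b} {b′} (L t) (L t′) l h h′ _ = ℕₚ.<-≤-trans
        (below-next (suc b) (ℕₚ.<-≤-trans (false-bound (suc b) h) 2m≤Λ))
        (ℕₚ.≤-trans (ℕₚ.*-monoˡ-≤ Λ (s≤s l)) (ℕₚ.m≤m+n (suc b′ * Λ) _))
      cross {b} {b′} (L t) (F t′) l h h′ clash = ℕₚ.<-≤-trans
        (below-next (suc b) (ℕₚ.<-≤-trans (false-bound (suc b) h) 2m≤Λ))
        (ℕₚ.≤-trans (ℕₚ.*-monoˡ-≤ Λ (ℕₚ.≤∧≢⇒< l λ e → clash refl refl (sym e))) (above-start b′ (F t′)))

      -- Inside a shared window the two kinds of cells are different letters of one word, so
      -- distinctness holds without the exclusion made in `cross`.
      cross-≢ : ∀ {b b′} c c′ → b < b′ → Bounded c → Bounded c′ → global b c ≢ global b′ c′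
      cross-≢ {b} {b′} (L t) (F t′) l h h′ e with b′ ℕₚ.≟ suc b
      ... | yes refl = pos-disjoint (window (suc b)) (subst (t <_) (sym (proj₁ (proj₂ (W (suc b))))) h)
                         (subst (t′ <_) (sym (proj₂ (proj₂ (W (suc b))))) h′) (ℕₚ.+-cancelˡ-≡ (suc b * Λ) _ _ e)
      ... | no ne = ℕₚ.<⇒≢ (cross (L t) (F t′) l h h′ λ _ _ e → ne e) e
      cross-≢ (F t) c′ l h h′ = ℕₚ.<⇒≢ (cross (F t) c′ l h h′ λ ())
      cross-≢ (Mid s t) c′ l h h′ = ℕₚ.<⇒≢ (cross (Mid s t) c′ l h h′ λ ())
      cross-≢ (L t) (Mid s′ t′) l h h′ = ℕₚ.<⇒≢ (cross (L t) (Mid s′ t′) l h h′ λ _ ())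
      cross-≢ (L t) (L t′) l h h′ = ℕₚ.<⇒≢ (cross (L t) (L t′) l h h′ λ _ ())

    module Assemble (layers : Fin k → Data) (W : ℕ → Shuffle m m) where
      open Global W

      cellAt : Fin k → Fin k → Fin k → Cell
      cellAt b i j = oriented (odd (toℕ b)) (layers b) (coord i) (coord j)

      bounded : ∀ b i j → Bounded (cellAt b i j)
      bounded b i j = oriented-bounded (odd (toℕ b)) (layers b) (coord i) (coord j)

      value : Point → ℕ
      value (b , i , j) = global (toℕ b) (cellAt b i j)

      no-clash : ∀ b b′ i j i′ j′ {t t′} → cellAt b i j ≡ L t → cellAt b′ i′ j′ ≡ F t′ → toℕ b′ ≡ suc (toℕ b) → i ≢ i′ × j ≢ j′
      no-clash b b′ i j i′ j′ h h′ e =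
        let ne , ne′ = oriented-clash (odd (toℕ b)) (layers b) (layers b′) (coord i) (coord j) (coord i′) (coord j′) h
                         (trans (cong (λ z → oriented (odd z) (layers b′) (coord i′) (coord j′)) (sym e)) h′)
        in (λ e₁ → ne (cong coord e₁)) , (λ e₂ → ne′ (cong coord e₂))

      value-injective : ∀ {x y} → value x ≡ value y → x ≡ y
      value-injective {b , i , j} {b′ , i′ , j′} h with Fₚ.<-cmp b b′
      ... | tri< l _ _ = contradiction h (cross-≢ (cellAt b i j) (cellAt b′ i′ j′) l (bounded b i j) (bounded b′ i′ j′))
      ... | tri> _ _ l = contradiction (sym h) (cross-≢ (cellAt b′ i′ j′) (cellAt b i j) l (bounded b′ i′ j′) (bounded b i j))
      ... | tri≈ _ refl _ with ⊏-tri (cellAt b i j) (cellAt b i′ j′)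
      ... | inj₁ l = contradiction h (ℕₚ.<⇒≢ (global-mono (toℕ b) (bounded b i j) (bounded b i′ j′) l))
      ... | inj₂ (inj₂ l) = contradiction (sym h) (ℕₚ.<⇒≢ (global-mono (toℕ b) (bounded b i′ j′) (bounded b i j) l))
      ... | inj₂ (inj₁ eq) with oriented-injective (odd (toℕ b)) (layers b) (coord i) (coord j) (coord i′) (coord j′) eq
      ... | e₁ , e₂ = cong₂ (λ u v → b , u , v) (coord-injective e₁) (coord-injective e₂)

      assembled : Key
      assembled = record
        { key = value
        ; key-injective = value-injective
        ; along-row = row
        ; along-col = column
        ; self-dual = dualise
        }
        where
        row : ∀ {b j b′ j′} i → Lex b j b′ j′ → value (b , i , j) < value (b′ , i , j′)
        row {b} {j} {_} {j′} i (inner refl l) = global-mono (toℕ b) (bounded b i j) (bounded b i j′)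
          (oriented-row (odd (toℕ b)) (layers b) (coord i) (coord-mono l))
        row {b} {j} {b′} {j′} i (outer l) = cross (cellAt b i j) (cellAt b′ i j′) l (bounded b i j) (bounded b′ i j′)
          λ h h′ e → proj₁ (no-clash b b′ i j i j′ h h′ e) refl
        column : ∀ {b i b′ i′} j → Lex b i b′ i′ → value (b , i , j) < value (b′ , i′ , j)
        column {b} {i} {_} {i′} j (inner refl l) = global-mono (toℕ b) (bounded b i j) (bounded b i′ j)
          (oriented-col (odd (toℕ b)) (layers b) (coord j) (coord-mono l))
        column {b} {i} {b′} {i′} j (outer l) = cross (cellAt b i j) (cellAt b′ i′ j) l (bounded b i j) (bounded b′ i′ j)
          λ h h′ e → proj₂ (no-clash b b′ i j i′ j h h′ e) refl
        cell-opposite : ∀ b i j → cellAt b (opposite i) (opposite j) ≡ reverse (cellAt b i j)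
        cell-opposite b i j = trans (cong₂ (oriented (odd (toℕ b)) (layers b)) (coord-opposite i) (coord-opposite j))
          (oriented-dual (odd (toℕ b)) (layers b) (coord i) (coord j))
        dualise : ∀ b i j i′ j′ → value (b , i , j) < value (b , i′ , j′) →
          value (b , opposite i′ , opposite j′) < value (b , opposite i , opposite j)
        dualise b i j i′ j′ l = global-mono (toℕ b) (bounded b _ _) (bounded b _ _)
          (subst₂ _⊏_ (sym (cell-opposite b i′ j′)) (sym (cell-opposite b i j))
            (reverse-anti (bounded b i j) (bounded b i′ j′) (global-mono⁻ (toℕ b) (bounded b i j) (bounded b i′ j′) l)))

    module Compare (D D′ : Fin k → Data) (W W′ : ℕ → Shuffle m m) where
      private
        module X  = Assemble D W
        module X′ = Assemble D′ W′
        module G  = Global W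
        module G′ = Global W′

      Implies : Set
      Implies = ∀ {x y} → X.value x < X.value y → X′.value x < X′.value y

      layer-order : Implies → ∀ b → SameOrder (D b) (D′ b)
      layer-order imp b = oriented-order⇒cell-order o (D b) (D′ b) λ x y x′ y′ l →
        subst₂ _⊏_ (at′ x y) (at′ x′ y′)
          (G′.global-mono⁻ (toℕ b) (X′.bounded b _ _) (X′.bounded b _ _)
            (imp {b , place x , place y} {b , place x′ , place y′}
              (G.global-mono (toℕ b) (X.bounded b _ _) (X.bounded b _ _) (subst₂ _⊏_ (sym (at x y)) (sym (at x′ y′)) l))))
        where
        o = odd (toℕ b)
        at : ∀ x y → X.cellAt b (place x) (place y) ≡ oriented o (D b) x y
        at x y = cong₂ (oriented o (D b)) (coord-place x) (coord-place y)
        at′ : ∀ x y → X′.cellAt b (place x) (place y) ≡ oriented o (D′ b) x y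
        at′ x y = cong₂ (oriented o (D′ b)) (coord-place x) (coord-place y)

      -- Every place of a window is held by some cell. Equal layer data guarantee that the same two
      -- points hold the places `u` and `v` in both orders, so layers are recovered before windows.
      window-order : Implies → (∀ b → D b ≡ D′ b) → ∀ t → suc t < k → ∀ u v → u < m → v < m →
        pos false (G.window (suc t)) u < pos true (G.window (suc t)) v →
        pos false (G′.window (suc t)) u < pos true (G′.window (suc t)) v
      window-order imp eq t h u v hu hv l =
        ℕₚ.+-cancelˡ-< (suc t * Λ) _ _ (subst₂ _<_ (left′ W′) (right′ W′) (imp {b , place x , place y} {b′ , place x′ , place y′}
          (subst₂ _<_ (sym (left W)) (sym (right W)) (ℕₚ.+-monoʳ-< (suc t * Λ) l))))
        where
        b b′ : Fin k
        b  = fromℕ< (ℕₚ.<-trans ℕₚ.≤-refl h)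
        b′ = fromℕ< h
        tb : toℕ b ≡ t
        tb = Fₚ.toℕ-fromℕ< _
        tb′ : toℕ b′ ≡ suc t
        tb′ = Fₚ.toℕ-fromℕ< h
        x  = proj₁ (L-at (odd (toℕ b)) (D b) u hu)
        y  = proj₁ (proj₂ (L-at (odd (toℕ b)) (D b) u hu))
        ex : oriented (odd (toℕ b)) (D b) x y ≡ L u
        ex = proj₂ (proj₂ (L-at (odd (toℕ b)) (D b) u hu))
        x′ = proj₁ (F-at (odd (toℕ b′)) (D b′) v hv)
        y′ = proj₁ (proj₂ (F-at (odd (toℕ b′)) (D b′) v hv))
        ex′ : oriented (odd (toℕ b′)) (D b′) x′ y′ ≡ F v
        ex′ = proj₂ (proj₂ (F-at (odd (toℕ b′)) (D b′) v hv))
        cell≡ : oriented (odd (toℕ b)) (D b) (coord (place x)) (coord (place y)) ≡ L u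
        cell≡ = trans (cong₂ (oriented (odd (toℕ b)) (D b)) (coord-place x) (coord-place y)) ex
        cell≡′ : oriented (odd (toℕ b′)) (D b′) (coord (place x′)) (coord (place y′)) ≡ F v
        cell≡′ = trans (cong₂ (oriented (odd (toℕ b′)) (D b′)) (coord-place x′) (coord-place y′)) ex′
        left : ∀ V → Assemble.value D V (b , place x , place y) ≡ suc t * Λ + pos false (proj₁ (V (suc t))) u
        left V = trans (cong (Global.global V (toℕ b)) cell≡) (cong (λ z → suc z * Λ + pos false (proj₁ (V (suc z))) u) tb)
        right : ∀ V → Assemble.value D V (b′ , place x′ , place y′) ≡ suc t * Λ + pos true (proj₁ (V (suc t))) v
        right V = trans (cong (Global.global V (toℕ b′)) cell≡′) (cong (λ z → z * Λ + pos true (proj₁ (V z)) v) tb′)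
        left′ : ∀ V → Assemble.value D′ V (b , place x , place y) ≡ suc t * Λ + pos false (proj₁ (V (suc t))) u
        left′ V = trans (cong (λ d → Global.global V (toℕ b) (oriented (odd (toℕ b)) d (coord (place x)) (coord (place y)))) (sym (eq b))) (left V)
        right′ : ∀ V → Assemble.value D′ V (b′ , place x′ , place y′) ≡ suc t * Λ + pos true (proj₁ (V (suc t))) v
        right′ V = trans (cong (λ d → Global.global V (toℕ b′) (oriented (odd (toℕ b′)) d (coord (place x′)) (coord (place y′)))) (sym (eq b′))) (right V)

    -- Window 0 meets only the first layer and window `k` only the last, so neither interleaves
    -- anything and both take the default `sorted`; the `k ∸ 1` windows between are free.
    windows : (Fin (k ∸ 1) → Fin #W) → ℕ → Shuffle m m
    windows f zero    = sorted m m
    windows f (suc t) with t ℕₚ.<? (k ∸ 1)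
    ... | yes h = shuffleOf (f (fromℕ< h))
    ... | no _  = sorted m m

    windows-at : ∀ f (i : Fin (k ∸ 1)) → windows f (suc (toℕ i)) ≡ shuffleOf (f i)
    windows-at f i with toℕ i ℕₚ.<? (k ∸ 1)
    ... | yes h = cong (shuffleOf ∘ f) (Fₚ.fromℕ<-toℕ i h)
    ... | no ¬h = contradiction (Fₚ.toℕ<n i) ¬h

    permOf : (Fin k → Data) → (Fin (k ∸ 1) → Fin #W) → Word (k * (k * k))
    permOf D f = Perm.perm (Assemble.assembled D (windows f))

    permOf-strongly-avoids : ∀ D f → IsPerm (permOf D f) × StronglyAvoids (permOf D f) (identityPattern (suc k))
    permOf-strongly-avoids D f = Perm.perm-isPerm K , Perm.perm-strongly-avoids K
      where K = Assemble.assembled D (windows f)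

    permOf-injective : ∀ D f D′ f′ → permOf D f ≡ permOf D′ f′ → (∀ b → D b ≡ D′ b) × (∀ i → f i ≡ f′ i)
    permOf-injective D f D′ f′ h = layers , λ i → injW _ _ (words i)
      where
      K  = Assemble.assembled D (windows f)
      K′ = Assemble.assembled D′ (windows f′)
      module C  = Compare D D′ (windows f) (windows f′)
      module C′ = Compare D′ D (windows f′) (windows f)
      imp : C.Implies
      imp {x} {y} = same-order K K′ h {x} {y}
      imp′ : C′.Implies
      imp′ {x} {y} = same-order K′ K (sym h) {x} {y}
      layers : ∀ b → D b ≡ D′ b
      layers b = data-determined (D b) (D′ b) (C.layer-order (λ {x} {y} → imp {x} {y}) b) (C′.layer-order (λ {x} {y} → imp′ {x} {y}) b)
      words : ∀ i → proj₁ (shuffleOf (f i)) ≡ proj₁ (shuffleOf (f′ i))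
      words i = pos-determines _ _ (trans (proj₁ (proj₂ s)) (sym (proj₁ (proj₂ s′)))) (trans (proj₂ (proj₂ s)) (sym (proj₂ (proj₂ s′))))
        (λ u v hu hv l → subst₂ (λ a b → pos false (proj₁ a) u < pos true (proj₁ b) v) (windows-at f′ i) (windows-at f′ i)
          (C.window-order (λ {x} {y} → imp {x} {y}) layers (toℕ i) i<k u v (subst (u <_) (proj₁ (proj₂ s)) hu) (subst (v <_) (proj₂ (proj₂ s)) hv)
            (subst₂ (λ a b → pos false (proj₁ a) u < pos true (proj₁ b) v) (sym (windows-at f i)) (sym (windows-at f i)) l)))
        (λ u v hu hv l → subst₂ (λ a b → pos false (proj₁ a) u < pos true (proj₁ b) v) (windows-at f i) (windows-at f i)
          (C′.window-order (λ {x} {y} → imp′ {x} {y}) (sym ∘ layers) (toℕ i) i<k u v (subst (u <_) (proj₁ (proj₂ s)) hu) (subst (v <_) (proj₂ (proj₂ s)) hv)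
            (subst₂ (λ a b → pos false (proj₁ a) u < pos true (proj₁ b) v) (sym (windows-at f′ i)) (sym (windows-at f′ i)) l)))
        where
        s  = shuffleOf (f i)
        s′ = shuffleOf (f′ i)
        i<k : suc (toℕ i) < k
        i<k = ℕₚ.<-≤-trans (s<s (Fₚ.toℕ<n i)) (ℕₚ.≤-reflexive (ℕₚ.m+[n∸m]≡n {1} {k} (nonempty k i)))
          where
          nonempty : ∀ n → Fin (n ∸ 1) → 1 ≤ n
          nonempty (suc n) _ = s≤s z≤n

    #data : ℕ
    #data = #A * (#S * #w)

    dataOf : Fin #data → Data
    dataOf z = fill (proj₁ u) (proj₁ v) (proj₂ v)
      where
      u = remQuot {#A} (#S * #w) z
      v = remQuot {#S} (#w) (proj₂ u)

    dataOf-injective : Injective dataOf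
    dataOf-injective {x} {y} h = trans (sym (Fₚ.combine-remQuot {#A} (#S * #w) x))
      (trans (cong₂ combine (cong Data.corner h) tail) (Fₚ.combine-remQuot {#A} (#S * #w) y))
      where
      tail : F.remainder {#A} (#S * #w) x ≡ F.remainder {#A} (#S * #w) y
      tail = trans (sym (Fₚ.combine-remQuot {#S} (#w) _))
        (trans (cong₂ combine (cong Data.side h) (cong Data.mixing h)) (Fₚ.combine-remQuot {#S} (#w) _))

    finToFun-injective : ∀ {a b} (x y : Fin (a ^ b)) → (∀ i → finToFun {a} {b} x i ≡ finToFun y i) → x ≡ y
    finToFun-injective {a} {b} x y h = trans (sym (Fₚ.funToFin-finToFin {b} {a} x)) (trans (ext _ _ h) (Fₚ.funToFin-finToFin {b} {a} y))
      where
      ext : ∀ {b} (f g : Fin b → Fin a) → (∀ i → f i ≡ g i) → funToFin f ≡ funToFin g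
      ext {zero}  f g h = refl
      ext {suc b} f g h = cong₂ combine (h zero) (ext (f ∘ suc) (g ∘ suc) (h ∘ suc))

    #family : ℕ
    #family = #data ^ k * #W ^ (k ∸ 1)

    member : Fin #family → Word (k * (k * k))
    member z = permOf (dataOf ∘ finToFun {#data} {k} (F.quotient (#W ^ (k ∸ 1)) z))
                      (finToFun {#W} {k ∸ 1} (F.remainder {#data ^ k} (#W ^ (k ∸ 1)) z))

    member-injective : Injective member
    member-injective {x} {y} h = trans (sym (Fₚ.combine-remQuot {#data ^ k} (#W ^ (k ∸ 1)) x))
      (trans (cong₂ combine
               (finToFun-injective {#data} {k} _ _ (λ i → dataOf-injective (proj₁ both i)))
               (finToFun-injective {#W} {k ∸ 1} _ _ (proj₂ both)))
             (Fₚ.combine-remQuot {#data ^ k} (#W ^ (k ∸ 1)) y))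
      where both = permOf-injective _ _ _ _ h

    family-bound : (#A * (#S * #w)) ^ k * #W ^ (k ∸ 1) ≤ #SAv (k * (k * k)) (identityPattern (suc k))
    family-bound = ≤-filter-length (sav? (identityPattern (suc k))) allVecs-complete member
      (λ z → permOf-strongly-avoids _ _) member-injective

-- Numerical estimates for binomials and tableau numbers.

open HookLength
open UpperBound
open Tableaux
open LayerOrder
open Assembly
open import Data.Nat using (_+_; _*_)
open import Data.Nat.Tactic.RingSolver using (solve-∀)

#shuffles≤ : ∀ a b → #shuffles a b ≤ 2 ^ (a + b)
#shuffles≤ zero    b       = ℕₚ.m^n>0 2 b
#shuffles≤ (suc a) zero    = ℕₚ.m^n>0 2 (suc a + 0)
#shuffles≤ (suc a) (suc b) = ℕₚ.≤-trans
  (ℕₚ.+-mono-≤ (#shuffles≤ a (suc b)) (subst (λ z → #shuffles (suc a) b ≤ 2 ^ z) (sym (ℕₚ.+-suc a b)) (#shuffles≤ (suc a) b)))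
  (ℕₚ.≤-reflexive (cong (2 ^ (a + suc b) +_) (sym (ℕₚ.+-identityʳ (2 ^ (a + suc b))))))

-- The factor by which the hook product grows when the rectangle gains a column, and also the
-- quotient of `(p + q) !` by `q !`.
columnProd : ℕ → ℕ → ℕ
columnProd zero    q = 1
columnProd (suc p) q = columnProd p q * suc (p + q)

columnProd≢0 : ∀ p q → ℕ.NonZero (columnProd p q)
columnProd≢0 zero    q = _
columnProd≢0 (suc p) q = ℕₚ.m*n≢0 (columnProd p q) (suc (p + q)) {{columnProd≢0 p q}}

hookProd-suc : ∀ p q → hookProd p (suc q) ≡ hookProd p q * columnProd p q
hookProd-suc zero    q = refl
hookProd-suc (suc p) q = begin
  hookProd p (suc q) * (rowProd p q * suc (p + q))              ≡⟨ cong (_* (rowProd p q * suc (p + q))) (hookProd-suc p q) ⟩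
  hookProd p q * columnProd p q * (rowProd p q * suc (p + q))   ≡⟨ ℕₚ.[m*n]*[o*p]≡[m*o]*[n*p] (hookProd p q) (columnProd p q) (rowProd p q) (suc (p + q)) ⟩
  hookProd p q * rowProd p q * (columnProd p q * suc (p + q))   ∎
  where open ≡-Reasoning

!-+ : ∀ n i → (n + i) ! ≡ n ! * columnProd i n
!-+ n zero    = trans (cong _! (ℕₚ.+-identityʳ n)) (sym (ℕₚ.*-identityʳ (n !)))
!-+ n (suc i) = begin
  (n + suc i) !                          ≡⟨ cong _! (ℕₚ.+-suc n i) ⟩
  suc (n + i) * (n + i) !                ≡⟨ cong₂ _*_ (cong suc (ℕₚ.+-comm n i)) (!-+ n i) ⟩
  suc (i + n) * (n ! * columnProd i n)   ≡⟨ ℕₚ.*-comm (suc (i + n)) _ ⟩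
  n ! * columnProd i n * suc (i + n)     ≡⟨ ℕₚ.*-assoc (n !) _ _ ⟩
  n ! * (columnProd i n * suc (i + n))   ∎
  where open ≡-Reasoning

-- Factor by factor: `i + 1 + p²` is at most `p (i + 1 + p)`.
columnProd-≤ : ∀ p → 1 ≤ p → ∀ i → columnProd i (p * p) ≤ p ^ i * columnProd i p
columnProd-≤ p 1≤p zero    = ℕₚ.≤-refl
columnProd-≤ p 1≤p (suc i) = ℕₚ.≤-trans (ℕₚ.*-mono-≤ (columnProd-≤ p 1≤p i) term)
  (ℕₚ.≤-reflexive (lemma (p ^ i) (columnProd i p) p (suc (i + p))))
  where
  lemma : ∀ a b c d → a * b * (c * d) ≡ c * a * (b * d)
  lemma = solve-∀
  expand : ∀ p i → p * suc (i + p) ≡ p + (p * i + p * p)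
  expand = solve-∀
  term : suc (i + p * p) ≤ p * suc (i + p)
  term = subst (suc (i + p * p) ≤_) (sym (expand p i))
    (ℕₚ.+-mono-≤ 1≤p (ℕₚ.+-monoˡ-≤ (p * p) (ℕₚ.m≤n*m i p {{ℕ.>-nonZero 1≤p}})))

-- By the hook length formula the ratio is the product of `(P² + i) / (P + i)` over `i` from 1 to
-- `P`, and each factor is at most `P`.
#SYT-ratio : ∀ P → 1 ≤ P → #SYT P (suc P) ≤ #SYT P P * P ^ P
#SYT-ratio P 1≤P = ℕₚ.*-cancelʳ-≤ _ _ (H * R) {{ℕₚ.m*n≢0 H R {{hookProd≢0 P P}} {{columnProd≢0 P P}}}} (begin
  #SYT P (suc P) * (H * R)            ≡⟨ cong (#SYT P (suc P) *_) (hookProd-suc P P) ⟨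
  #SYT P (suc P) * hookProd P (suc P) ≡⟨ hook-length P (suc P) ⟩
  (P * suc P) !                       ≡⟨ cong _! (trans (ℕₚ.*-suc P P) (ℕₚ.+-comm P (P * P))) ⟩
  (P * P + P) !                       ≡⟨ !-+ (P * P) P ⟩
  (P * P) ! * columnProd P (P * P)    ≤⟨ ℕₚ.*-monoʳ-≤ ((P * P) !) (columnProd-≤ P 1≤P P) ⟩
  (P * P) ! * (P ^ P * R)             ≡⟨ cong (_* (P ^ P * R)) (hook-length P P) ⟨
  #SYT P P * H * (P ^ P * R)          ≡⟨ lemma (#SYT P P) H (P ^ P) R ⟩
  #SYT P P * P ^ P * (H * R)          ∎)
  where
  open ℕₚ.≤-Reasoning
  H = hookProd P P
  R = columnProd P P
  lemma : ∀ a b c d → a * b * (c * d) ≡ a * c * (b * d)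
  lemma = solve-∀

4p≤2^p : ∀ p → 4 * (4 + p) ≤ 2 ^ (4 + p)
4p≤2^p zero    = ℕₚ.≤-refl
4p≤2^p (suc p) = ℕₚ.≤-trans
  (subst (4 * (5 + p) ≤_) (sym (expand p)) (ℕₚ.m≤m+n (4 * (5 + p)) (12 + 4 * p)))
  (ℕₚ.*-monoʳ-≤ 2 (4p≤2^p p))
  where
  expand : ∀ p → 2 * (4 * (4 + p)) ≡ 4 * (5 + p) + (12 + 4 * p)
  expand = solve-∀

^-distribʳ-* : ∀ k a b → (a * b) ^ k ≡ a ^ k * b ^ k
^-distribʳ-* zero    a b = refl
^-distribʳ-* (suc k) a b = trans (cong (a * b *_) (^-distribʳ-* k a b)) (ℕₚ.[m*n]*[o*p]≡[m*o]*[n*p] a b (a ^ k) (b ^ k))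

-- From `P = 4` on, `4 P ≤ 2 ^ P` can be raised to the power `2 P + 1`, as there is room to enlarge
-- the exponent of 4; `P = 3` is evaluated. For `P = 1` and `P = 2` the inequality fails, so
-- `enough-odd` treats these sizes directly.
power-bound : ∀ p → 4 ^ suc (3 + p) * (3 + p) ^ suc ((3 + p) + (3 + p)) ≤ (2 ^ (3 + p)) ^ suc ((3 + p) + (3 + p))
power-bound zero    = ℕₚ.≤ᵇ⇒≤ _ _ tt
power-bound (suc p) = begin
  4 ^ suc P * P ^ K          ≤⟨ ℕₚ.*-monoˡ-≤ (P ^ K) (ℕₚ.^-monoʳ-≤ 4 (s≤s (ℕₚ.m≤m+n P P))) ⟩
  4 ^ K * P ^ K              ≡⟨ ^-distribʳ-* K 4 P ⟨
  (4 * P) ^ K                ≤⟨ ℕₚ.^-monoˡ-≤ K (4p≤2^p p) ⟩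
  (2 ^ P) ^ K                ∎
  where
  open ℕₚ.≤-Reasoning
  P = 4 + p
  K = suc (P + P)

-- What the symmetric blocks must pay for: the binomial of the one missing window and a second
-- tableau in each of the `k` layers.
Enough : ℕ → ℕ → ℕ → Set
Enough p q k = #shuffles (p * q) (p * q) * #SYT p q ^ k ≤ (#SYT p p * 2 ^ (p * p)) ^ k

-- For even `k` both tableaux are square and cancel; what remains is C(2N,N) ≤ 2^(2N) ≤ 2^(2pN).
enough-even : ∀ p → 1 ≤ p → Enough p p (p + p)
enough-even p 1≤p = go (#SYT p p) (#shuffles N N) (#shuffles≤ N N)
  where
  open ℕₚ.≤-Reasoning
  K = p + p
  N = p * p
  exponent : N + N ≤ N * K
  exponent = subst (N + N ≤_) (sym (ℕₚ.*-distribˡ-+ N p p)) (ℕₚ.+-mono-≤ N≤ N≤)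
    where
    N≤ : N ≤ N * p
    N≤ = ℕₚ.m≤m*n N p {{ℕ.>-nonZero 1≤p}}
  go : ∀ s c → c ≤ 2 ^ (N + N) → c * s ^ K ≤ (s * 2 ^ N) ^ K
  go s c h = begin
    c * s ^ K                  ≤⟨ ℕₚ.*-monoˡ-≤ (s ^ K) h ⟩
    2 ^ (N + N) * s ^ K        ≡⟨ ℕₚ.*-comm (2 ^ (N + N)) (s ^ K) ⟩
    s ^ K * 2 ^ (N + N)        ≤⟨ ℕₚ.*-monoʳ-≤ (s ^ K) (ℕₚ.^-monoʳ-≤ 2 exponent) ⟩
    s ^ K * 2 ^ (N * K)        ≡⟨ cong (s ^ K *_) (ℕₚ.^-*-assoc 2 N K) ⟨
    s ^ K * (2 ^ N) ^ K        ≡⟨ ^-distribʳ-* K s (2 ^ N) ⟨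
    (s * 2 ^ N) ^ K            ∎

-- Once `s ^ K` is split off, everything left is a `P`-th power, because `P` divides both
-- `2 P (P + 1)` and the exponent `P K`; the last hypothesis is the `P`-th root of the remaining
-- inequality.
odd-estimate : ∀ P K a s c → a ≤ s * P ^ P → c ≤ 2 ^ (P * suc P + P * suc P) →
  4 ^ suc P * P ^ K ≤ (2 ^ P) ^ K → c * a ^ K ≤ (s * 2 ^ (P * P)) ^ K
odd-estimate P K a s c ha hc hP = begin
  c * a ^ K                                ≤⟨ ℕₚ.*-mono-≤ hc (ℕₚ.^-monoˡ-≤ K ha) ⟩
  2 ^ (M + M) * (s * P ^ P) ^ K            ≡⟨ cong (2 ^ (M + M) *_) (^-distribʳ-* K s (P ^ P)) ⟩
  2 ^ (M + M) * (s ^ K * (P ^ P) ^ K)      ≡⟨ swap (2 ^ (M + M)) (s ^ K) ((P ^ P) ^ K) ⟩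
  s ^ K * (2 ^ (M + M) * (P ^ P) ^ K)      ≡⟨ cong (s ^ K *_) (cong₂ _*_ power₁ (power₂ P P K)) ⟩
  s ^ K * ((4 ^ suc P) ^ P * (P ^ K) ^ P)  ≡⟨ cong (s ^ K *_) (^-distribʳ-* P (4 ^ suc P) (P ^ K)) ⟨
  s ^ K * (4 ^ suc P * P ^ K) ^ P          ≤⟨ ℕₚ.*-monoʳ-≤ (s ^ K) (ℕₚ.^-monoˡ-≤ P hP) ⟩
  s ^ K * ((2 ^ P) ^ K) ^ P                ≡⟨ cong (s ^ K *_) (trans (power₂ (2 ^ P) K P) (cong (_^ K) (ℕₚ.^-*-assoc 2 P P))) ⟩
  s ^ K * (2 ^ (P * P)) ^ K                ≡⟨ ^-distribʳ-* K s (2 ^ (P * P)) ⟨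
  (s * 2 ^ (P * P)) ^ K                    ∎
  where
  open ℕₚ.≤-Reasoning
  M = P * suc P
  swap : ∀ a b c → a * (b * c) ≡ b * (a * c)
  swap = solve-∀
  power₂ : ∀ x i j → (x ^ i) ^ j ≡ (x ^ j) ^ i
  power₂ x i j = trans (ℕₚ.^-*-assoc x i j) (trans (cong (x ^_) (ℕₚ.*-comm i j)) (sym (ℕₚ.^-*-assoc x j i)))
  double : ∀ p → p * suc p + p * suc p ≡ 2 * suc p * p
  double = solve-∀
  power₁ : 2 ^ (M + M) ≡ (4 ^ suc P) ^ P
  power₁ = trans (cong (2 ^_) (double P)) (trans (sym (ℕₚ.^-*-assoc 2 (2 * suc P) P)) (cong (_^ P) (sym (ℕₚ.^-*-assoc 2 2 (suc P)))))

enough-odd-large : ∀ P → 1 ≤ P → 4 ^ suc P * P ^ suc (P + P) ≤ (2 ^ P) ^ suc (P + P) → Enough P (suc P) (suc (P + P))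
enough-odd-large P h hP = odd-estimate P (suc (P + P)) (#SYT P (suc P)) (#SYT P P) (#shuffles (P * suc P) (P * suc P))
  (#SYT-ratio P h) (#shuffles≤ (P * suc P) (P * suc P)) hP

enough-odd : ∀ p → Enough p (suc p) (suc (p + p))
enough-odd 0                   = ℕₚ.≤ᵇ⇒≤ (#shuffles 0 0 * #SYT 0 1 ^ 1) ((#SYT 0 0 * 2 ^ 0) ^ 1) tt
enough-odd 1                   = ℕₚ.≤ᵇ⇒≤ (#shuffles 2 2 * #SYT 1 2 ^ 3) ((#SYT 1 1 * 2 ^ 1) ^ 3) tt
enough-odd 2                   = ℕₚ.≤ᵇ⇒≤ (#shuffles 6 6 * #SYT 2 3 ^ 5) ((#SYT 2 2 * 2 ^ 4) ^ 5) tt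
enough-odd (suc (suc (suc p))) = enough-odd-large (3 + p) (s≤s z≤n) (power-bound p)

-- The family already contains `a ^ k` and `c ^ (k ∸ 1)`; the missing `c` and the second `a ^ k` are
-- exchanged for `d ^ k`.
family-size : ∀ c a d k → 1 ≤ k → c * a ^ k ≤ d ^ k → c ^ k * a ^ (2 * k) ≤ (a * d) ^ k * c ^ (k ∸ 1)
family-size c a d (suc k) _ h = begin
  c ^ K * a ^ (2 * K)                 ≡⟨ cong (c ^ K *_) (trans (cong (λ z → a ^ (K + z)) (ℕₚ.+-identityʳ K)) (ℕₚ.^-distribˡ-+-* a K K)) ⟩
  c * c ^ k * (a ^ K * a ^ K)         ≡⟨ lemma₁ c (c ^ k) (a ^ K) ⟩
  a ^ K * c ^ k * (c * a ^ K)         ≤⟨ ℕₚ.*-monoʳ-≤ (a ^ K * c ^ k) h ⟩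
  a ^ K * c ^ k * d ^ K               ≡⟨ lemma₂ (a ^ K) (c ^ k) (d ^ K) ⟩
  a ^ K * d ^ K * c ^ k               ≡⟨ cong (_* c ^ k) (^-distribʳ-* K a d) ⟨
  (a * d) ^ K * c ^ k                 ∎
  where
  open ℕₚ.≤-Reasoning
  K = suc k
  lemma₁ : ∀ c c′ a → c * c′ * (a * a) ≡ a * c′ * (c * a)
  lemma₁ = solve-∀
  lemma₂ : ∀ a c d → a * c * d ≡ a * d * c
  lemma₂ = solve-∀

family-≤ : ∀ p e (e≤1 : e ≤ 1) → let k = p + (e + p) in
  (#SYT p (p + e) * (#SYT p p * 2 ^ (p * p))) ^ k * #shuffles (p * (p + e)) (p * (p + e)) ^ (k ∸ 1)
    ≤ #SAv (k * (k * k)) (identityPattern (suc k))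
family-≤ p e e≤1 = Family.family-bound p e e≤1 (p + (e + p))
  coord place coord-place coord-injective coord-mono coord-opposite
  (#SYT p (p + e)) (#SYT p p) (2 ^ (p * p)) (#shuffles (p * (p + e)) (p * (p + e)))
  (tableau p (p + e)) (tableau-standard p (p + e)) (tableau-injective p (p + e))
  (tableau p p) (tableau-standard p p) (tableau-injective p p)
  (bits (p * p)) (bits-length (p * p)) (bits-injective (p * p))
  (shuffle (p * (p + e)) (p * (p + e))) (shuffle-injective (p * (p + e)) (p * (p + e)))
  where open Embedding p e e≤1

-- The lower bound for even and odd k.

LowerBound : ℕ → Set
LowerBound k = (((k * k) / 2) C ((k * k) / 4)) ^ k * fRect ⌊ k /2⌋ ⌈ k /2⌉ ^ (2 * k)
  ≤ #SAv (k ^ 3) (identityPattern (suc k))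

cube : ∀ k → k * (k * k) ≡ k ^ 3
cube k = cong (λ z → k * (k * z)) (sym (ℕₚ.*-identityʳ k))

lower-from-family : ∀ p e k → e ≤ 1 → k ≡ p + (e + p) → 1 ≤ k → Enough p (p + e) k →
  ⌊ k /2⌋ ≡ p → ⌈ k /2⌉ ≡ p + e → (k * k) / 2 ≡ p * (p + e) + p * (p + e) → (k * k) / 4 ≡ p * (p + e) → LowerBound k
lower-from-family p e k e≤1 refl 1≤k enough fl ce half quarter =
  lower (#SAv (k ^ 3) (identityPattern (suc k)))
    (subst (λ n → family ≤ #SAv n (identityPattern (suc k))) (cube k) (family-≤ p e e≤1))
  where
  open ℕₚ.≤-Reasoning
  m = p * (p + e)
  family = (#SYT p (p + e) * (#SYT p p * 2 ^ (p * p))) ^ k * #shuffles m m ^ (k ∸ 1)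
  lower : ∀ s → family ≤ s → (((k * k) / 2) C ((k * k) / 4)) ^ k * fRect ⌊ k /2⌋ ⌈ k /2⌉ ^ (2 * k) ≤ s
  lower s h = begin
    (((k * k) / 2) C ((k * k) / 4)) ^ k * fRect ⌊ k /2⌋ ⌈ k /2⌉ ^ (2 * k)
      ≡⟨ cong₂ (λ u v → u ^ k * v ^ (2 * k)) (trans (cong₂ _C_ half quarter) (sym (#shuffles≡C m m)))
                                             (trans (cong₂ fRect fl ce) (fRect≡#words p (p + e))) ⟩
    #shuffles m m ^ k * #SYT p (p + e) ^ (2 * k)
      ≤⟨ family-size (#shuffles m m) (#SYT p (p + e)) (#SYT p p * 2 ^ (p * p)) k 1≤k enough ⟩
    family
      ≤⟨ h ⟩
    s ∎

-- With `m = p (p + e)`, the square of `k` is `4 m` or `4 m + 1`, so `r` is 0 or 1 and the divisors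
-- 2 and 4 give `m + m` and `m`.
quotient : ∀ r n d .{{_ : ℕ.NonZero d}} → r / d ≡ 0 → (r + n * d) / d ≡ n
quotient r n d h = trans (DivMod.+-distrib-/-∣ʳ r (divides n refl)) (cong₂ _+_ h (DivMod.m*n/n≡m n d))

data Halves : ℕ → Set where
  even-double : ∀ p → Halves (p + p)
  odd-double  : ∀ p → Halves (suc (p + p))

halves : ∀ k → Halves k
halves zero = even-double 0
halves (suc k) with halves k
... | even-double p = odd-double p
... | odd-double p  = subst Halves (cong suc (ℕₚ.+-suc p p)) (even-double (suc p))

lower-even : ∀ p → 1 ≤ p → 1 ≤ p + p → LowerBound (p + p)
lower-even p 1≤p 1≤k = lower-from-family p 0 (p + p) z≤n refl 1≤k
  (subst (λ z → Enough p z (p + p)) (sym (ℕₚ.+-identityʳ p)) (enough-even p 1≤p))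
  (sym (ℕₚ.n≡⌊n+n/2⌋ p)) (trans (sym (ℕₚ.n≡⌈n+n/2⌉ p)) (sym (ℕₚ.+-identityʳ p)))
  (trans (cong (_/ 2) (half p)) (quotient 0 (p * (p + 0) + p * (p + 0)) 2 refl))
  (trans (cong (_/ 4) (quarter p)) (quotient 0 (p * (p + 0)) 4 refl))
  where
  half : ∀ p → (p + p) * (p + p) ≡ 0 + (p * (p + 0) + p * (p + 0)) * 2
  half = solve-∀
  quarter : ∀ p → (p + p) * (p + p) ≡ 0 + p * (p + 0) * 4
  quarter = solve-∀

lower-odd : ∀ p → LowerBound (suc (p + p))
lower-odd p = lower-from-family p 1 (suc (p + p)) ℕₚ.≤-refl (sym (ℕₚ.+-suc p p)) (s≤s z≤n)
  (subst (λ z → Enough p z (suc (p + p))) (sym (ℕₚ.+-comm p 1)) (enough-odd p))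
  (sym (ℕₚ.n≡⌈n+n/2⌉ p)) (trans (cong suc (sym (ℕₚ.n≡⌊n+n/2⌋ p))) (sym (ℕₚ.+-comm p 1)))
  (trans (cong (_/ 2) (half p)) (quotient 1 (p * (p + 1) + p * (p + 1)) 2 refl))
  (trans (cong (_/ 4) (quarter p)) (quotient 1 (p * (p + 1)) 4 refl))
  where
  half : ∀ p → suc (p + p) * suc (p + p) ≡ 1 + (p * (p + 1) + p * (p + 1)) * 2
  half = solve-∀
  quarter : ∀ p → suc (p + p) * suc (p + p) ≡ 1 + p * (p + 1) * 4
  quarter = solve-∀

lower-bound : ∀ {k} → Halves k → 1 ≤ k → LowerBound k
lower-bound (even-double (suc p)) 1≤k = lower-even (suc p) (s≤s z≤n) 1≤k
lower-bound (odd-double p)        1≤k = lower-odd p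

theorem1p1 : (k : ℕ) → 1 ≤ k →
    (((k * k) / 2) C ((k * k) / 4)) ^ k * fRect ⌊ k /2⌋ ⌈ k /2⌉ ^ (2 * k)
    ≤ #SAv (k ^ 3) (identityPattern (suc k))
    × #SAv (k ^ 3) (identityPattern (suc k)) ≤ fRect (k * k) k ^ 2
theorem1p1 k 1≤k = lower-bound (halves k) 1≤k , upper-bound k (k ^ 3) (trans (sym (cube k)) (sym (ℕₚ.*-assoc k k k)))
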